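{- For every integer $n\geq 2$, if $G=(V,A,s,t)$ is a doubly-rooted digraph with $|V|=n$ and $|A|=4n-1$, and $B\subseteq A$ with $|B|\leq 3$, then $T(G,B)=0$.
   Context: A doubly-rooted digraph $G=(V,A,s,t)$: finite vertex set $V$, finite edge set $A$, each edge $a$ with source $a^-$ and target $a^+$ (loops and multiple edges allowed), roots $s,t\in V$. For an enumeration $A=\{a_1,\dots,a_k\}$ and $B\subseteq A$: $M(B)=\{j\in[k]:a_j\in B\}$; $P(G)=\{\sigma\in\mathfrak{S}_k: a_{\sigma(1)}^-=s,\ a_{\sigma(k)}^+=t,\ a_{\sigma(j+1)}^-=a_{\sigma(j)}^+\ \forall j\in[k-1]\}$; for $M=\{j_1<\dots<j_\ell\}\subseteq[k]$ and $\sigma\in\mathfrak{S}_k$, $\sigma_M\in\mathfrak{S}_\ell$ is $\sigma_M(g)=|\{h\in[\ell]:\sigma(j_h)\le\sigma(j_g)\}|$; $S(G,B)=\sum_{\sigma\in P(G)}\mathrm{sgn}(\sigma)\mathrm{sgn}(\sigma_{M(B)})$ and $T(G,B)=|S(G,B)|$ (independent of the enumeration).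
   Formalization: In S(G,B) the second sign is taken of the inverse, sgn((σ⁻¹)_{M(B)}), i.e. the order in which the trail visits the edges of B; with σ_{M(B)} as written, T(G,B) would depend on the enumeration of A. -}

module Defs where

open import Data.Bool.Base using (Bool)
open import Data.Fin.Base using (Fin; zero; toℕ)
import Data.Fin.Properties as Fin
open import Data.Fin.Permutation using (Permutation′; _⟨$⟩ʳ_; flip; insert) renaming (id to idₚ)
open import Data.Fin.Subset using (Subset; ∣_∣)
open import Data.Fin.Subset.Properties using (_∈?_)
open import Data.Integer.Base as ℤ using (ℤ; 0ℤ; -1ℤ)
open import Data.List.Base using (List; [_]; map; foldr; filter; length; lookup; allFin; cartesianProduct; cartesianProductWith)
open import Data.Nat.Base using (ℕ; zero; suc)
import Data.Nat.Properties as ℕ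
open import Data.Product.Base using (_×_; proj₁; proj₂)
open import Data.Vec.Base using (tabulate)
open import Function.Base using (_∘_)
open import Function.Bundles using (_↔_; Inverse)
open import Function.Construct.Symmetry using (↔-sym)
open import Function.Properties.Inverse using (↔⇒↣)
open import Relation.Binary.Definitions using (DecidableEquality)
open import Relation.Binary.PropositionalEquality.Core using (_≡_)
open import Relation.Nullary.Decidable using (Dec; _×-dec_; _→-dec_)

-- Every element of 𝔖ₖ, exactly once: insert zero j π sends zero to j and
-- acts on the remaining points as π does.
permutations : ∀ k → List (Permutation′ k)
permutations zero    = [ idₚ ]
permutations (suc k) = cartesianProductWith (insert zero) (allFin (suc k)) (permutations k)

-- Permutations are fed to inversions and sgn in one-line notation; values
-- are in ℕ so that both 0-based and 1-based words are covered.
inversions : ∀ {k} → (Fin k → ℕ) → ℕ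
inversions {k} w = length (filter
  (λ p → (proj₁ p Fin.<? proj₂ p) ×-dec (w (proj₂ p) ℕ.<? w (proj₁ p)))
  (cartesianProduct (allFin k) (allFin k)))

sgn : ∀ {k} → (Fin k → ℕ) → ℤ
sgn w = -1ℤ ℤ.^ inversions w

-- M = {j₁ < … < j_ℓ}, in increasing order.
elements : ∀ {k} → Subset k → List (Fin k)
elements {k} M = filter (_∈? M) (allFin k)

-- The one-line notation (with values 1, …, ℓ) of σ_M:
-- σ_M(g) = |{h ∈ [ℓ] : σ(j_h) ≤ σ(j_g)}|.
restrict : ∀ {k} → Permutation′ k → (M : Subset k) → Fin (length (elements M)) → ℕ
restrict σ M g = length (filter (λ h → (σ ⟨$⟩ʳ j h) Fin.≤? (σ ⟨$⟩ʳ j g)) (allFin _))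
  where j = lookup (elements M)

-- Finiteness of V and A is given by explicit enumerations; the one of A is
-- the enumeration a₁, …, aₖ entering the definition of S and T.
record DoublyRootedDigraph : Set₁ where
  field
    V A     : Set
    ∣V∣ ∣A∣ : ℕ
    enumV   : Fin ∣V∣ ↔ V
    enumA   : Fin ∣A∣ ↔ A
    _⁻ _⁺   : A → V
    s t     : V

  a : Fin ∣A∣ → A
  a = Inverse.to enumA

  _≟_ : DecidableEquality V
  _≟_ = Fin.inj⇒≟ (↔⇒↣ (↔-sym enumV))

  -- σ i is the index of the edge in position i.
  IsTrail : Permutation′ ∣A∣ → Set
  IsTrail σ =
      (∀ i → toℕ i ≡ 0 → (a (σ ⟨$⟩ʳ i) ⁻) ≡ s)
    × (∀ i → suc (toℕ i) ≡ ∣A∣ → (a (σ ⟨$⟩ʳ i) ⁺) ≡ t)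
    × (∀ i j → toℕ j ≡ suc (toℕ i) → (a (σ ⟨$⟩ʳ j) ⁻) ≡ (a (σ ⟨$⟩ʳ i) ⁺))

  isTrail? : ∀ σ → Dec (IsTrail σ)
  isTrail? σ =
          Fin.all? (λ i → (toℕ i ℕ.≟ 0) →-dec ((a (σ ⟨$⟩ʳ i) ⁻) ≟ s))
    ×-dec Fin.all? (λ i → (suc (toℕ i) ℕ.≟ ∣A∣) →-dec ((a (σ ⟨$⟩ʳ i) ⁺) ≟ t))
    ×-dec Fin.all? (λ i → Fin.all? (λ j →
            (toℕ j ℕ.≟ suc (toℕ i)) →-dec ((a (σ ⟨$⟩ʳ j) ⁻) ≟ (a (σ ⟨$⟩ʳ i) ⁺))))

  P : List (Permutation′ ∣A∣)
  P = filter isTrail? (permutations ∣A∣)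

  -- A subset B ⊆ A is given by its characteristic function.
  M : (A → Bool) → Subset ∣A∣
  M B = tabulate (B ∘ a)

  -- |B|, computed as |M(B)|; a is a bijection.
  card : (A → Bool) → ℕ
  card B = ∣ M B ∣

  -- The elements of M(B) are indices of edges, whereas a trail σ takes
  -- positions to indices. The second sign is that of the order in which the
  -- trail visits the edges of B, so it is taken of (σ⁻¹)_{M(B)}. With
  -- σ_{M(B)} instead, |S| would depend on the enumeration of A.
  S : (A → Bool) → ℤ
  S B = foldr ℤ._+_ 0ℤ (map (λ σ → sgn (toℕ ∘ (σ ⟨$⟩ʳ_)) ℤ.* sgn (restrict (flip σ) (M B))) P)

  T : (A → Bool) → ℕ
  T B = ℤ.∣ S B ∣

open DoublyRootedDigraph public

{-# OPTIONS --safe #-}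
module Submission where

-- Attach an odd (anticommuting) variable to every edge outside B and an even variable of square zero to every
-- edge of B, and let X and b be the two adjacency matrices. Up to sign, S(G,B) is the top coefficient of an entry
-- of the alternating product g X g′ X g ⋯ with g = (1 - b)⁻¹ and g′ = (1 + b)⁻¹, so it suffices that U²ⁿ⁻² = 0 for
-- U = X g′ X g, everything being of order at most 3 in b.
--
-- Since X is odd, tr Uᵏ changes sign under b ↦ -b, that is, when X g′ X g is replaced by X g X g′. Comparing the
-- Cayley–Hamilton identities of these two matrices gives, for n ≥ 3, U²ⁿ⁻² = -2 q Uⁿ⁻¹, where q = ∑ γᵢγⱼ over
-- i + j = n - 1 and γₖ = tr(X²ᵏ b). To first order in b, the Cayley–Hamilton identities of X² + b and X² + X b X
-- give ∑ᵢ γᵢ X²⁽ᵐ⁻ⁱ⁾ = 0 for m ≥ n. From this q X²ⁿ⁻² equals n times itself, hence vanishes, and its derivative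
-- in the direction X ↦ c X forces q Uⁿ⁻¹ = 0. For n = 2 the product of any two entries of X² is zero, because they
-- involve only three odd elements.

open import Algebra.Bundles using (CommutativeRing; Ring)
open import Algebra.Structures using (IsRing)
import Data.Bool.Base as 𝔹
open import Data.Bool.Base using (Bool; true; false; not; if_then_else_; _∧_)
import Data.Bool.Properties as Bool
open import Data.Empty using (⊥-elim)
open import Data.Fin.Base as Fin using (Fin; zero; suc; toℕ; punchIn)
import Data.Fin.Permutation as Perm
open import Data.Fin.Permutation using (Permutation′; _⟨$⟩ʳ_; _⟨$⟩ˡ_; flip; insert)
import Data.Fin.Properties as Fin
open import Data.Fin.Subset using (∣_∣)
open import Data.Fin.Subset.Properties using (_∈?_)
open import Data.Integer.Base as ℤ using (ℤ; 0ℤ; 1ℤ; -1ℤ)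
import Data.Integer.Properties as ℤ
open import Data.List.Base using (List; []; _∷_; _++_; map; foldr; filter; length; lookup; allFin; tabulate; cartesianProduct; cartesianProductWith)
import Data.List.Properties as List
open import Data.Maybe.Base using (Maybe; just; nothing)
open import Data.Nat.Base as ℕ using (ℕ; zero; suc; s≤s; z≤n; s<s; _<ᵇ_; _≤ᵇ_)
import Data.Nat.Properties as ℕ
import Data.Nat.Solver as ℕ
open import Data.Product.Base using (_,_; proj₁; proj₂) renaming (_×_ to _⨯_)
open import Data.Rational.Base as ℚ using (ℚ; 0ℚ; 1ℚ)
open import Data.Rational.Literals using (fromℤ)
import Data.Rational.Properties as ℚ
import Data.Rational.Unnormalised.Base as ℚᵘ
import Data.Rational.Unnormalised.Properties as ℚᵘ
open import Data.Unit.Base using (⊤; tt)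
open import Data.Vec.Base as Vec using (Vec; []; _∷_)
open import Data.Vec.N-ary using (N-ary; ∀ⁿ; curryⁿ; _$ⁿ_)
open import Function.Base using (_∘_; id)
open import Function.Bundles using (Inverse)
open import Level using (0ℓ)
open import Relation.Binary.Definitions using (tri<; tri≈; tri>)
open import Relation.Binary.PropositionalEquality as ≡ using (_≡_; _≢_)
open import Relation.Nullary.Decidable using (dec-true; dec-false)
open import Relation.Nullary.Decidable.Core using (Dec; yes; no; does)
open import Relation.Nullary.Negation using (contradiction)
open import Relation.Unary using (Decidable)
open import Defs using (permutations; inversions; sgn; elements; restrict)

-- Edges of B commute with each other but anticommute with the remaining edges, whereas even
-- variables commute with everything. The missing sign comes from the involution `ρ`, which is b ↦
-- -b; this is why g and g′ alternate. The exponent comes from counting: at least (4n - 1) - 3 =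
-- 2(2n - 2) edges lie outside B, and U has two factors X. The guiding principle is parity. `ρ` acts
-- on the part of order j in b by (-1)ʲ, and order 4 is zero. Hence an element of order 3 fixed by
-- `ρ` vanishes, and one of order 2 negated by `ρ` has order 3. Identities are therefore proved
-- modulo order 2 or 3, where little survives, and then upgraded to the order above. The obstacle is
-- the second order: there the characteristic polynomial of U has terms in q, and the only one that
-- is not removed directly is q Uⁿ⁻¹. Its first-order part needs a derivative, which is taken by
-- adjoining an even η with η² = 0. This is why all statements are made over an arbitrary super
-- ring. Rational coefficients are used because Newton's recursion divides by integers.

-- Deciding identities in noncommutative rings

module Expression where

  infixl 6 _⊞_ _⊖_
  infixl 7 _⊠_
  infix 8 ⊟_
  data Expr (n : ℕ) : Set where
    var : Fin n → Expr n
    _⊞_ _⊠_ : Expr n → Expr n → Expr n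
    ⊟_ : Expr n → Expr n
    𝟘 𝟙 : Expr n

  _⊖_ : ∀ {n} → Expr n → Expr n → Expr n
  e ⊖ f = e ⊞ ⊟ f

  -- A signed monomial, `true` standing for the sign +. Integer coefficients are represented by
  -- repetition, so collecting terms only ever means cancelling opposite copies.
  Term : ℕ → Set
  Term n = Bool ⨯ List (Fin n)

  infix 4 _⊜_
  _⊜_ : ∀ {n} → Expr n → Expr n → Expr n ⨯ Expr n
  _⊜_ = _,_

  eqv : Bool → Bool → Bool
  eqv true s = s
  eqv false s = not s

  neg : ∀ {n} → Term n → Term n
  neg (s , w) = not s , w

  times : ∀ {n} → Term n → Term n → Term n
  times (s , w) (s′ , w′) = eqv s s′ , w ++ w′

  scale : ∀ {n} → Term n → List (Term n) → List (Term n)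
  scale t = map (times t)

  mult : ∀ {n} → List (Term n) → List (Term n) → List (Term n)
  mult [] us = []
  mult (t ∷ ts) us = scale t us ++ mult ts us

  -- What is removed is one copy of the negative of the given term; `nothing` means that there is
  -- none to cancel.
  delete : ∀ {n} → Term n → List (Term n) → Maybe (List (Term n))
  delete t [] = nothing
  delete (s , w) ((s′ , w′) ∷ ts) with s′ Bool.≟ not s | List.≡-dec Fin._≟_ w w′ | delete (s , w) ts
  ... | yes _ | yes _ | _ = just ts
  ... | _ | _ | just us = just ((s′ , w′) ∷ us)
  ... | _ | _ | nothing = nothing

  cons : ∀ {n} → Term n → List (Term n) → List (Term n)
  cons t ts with delete t ts
  ... | just us = us
  ... | nothing = t ∷ ts

  reduce : ∀ {n} → List (Term n) → List (Term n)
  reduce = foldr cons []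

  expand : ∀ {n} → Expr n → List (Term n)
  expand (var i) = (true , i ∷ []) ∷ []
  expand (e ⊞ f) = expand e ++ expand f
  expand (e ⊠ f) = mult (expand e) (expand f)
  expand (⊟ e) = map neg (expand e)
  expand 𝟘 = []
  expand 𝟙 = (true , []) ∷ []

open Expression using (_⊞_; _⊠_; ⊟_; _⊖_; 𝟘; 𝟙; _⊜_)

module NonCommSolver (𝓡 : Ring 0ℓ 0ℓ) where
  open Ring 𝓡
  open import Algebra.Properties.Ring 𝓡
  open import Relation.Binary.Reasoning.Setoid setoid
  open Expression

  ⟦_⟧ : ∀ {n} → Expr n → Vec Carrier n → Carrier
  ⟦ var i ⟧ ρ = Vec.lookup ρ i
  ⟦ e ⊞ f ⟧ ρ = ⟦ e ⟧ ρ + ⟦ f ⟧ ρ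
  ⟦ e ⊠ f ⟧ ρ = ⟦ e ⟧ ρ * ⟦ f ⟧ ρ
  ⟦ ⊟ e ⟧ ρ = - ⟦ e ⟧ ρ
  ⟦ 𝟘 ⟧ ρ = 0#
  ⟦ 𝟙 ⟧ ρ = 1#

  word : ∀ {n} → List (Fin n) → Vec Carrier n → Carrier
  word [] ρ = 1#
  word (i ∷ w) ρ = Vec.lookup ρ i * word w ρ

  signed : Bool → Carrier → Carrier
  signed true x = x
  signed false x = - x

  term : ∀ {n} → Term n → Vec Carrier n → Carrier
  term (s , w) ρ = signed s (word w ρ)

  total : ∀ {n} → List (Term n) → Vec Carrier n → Carrier
  total [] ρ = 0#
  total (t ∷ ts) ρ = term t ρ + total ts ρ

  signed-not : ∀ s x → signed (not s) x ≈ - signed s x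
  signed-not true x = refl
  signed-not false x = sym (-‿involutive x)

  signed-* : ∀ s s′ x y → signed (eqv s s′) (x * y) ≈ signed s x * signed s′ y
  signed-* true true x y = refl
  signed-* true false x y = -‿distribʳ-* x y
  signed-* false true x y = -‿distribˡ-* x y
  signed-* false false x y = begin
    x * y ≈⟨ -‿involutive _ ⟨
    - - (x * y) ≈⟨ -‿cong (-‿distribˡ-* x y) ⟩
    - (- x * y) ≈⟨ -‿distribʳ-* _ y ⟩
    - x * - y ∎

  signed-cong : ∀ s {x y} → x ≈ y → signed s x ≈ signed s y
  signed-cong true p = p
  signed-cong false p = -‿cong p

  word-++ : ∀ {n} (w w′ : List (Fin n)) ρ → word (w ++ w′) ρ ≈ word w ρ * word w′ ρ
  word-++ [] w′ ρ = sym (*-identityˡ _)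
  word-++ (i ∷ w) w′ ρ = trans (*-congˡ (word-++ w w′ ρ)) (sym (*-assoc _ _ _))

  total-++ : ∀ {n} (ts us : List (Term n)) ρ → total (ts ++ us) ρ ≈ total ts ρ + total us ρ
  total-++ [] us ρ = sym (+-identityˡ _)
  total-++ (t ∷ ts) us ρ = trans (+-congˡ (total-++ ts us ρ)) (sym (+-assoc _ _ _))

  total-neg : ∀ {n} (ts : List (Term n)) ρ → total (map neg ts) ρ ≈ - total ts ρ
  total-neg [] ρ = sym -0#≈0#
  total-neg ((s , w) ∷ ts) ρ = trans (+-cong (signed-not s _) (total-neg ts ρ)) (-‿+-comm _ _)

  total-scale : ∀ {n} t (us : List (Term n)) ρ → total (scale t us) ρ ≈ term t ρ * total us ρ
  total-scale t [] ρ = sym (zeroʳ _)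
  total-scale t@(s , w) ((s′ , w′) ∷ us) ρ = begin
    signed (eqv s s′) (word (w ++ w′) ρ) + total (scale t us) ρ
      ≈⟨ +-cong (trans (signed-cong (eqv s s′) (word-++ w w′ ρ)) (signed-* s s′ _ _)) (total-scale t us ρ) ⟩
    term t ρ * term (s′ , w′) ρ + term t ρ * total us ρ ≈⟨ distribˡ _ _ _ ⟨
    term t ρ * (term (s′ , w′) ρ + total us ρ) ∎

  total-mult : ∀ {n} (ts us : List (Term n)) ρ → total (mult ts us) ρ ≈ total ts ρ * total us ρ
  total-mult [] us ρ = sym (zeroˡ _)
  total-mult (t ∷ ts) us ρ = begin
    total (scale t us ++ mult ts us) ρ ≈⟨ total-++ (scale t us) (mult ts us) ρ ⟩
    total (scale t us) ρ + total (mult ts us) ρ ≈⟨ +-cong (total-scale t us ρ) (total-mult ts us ρ) ⟩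
    term t ρ * total us ρ + total ts ρ * total us ρ ≈⟨ distribʳ _ _ _ ⟨
    (term t ρ + total ts ρ) * total us ρ ∎

  expand-sound : ∀ {n} (e : Expr n) ρ → total (expand e) ρ ≈ ⟦ e ⟧ ρ
  expand-sound (var i) ρ = trans (+-identityʳ _) (*-identityʳ _)
  expand-sound (e ⊞ f) ρ = trans (total-++ (expand e) _ ρ) (+-cong (expand-sound e ρ) (expand-sound f ρ))
  expand-sound (e ⊠ f) ρ = trans (total-mult (expand e) _ ρ) (*-cong (expand-sound e ρ) (expand-sound f ρ))
  expand-sound (⊟ e) ρ = trans (total-neg (expand e) ρ) (-‿cong (expand-sound e ρ))
  expand-sound 𝟘 ρ = refl
  expand-sound 𝟙 ρ = +-identityʳ _

  swap-front : ∀ x y z → x + (y + z) ≈ y + (x + z)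
  swap-front x y z = trans (sym (+-assoc x y z)) (trans (+-congʳ (+-comm x y)) (+-assoc y x z))

  delete-sound : ∀ {n} t (ts : List (Term n)) {us} ρ → delete t ts ≡ just us → total us ρ ≈ term t ρ + total ts ρ
  delete-sound (s , w) ((s′ , w′) ∷ ts) ρ eq with s′ Bool.≟ not s | List.≡-dec Fin._≟_ w w′ | delete (s , w) ts in eq′
  delete-sound (s , w) ((s′ , w′) ∷ ts) ρ ≡.refl | yes ≡.refl | yes ≡.refl | _ = begin
    total ts ρ ≈⟨ +-identityˡ _ ⟨
    0# + total ts ρ ≈⟨ +-congʳ (-‿inverseʳ (signed s (word w ρ))) ⟨
    signed s (word w ρ) + - signed s (word w ρ) + total ts ρ ≈⟨ +-assoc _ _ _ ⟩
    signed s (word w ρ) + (- signed s (word w ρ) + total ts ρ) ≈⟨ +-congˡ (+-congʳ (signed-not s _)) ⟨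
    signed s (word w ρ) + (signed (not s) (word w ρ) + total ts ρ) ∎
  delete-sound (s , w) ((s′ , w′) ∷ ts) ρ ≡.refl | yes _ | no _ | just us =
    trans (+-congˡ (delete-sound _ ts ρ eq′)) (swap-front _ _ _)
  delete-sound (s , w) ((s′ , w′) ∷ ts) ρ ≡.refl | no _ | yes _ | just us =
    trans (+-congˡ (delete-sound _ ts ρ eq′)) (swap-front _ _ _)
  delete-sound (s , w) ((s′ , w′) ∷ ts) ρ ≡.refl | no _ | no _ | just us =
    trans (+-congˡ (delete-sound _ ts ρ eq′)) (swap-front _ _ _)

  cons-sound : ∀ {n} t (ts : List (Term n)) ρ → total (cons t ts) ρ ≈ term t ρ + total ts ρ
  cons-sound t ts ρ with delete t ts in eq
  ... | just us = delete-sound t ts ρ eq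
  ... | nothing = refl

  reduce-sound : ∀ {n} (ts : List (Term n)) ρ → total (reduce ts) ρ ≈ total ts ρ
  reduce-sound [] ρ = refl
  reduce-sound (t ∷ ts) ρ = trans (cons-sound t (reduce ts) ρ) (+-congˡ (reduce-sound ts ρ))

  -- The hypothesis is a closed computation on syntax, so callers discharge it by reflexivity.
  decide : ∀ {n} (e f : Expr n) ρ → reduce (expand (e ⊖ f)) ≡ [] → ⟦ e ⟧ ρ ≈ ⟦ f ⟧ ρ
  decide e f ρ eq = x∙y⁻¹≈ε⇒x≈y _ _ (begin
    ⟦ e ⊖ f ⟧ ρ ≈⟨ expand-sound (e ⊖ f) ρ ⟨
    total (expand (e ⊖ f)) ρ ≈⟨ reduce-sound (expand (e ⊖ f)) ρ ⟨
    total (reduce (expand (e ⊖ f))) ρ ≡⟨ ≡.cong (λ ts → total ts ρ) eq ⟩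
    0# ∎)

  curry-∀ : ∀ {A : Set} n {P : Vec A n → Set} → (∀ ρ → P ρ) → ∀ⁿ n (curryⁿ P)
  curry-∀ zero h = h []
  curry-∀ (suc n) h x = curry-∀ n (λ ρ → h (x ∷ ρ))

  solve : ∀ n (f : N-ary n (Expr n) (Expr n ⨯ Expr n)) →
    let e = f $ⁿ Vec.map var (Vec.allFin n) in
    reduce (expand (proj₁ e ⊖ proj₂ e)) ≡ [] →
    ∀ⁿ n (curryⁿ (λ ρ → ⟦ proj₁ e ⟧ ρ ≈ ⟦ proj₂ e ⟧ ρ))
  solve n f eq = curry-∀ n λ ρ → decide (proj₁ e) (proj₂ e) ρ eq
    where e = f $ⁿ Vec.map var (Vec.allFin n)

-- Sums, matrices and traces over an arbitrary ring

-- Kept opaque so that the unifier never unfolds finite sums; it depends only on the operations, so that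
-- rings differing only in their equality share their sums.
opaque
  fold : {A : Set} → (A → A → A) → A → {n : ℕ} → (Fin n → A) → A
  fold _∙_ ε {zero} f = ε
  fold _∙_ ε {suc n} f = f zero ∙ fold _∙_ ε (λ i → f (suc i))

  fold-zero : {A : Set} (_∙_ : A → A → A) (ε : A) (f : Fin 0 → A) → fold _∙_ ε f ≡ ε
  fold-zero _∙_ ε f = ≡.refl

  fold-suc : {A : Set} (_∙_ : A → A → A) (ε : A) {n : ℕ} (f : Fin (suc n) → A) →
    fold _∙_ ε f ≡ (f zero ∙ fold _∙_ ε (λ i → f (suc i)))
  fold-suc _∙_ ε f = ≡.refl

  diagonal : {A : Set} → (A → A → A) → A → {n : ℕ} → (Fin n → Fin n → A) → A
  diagonal _∙_ ε M = fold _∙_ ε (λ i → M i i)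

  diagonal-fold : {A : Set} (_∙_ : A → A → A) (ε : A) {n : ℕ} (M : Fin n → Fin n → A) →
    diagonal _∙_ ε M ≡ fold _∙_ ε (λ i → M i i)
  diagonal-fold _∙_ ε M = ≡.refl

-- The definitions below take the bare operations as parameters, so that they are shared by rings that differ
-- only in their equality (such as a ring and its quotients).
module Raw {A : Set} (_+_ _*_ : A → A → A) (-_ : A → A) (0# 1# : A) where

  infixr 8 _×_
  _×_ : ℕ → A → A
  zero × x = 0#
  suc k × x = x + (k × x)

  ∑ : ∀ {n} → (Fin n → A) → A
  ∑ = fold _+_ 0#

  δ : ∀ {m} → Fin m → Fin m → A
  δ zero zero = 1#
  δ zero (suc _) = 0#
  δ (suc _) zero = 0#
  δ (suc i) (suc j) = δ i j

  module RawMatrix (n : ℕ) where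

    Mat : Set
    Mat = Fin n → Fin n → A

    infixl 7 _⊗_
    infixl 6 _⊕_ _⊖ᴹ_
    infix 8 ⊝_
    infixr 8 _•_
    _⊗_ _⊕_ _⊖ᴹ_ : Mat → Mat → Mat
    (M ⊗ N) i j = ∑ (λ x → M i x * N x j)
    (M ⊕ N) i j = M i j + N i j
    (M ⊖ᴹ N) i j = M i j + (- N i j)

    ⊝_ : Mat → Mat
    (⊝ M) i j = - M i j

    0ᴹ : Mat
    0ᴹ i j = 0#

    _•_ : A → Mat → Mat
    (a • M) i j = a * M i j

    ι : A → Mat
    ι a = a • δ

    tr : Mat → A
    tr = diagonal _+_ 0#

    pow : Mat → ℕ → Mat
    pow M zero = δ
    pow M (suc k) = M ⊗ pow M k

    -- The derivative of pow C k in the direction e.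
    dpow : Mat → Mat → ℕ → Mat
    dpow C e zero = 0ᴹ
    dpow C e (suc k) = C ⊗ dpow C e k ⊕ e ⊗ pow C k

    -- ∑ᵢ tr(eCⁱ) Cᵏ⁻¹⁻ⁱ
    trpow : Mat → Mat → ℕ → Mat
    trpow C e zero = 0ᴹ
    trpow C e (suc k) = C ⊗ trpow C e k ⊕ ι (tr (e ⊗ pow C k))

    -- The characteristic polynomial and the adjugate of 1 - tU by Newton's recursion.
    module Newton (inv : ℕ → A) where
      mutual
        coef : Mat → ℕ → A
        coef U zero = 1#
        coef U (suc k) = - (inv k * tr (adj U k ⊗ U))

        adj : Mat → ℕ → Mat
        adj U zero = δ
        adj U (suc k) = U ⊗ adj U k ⊕ ι (coef U (suc k))

module Sums (𝓡 : Ring 0ℓ 0ℓ) where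
  open Ring 𝓡 hiding (zero)
  import Algebra.Properties.Semiring.Sum semiring as S
  open import Algebra.Properties.Ring 𝓡 public

  open Raw _+_ _*_ -_ 0# 1# public using (_×_; ∑; δ)

  ×-cong : ∀ k {x y} → x ≈ y → k × x ≈ k × y
  ×-cong zero h = refl
  ×-cong (suc k) h = +-cong h (×-cong k h)

  ×-comm-* : ∀ k x y → x * (k × y) ≈ k × (x * y)
  ×-comm-* zero x y = zeroʳ x
  ×-comm-* (suc k) x y = trans (distribˡ x y _) (+-congˡ (×-comm-* k x y))

  ∑-suc : ∀ {n} (f : Fin (suc n) → Carrier) → ∑ f ≈ f zero + ∑ (λ i → f (suc i))
  ∑-suc f = reflexive (fold-suc _+_ 0# f)

  ∑≈sum : ∀ {n} (f : Fin n → Carrier) → ∑ f ≈ S.sum f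
  ∑≈sum {zero} f = reflexive (fold-zero _+_ 0# f)
  ∑≈sum {suc n} f = trans (∑-suc f) (+-congˡ (∑≈sum (λ i → f (suc i))))

  ∑-cong : ∀ {n} {f g : Fin n → Carrier} → (∀ i → f i ≈ g i) → ∑ f ≈ ∑ g
  ∑-cong {f = f} {g} h = trans (∑≈sum f) (trans (S.sum-cong-≋ h) (sym (∑≈sum g)))

  ∑-distrib-+ : ∀ {n} (f g : Fin n → Carrier) → ∑ (λ i → f i + g i) ≈ ∑ f + ∑ g
  ∑-distrib-+ f g = trans (∑≈sum _) (trans (S.∑-distrib-+ f g) (sym (+-cong (∑≈sum f) (∑≈sum g))))

  ∑-comm : ∀ {m n} (f : Fin m → Fin n → Carrier) → ∑ (λ i → ∑ (λ j → f i j)) ≈ ∑ (λ j → ∑ (λ i → f i j))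
  ∑-comm f = trans (nested f) (trans (S.∑-comm f) (sym (nested (λ j i → f i j))))
    where
    nested : ∀ {m n} (f : Fin m → Fin n → Carrier) → ∑ (λ i → ∑ (λ j → f i j)) ≈ S.sum (λ i → S.sum (λ j → f i j))
    nested f = trans (∑≈sum _) (S.sum-cong-≋ (λ i → ∑≈sum (f i)))

  *-distribˡ-∑ : ∀ {n} x (f : Fin n → Carrier) → x * ∑ f ≈ ∑ (λ i → x * f i)
  *-distribˡ-∑ x f = trans (*-congˡ (∑≈sum f)) (trans (S.*-distribˡ-sum x f) (sym (∑≈sum _)))

  *-distribʳ-∑ : ∀ {n} x (f : Fin n → Carrier) → ∑ f * x ≈ ∑ (λ i → f i * x)
  *-distribʳ-∑ x f = trans (*-congʳ (∑≈sum f)) (trans (S.*-distribʳ-sum x f) (sym (∑≈sum _)))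

  ∑-zero : ∀ {n} {f : Fin n → Carrier} → (∀ i → f i ≈ 0#) → ∑ f ≈ 0#
  ∑-zero {n} h = trans (∑-cong h) (trans (∑≈sum (λ _ → 0#)) (S.sum-replicate-zero n))

  ∑-neg : ∀ {n} (f : Fin n → Carrier) → ∑ (λ i → - f i) ≈ - ∑ f
  ∑-neg f = trans (∑-cong (λ i → sym (-1*x≈-x (f i)))) (trans (sym (*-distribˡ-∑ (- 1#) f)) (-1*x≈-x _))

  ∑-minus : ∀ {n} (f g : Fin n → Carrier) → ∑ (λ i → f i - g i) ≈ ∑ f - ∑ g
  ∑-minus f g = trans (∑-distrib-+ f (λ i → - g i)) (+-congˡ (∑-neg g))

  -- The rings are noncommutative, so centrality is carried by the individual elements that have it:
  -- even elements, products of two odd ones, and what is built from these.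
  Cen : Carrier → Set
  Cen x = ∀ y → x * y ≈ y * x

  cen-resp : ∀ {x y} → x ≈ y → Cen x → Cen y
  cen-resp e c z = trans (*-congʳ (sym e)) (trans (c z) (*-congˡ e))

  cen-0 : Cen 0#
  cen-0 y = trans (zeroˡ y) (sym (zeroʳ y))

  cen-1 : Cen 1#
  cen-1 y = trans (*-identityˡ y) (sym (*-identityʳ y))

  cen-+ : ∀ {x y} → Cen x → Cen y → Cen (x + y)
  cen-+ c d z = trans (distribʳ z _ _) (trans (+-cong (c z) (d z)) (sym (distribˡ z _ _)))

  cen-neg : ∀ {x} → Cen x → Cen (- x)
  cen-neg c z = trans (sym (-‿distribˡ-* _ z)) (trans (-‿cong (c z)) (-‿distribʳ-* z _))

  cen-* : ∀ {x y} → Cen x → Cen y → Cen (x * y)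
  cen-* {x} {y} c d z = trans (*-assoc x y z) (trans (*-congˡ (d z)) (trans (sym (*-assoc x z y)) (trans (*-congʳ (c z)) (*-assoc z x y))))

  cen-∑ : ∀ {n} {f : Fin n → Carrier} → (∀ i → Cen (f i)) → Cen (∑ f)
  cen-∑ {f = f} h y = trans (*-distribʳ-∑ y f) (trans (∑-cong (λ i → h i y)) (sym (*-distribˡ-∑ y f)))

  cen-left : ∀ {a} → Cen a → ∀ x y → x * (a * y) ≈ a * (x * y)
  cen-left {a} c x y = trans (sym (*-assoc x a y)) (trans (*-congʳ (sym (c x))) (*-assoc a x y))

-- `inv k` is the inverse of k + 1. Newton's recursion divides by all positive integers, and
-- `self-neg`, the source of many vanishing statements, divides by 2.
record Divisible (𝓡 : Ring 0ℓ 0ℓ) : Set where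
  open Ring 𝓡 hiding (zero)
  open Sums 𝓡
  field
    inv : ℕ → Carrier
    inv-cen : ∀ k → Cen (inv k)
    inv-law : ∀ k x → inv k * (suc k × x) ≈ x

  ×-cancel : ∀ k {x} → suc k × x ≈ 0# → x ≈ 0#
  ×-cancel k {x} h = trans (sym (inv-law k x)) (trans (*-congˡ h) (zeroʳ _))

  double-cancel : ∀ {x} → x + x ≈ 0# → x ≈ 0#
  double-cancel {x} h = ×-cancel 1 (trans (+-congˡ (+-identityʳ x)) h)

  self-neg : ∀ {x} → x ≈ - x → x ≈ 0#
  self-neg {x} h = double-cancel (trans (+-congˡ h) (-‿inverseʳ x))

module Matrices (𝓡 : Ring 0ℓ 0ℓ) (n : ℕ) where
  open Ring 𝓡 hiding (zero)
  open Sums 𝓡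
  open NonCommSolver 𝓡 using (solve)
  open import Relation.Binary.Reasoning.Setoid setoid

  open Raw.RawMatrix _+_ _*_ -_ 0# 1# n public

  infix 4 _≋_
  _≋_ : Mat → Mat → Set
  M ≋ N = ∀ i j → M i j ≈ N i j

  δ-∑ˡ : ∀ {m} (i : Fin m) (f : Fin m → Carrier) → ∑ (λ x → δ i x * f x) ≈ f i
  δ-∑ˡ zero f = trans (∑-suc _) (trans (+-cong (*-identityˡ _) (∑-zero (λ _ → zeroˡ _))) (+-identityʳ _))
  δ-∑ˡ (suc i) f = trans (∑-suc _) (trans (+-cong (zeroˡ _) (δ-∑ˡ i (λ x → f (suc x)))) (+-identityˡ _))

  δ-∑ʳ : ∀ {m} (i : Fin m) (f : Fin m → Carrier) → ∑ (λ x → f x * δ x i) ≈ f i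
  δ-∑ʳ zero f = trans (∑-suc _) (trans (+-cong (*-identityʳ _) (∑-zero (λ _ → zeroʳ _))) (+-identityʳ _))
  δ-∑ʳ (suc i) f = trans (∑-suc _) (trans (+-cong (zeroʳ _) (δ-∑ʳ i (λ x → f (suc x)))) (+-identityˡ _))

  cen-δ : ∀ {m} (i j : Fin m) → Cen (δ i j)
  cen-δ zero zero = cen-1
  cen-δ zero (suc _) = cen-0
  cen-δ (suc _) zero = cen-0
  cen-δ (suc i) (suc j) = cen-δ i j

  ⊗-assoc : ∀ M N P → (M ⊗ N) ⊗ P ≋ M ⊗ (N ⊗ P)
  ⊗-assoc M N P i j = begin
    ∑ (λ y → ∑ (λ x → M i x * N x y) * P y j) ≈⟨ ∑-cong (λ y → *-distribʳ-∑ (P y j) _) ⟩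
    ∑ (λ y → ∑ (λ x → M i x * N x y * P y j)) ≈⟨ ∑-comm _ ⟩
    ∑ (λ x → ∑ (λ y → M i x * N x y * P y j)) ≈⟨ ∑-cong (λ x → ∑-cong (λ y → *-assoc _ _ _)) ⟩
    ∑ (λ x → ∑ (λ y → M i x * (N x y * P y j))) ≈⟨ ∑-cong (λ x → *-distribˡ-∑ (M i x) _) ⟨
    ∑ (λ x → M i x * ∑ (λ y → N x y * P y j)) ∎

  -- Makes the solver available for matrix identities and allows convolutions with matrix
  -- coefficients.
  matRing : Ring 0ℓ 0ℓ
  matRing = record
    { Carrier = Mat
    ; _≈_ = _≋_
    ; _+_ = _⊕_
    ; _*_ = _⊗_
    ; -_ = ⊝_
    ; 0# = 0ᴹ
    ; 1# = δ
    ; isRing = record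
      { +-isAbelianGroup = record
        { isGroup = record
          { isMonoid = record
            { isSemigroup = record
              { isMagma = record
                { isEquivalence = record
                  { refl = λ _ _ → refl
                  ; sym = λ p i j → sym (p i j)
                  ; trans = λ p q i j → trans (p i j) (q i j) }
                ; ∙-cong = λ p q i j → +-cong (p i j) (q i j) }
              ; assoc = λ M N P i j → +-assoc _ _ _ }
            ; identity = (λ M i j → +-identityˡ _) , (λ M i j → +-identityʳ _) }
          ; inverse = (λ M i j → -‿inverseˡ _) , (λ M i j → -‿inverseʳ _)
          ; ⁻¹-cong = λ p i j → -‿cong (p i j) }
        ; comm = λ M N i j → +-comm _ _ }
      ; *-cong = λ p q i j → ∑-cong (λ x → *-cong (p i x) (q x j))
      ; *-assoc = ⊗-assoc
      ; *-identity = (λ M i j → δ-∑ˡ i (λ x → M x j)) , (λ M i j → δ-∑ʳ j (M i))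
      ; distrib = (λ M N P i j → trans (∑-cong (λ x → distribˡ _ _ _)) (∑-distrib-+ _ _))
                , (λ M N P i j → trans (∑-cong (λ x → distribʳ _ _ _)) (∑-distrib-+ _ _))
      }
    }

  tr-∑ : ∀ M → tr M ≈ ∑ (λ i → M i i)
  tr-∑ M = reflexive (diagonal-fold _+_ 0# M)

  CenM : Mat → Set
  CenM M = ∀ i j → Cen (M i j)

  cen-⊗ : ∀ {M N} → CenM M → CenM N → CenM (M ⊗ N)
  cen-⊗ c d i j = cen-∑ (λ x → cen-* (c i x) (d x j))

  tr-cong : ∀ {M N} → M ≋ N → tr M ≈ tr N
  tr-cong {M} {N} p = trans (tr-∑ M) (trans (∑-cong (λ i → p i i)) (sym (tr-∑ N)))

  tr-+ : ∀ M N → tr (M ⊕ N) ≈ tr M + tr N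
  tr-+ M N = trans (tr-∑ _) (trans (∑-distrib-+ _ _) (sym (+-cong (tr-∑ M) (tr-∑ N))))

  tr-neg : ∀ M → tr (⊝ M) ≈ - tr M
  tr-neg M = trans (tr-∑ _) (trans (∑-neg _) (sym (-‿cong (tr-∑ M))))

  tr-comm : ∀ {M} N → CenM M → tr (M ⊗ N) ≈ tr (N ⊗ M)
  tr-comm {M} N c = trans (tr-∑ _) (trans (∑-comm _) (trans (∑-cong (λ x → ∑-cong (λ i → c i x (N x i)))) (sym (tr-∑ _))))

  -- The exchange of entries behind the cyclicity of the trace costs one sign for each product.
  tr-anticomm : ∀ {M N} → (∀ i j k l → M i j * N k l ≈ - (N k l * M i j)) → tr (M ⊗ N) ≈ - tr (N ⊗ M)
  tr-anticomm {M} {N} h = begin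
    tr (M ⊗ N) ≈⟨ tr-∑ _ ⟩
    ∑ (λ i → ∑ (λ x → M i x * N x i)) ≈⟨ ∑-comm _ ⟩
    ∑ (λ x → ∑ (λ i → M i x * N x i)) ≈⟨ ∑-cong (λ x → trans (∑-cong (λ i → h i x x i)) (∑-neg _)) ⟩
    ∑ (λ x → - ∑ (λ i → N x i * M i x)) ≈⟨ ∑-neg _ ⟩
    - ∑ (λ x → ∑ (λ i → N x i * M i x)) ≈⟨ -‿cong (tr-∑ _) ⟨
    - tr (N ⊗ M) ∎

  tr-• : ∀ a M → tr (a • M) ≈ a * tr M
  tr-• a M = trans (tr-∑ _) (trans (sym (*-distribˡ-∑ a _)) (*-congˡ (sym (tr-∑ M))))

-- The Cayley-Hamilton theorem for matrices with central entries

module CayleyHamilton (𝓡 : Ring 0ℓ 0ℓ) (div : Divisible 𝓡) (n : ℕ) where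
  open Ring 𝓡 hiding (zero)
  open Sums 𝓡
  open Divisible div
  open NonCommSolver 𝓡 using (solve)
  open Matrices 𝓡 n
  open import Relation.Binary.Reasoning.Setoid setoid

  open Newton inv public

  mutual
    coef-cong : ∀ {U V} → U ≋ V → ∀ k → coef U k ≈ coef V k
    coef-cong h zero = refl
    coef-cong h (suc k) = -‿cong (*-congˡ (tr-cong (λ i j → ∑-cong (λ x → *-cong (adj-cong h k i x) (h x j)))))

    adj-cong : ∀ {U V} → U ≋ V → ∀ k → adj U k ≋ adj V k
    adj-cong h zero i j = refl
    adj-cong h (suc k) i j = +-cong (∑-cong (λ x → *-cong (h i x) (adj-cong h k x j))) (*-congʳ (coef-cong h (suc k)))

  -- Antisymmetric tensors: ψ c is multiplication by the covector c, and prefixing an index is contraction,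
  -- so a minor is a value of an iterated ψ, and Laplace expansion along the first row holds by definition.
  State : Set
  State = List (Fin n) → Carrier

  ψ : (Fin n → Carrier) → State → State
  ψ c s [] = 0#
  ψ c s (i ∷ zs) = c i * s zs - ψ c (λ ws → s (i ∷ ws)) zs

  vacuum : State
  vacuum [] = 1#
  vacuum (_ ∷ _) = 0#

  ψ-cong : ∀ c {s s′ : State} → (∀ zs → s zs ≈ s′ zs) → ∀ zs → ψ c s zs ≈ ψ c s′ zs
  ψ-cong c h [] = refl
  ψ-cong c h (i ∷ zs) = +-cong (*-congˡ (h zs)) (-‿cong (ψ-cong c (λ ws → h (i ∷ ws)) zs))

  ψ-linear : ∀ c {a} → Cen a → ∀ (s s′ : State) zs → ψ c (λ ws → a * s ws - s′ ws) zs ≈ a * ψ c s zs - ψ c s′ zs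
  ψ-linear c {a} ca s s′ [] = sym (trans (+-cong (zeroʳ a) -0#≈0#) (+-identityˡ 0#))
  ψ-linear c {a} ca s s′ (i ∷ zs) = begin
    c i * (a * s zs - s′ zs) - ψ c (λ ws → a * s (i ∷ ws) - s′ (i ∷ ws)) zs
      ≈⟨ +-congˡ (-‿cong (ψ-linear c ca (λ ws → s (i ∷ ws)) (λ ws → s′ (i ∷ ws)) zs)) ⟩
    c i * (a * s zs - s′ zs) - (a * p - q)
      ≈⟨ solve 6 (λ c a s s′ p q → c ⊠ (a ⊠ s ⊖ s′) ⊖ (a ⊠ p ⊖ q) ⊜ c ⊠ (a ⊠ s) ⊖ a ⊠ p ⊖ (c ⊠ s′ ⊖ q)) ≡.refl _ _ _ _ _ _ ⟩
    c i * (a * s zs) - a * p - (c i * s′ zs - q) ≈⟨ +-congʳ (+-congʳ (cen-left ca _ _)) ⟩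
    a * (c i * s zs) - a * p - (c i * s′ zs - q)
      ≈⟨ +-congʳ (solve 3 (λ a x p → a ⊠ x ⊖ a ⊠ p ⊜ a ⊠ (x ⊖ p)) ≡.refl _ _ _) ⟩
    a * (c i * s zs - p) - (c i * s′ zs - q) ∎
    where
    p = ψ c (λ ws → s (i ∷ ws)) zs
    q = ψ c (λ ws → s′ (i ∷ ws)) zs

  Alternating : State → Set
  Alternating s = ∀ ws x y zs → s (ws ++ x ∷ y ∷ zs) ≈ - s (ws ++ y ∷ x ∷ zs)

  contract-alt : ∀ {s} i → Alternating s → Alternating (λ ws → s (i ∷ ws))
  contract-alt i alt ws = alt (i ∷ ws)

  neg-ψ : ∀ c s zs → ψ c (λ ws → - s ws) zs ≈ - ψ c s zs
  neg-ψ c s [] = sym -0#≈0#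
  neg-ψ c s (i ∷ zs) = trans (+-congˡ (-‿cong (neg-ψ c (λ ws → s (i ∷ ws)) zs)))
    (solve 3 (λ c s p → c ⊠ (⊟ s) ⊖ ⊟ p ⊜ ⊟ (c ⊠ s ⊖ p)) ≡.refl _ _ _)

  ψ-alt : ∀ c {s} → Alternating s → Alternating (ψ c s)
  ψ-alt c {s} alt [] x y zs = begin
    c x * s (y ∷ zs) - (c y * s (x ∷ zs) - ψ c (λ ws → s (x ∷ y ∷ ws)) zs)
      ≈⟨ +-congˡ (-‿cong (+-congˡ (-‿cong (trans (ψ-cong c (alt [] x y) zs) (neg-ψ c _ zs))))) ⟩
    c x * s (y ∷ zs) - (c y * s (x ∷ zs) - - ψ c (λ ws → s (y ∷ x ∷ ws)) zs)
      ≈⟨ solve 3 (λ a b p → a ⊖ (b ⊖ ⊟ p) ⊜ ⊟ (b ⊖ (a ⊖ p))) ≡.refl _ _ _ ⟩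
    - (c y * s (x ∷ zs) - (c x * s (y ∷ zs) - ψ c (λ ws → s (y ∷ x ∷ ws)) zs)) ∎
  ψ-alt c {s} alt (w ∷ ws) x y zs = begin
    c w * s (ws ++ x ∷ y ∷ zs) - ψ c (λ vs → s (w ∷ vs)) (ws ++ x ∷ y ∷ zs)
      ≈⟨ +-cong (*-congˡ (alt ws x y zs)) (-‿cong (ψ-alt c (contract-alt {s} w alt) ws x y zs)) ⟩
    c w * - s (ws ++ y ∷ x ∷ zs) - - ψ c (λ vs → s (w ∷ vs)) (ws ++ y ∷ x ∷ zs)
      ≈⟨ solve 3 (λ c s p → c ⊠ (⊟ s) ⊖ ⊟ p ⊜ ⊟ (c ⊠ s ⊖ p)) ≡.refl _ _ _ ⟩
    - (c w * s (ws ++ y ∷ x ∷ zs) - ψ c (λ vs → s (w ∷ vs)) (ws ++ y ∷ x ∷ zs)) ∎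

  vacuum-alt : Alternating vacuum
  vacuum-alt [] x y zs = sym -0#≈0#
  vacuum-alt (w ∷ ws) x y zs = sym -0#≈0#

  -- Transpositions carry the repeated index next to its copy; there, exchanging the two equal
  -- neighbours makes the value its own negative.
  alternating-later : ∀ {s} → Alternating s → ∀ ws x zs (j : Fin (length zs)) → lookup zs j ≡ x → s (ws ++ x ∷ zs) ≈ 0#
  alternating-later {s} alt ws x (z ∷ zs) zero ≡.refl = self-neg (alt ws z z zs)
  alternating-later {s} alt ws x (z ∷ zs) (suc j) eq = begin
    s (ws ++ x ∷ z ∷ zs) ≈⟨ alt ws x z zs ⟩
    - s (ws ++ z ∷ x ∷ zs) ≡⟨ ≡.cong (λ l → - s l) (List.++-assoc ws (z ∷ []) (x ∷ zs)) ⟨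
    - s ((ws ++ z ∷ []) ++ x ∷ zs) ≈⟨ -‿cong (alternating-later {s} alt (ws ++ z ∷ []) x zs j eq) ⟩
    - 0# ≈⟨ -0#≈0# ⟩
    0# ∎

  alternating-repeat : ∀ {s} → Alternating s → ∀ ws zs (i j : Fin (length zs)) → i Fin.< j →
    lookup zs i ≡ lookup zs j → s (ws ++ zs) ≈ 0#
  alternating-repeat {s} alt ws (z ∷ zs) zero (suc j) i<j eq = alternating-later {s} alt ws z zs j (≡.sym eq)
  alternating-repeat {s} alt ws (z ∷ zs) (suc i) (suc j) (s<s i<j) eq =
    trans (reflexive (≡.cong s (≡.sym (List.++-assoc ws (z ∷ []) zs))))
      (alternating-repeat {s} alt (ws ++ z ∷ []) zs i j i<j eq)

  alternating-long : ∀ {s} → Alternating s → ∀ zs → n ℕ.< length zs → s zs ≈ 0#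
  alternating-long {s} alt zs n<l with i , j , i<j , eq ← Fin.pigeonhole n<l (lookup zs) =
    alternating-repeat {s} alt [] zs i j i<j eq

  module _ (U : Mat) (cU : CenM U) where

    -- `T k s` is (-1)ᵏ/k! times the sum over x₁, ..., xₖ of the contraction by these indices of the
    -- wedge of the columns x₁, ..., xₖ of `U` with `s`. On the vacuum, without further indices, it
    -- is (-1)ᵏ times the sum of the principal minors of size k.
    T : ℕ → State → State
    T zero s zs = s zs
    T (suc k) s zs = - (inv k * ∑ (λ x → T k (ψ (λ z → U z x) s) (x ∷ zs)))

    T-cong : ∀ k {s s′ : State} → (∀ zs → s zs ≈ s′ zs) → ∀ zs → T k s zs ≈ T k s′ zs
    T-cong zero h zs = h zs
    T-cong (suc k) h zs = -‿cong (*-congˡ (∑-cong (λ x → T-cong k (ψ-cong _ h) (x ∷ zs))))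

    T-linear : ∀ k {a} → Cen a → ∀ (s s′ : State) zs → T k (λ ws → a * s ws - s′ ws) zs ≈ a * T k s zs - T k s′ zs
    T-linear zero ca s s′ zs = refl
    T-linear (suc k) {a} ca s s′ zs = begin
      - (inv k * ∑ (λ x → T k (ψ _ (λ ws → a * s ws - s′ ws)) (x ∷ zs)))
        ≈⟨ -‿cong (*-congˡ (trans (∑-cong (λ x → trans (T-cong k (ψ-linear _ ca s s′) (x ∷ zs)) (T-linear k ca _ _ (x ∷ zs)))) (∑-minus _ _))) ⟩
      - (inv k * (∑ (λ x → a * f x) - ∑ g)) ≈⟨ -‿cong (*-congˡ (+-congʳ (*-distribˡ-∑ a f))) ⟨
      - (inv k * (a * ∑ f - ∑ g))
        ≈⟨ solve 4 (λ i a f g → ⊟ (i ⊠ (a ⊠ f ⊖ g)) ⊜ ⊟ (i ⊠ a ⊠ f) ⊖ ⊟ (i ⊠ g)) ≡.refl _ _ _ _ ⟩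
      - (inv k * a * ∑ f) - - (inv k * ∑ g) ≈⟨ +-congʳ (-‿cong (*-congʳ (inv-cen k a))) ⟩
      - (a * inv k * ∑ f) - - (inv k * ∑ g)
        ≈⟨ +-congʳ (solve 3 (λ a i f → ⊟ (a ⊠ i ⊠ f) ⊜ a ⊠ (⊟ (i ⊠ f))) ≡.refl _ _ _) ⟩
      a * - (inv k * ∑ f) - - (inv k * ∑ g) ∎
      where
      f g : Fin n → Carrier
      f x = T k (ψ (λ z → U z x) s) (x ∷ zs)
      g x = T k (ψ (λ z → U z x) s′) (x ∷ zs)

    T-alt : ∀ k {s} → Alternating s → Alternating (T k s)
    T-alt zero alt = alt
    T-alt (suc k) {s} alt ws x y zs = -‿cong (begin
      inv k * ∑ (λ v → T k (ψ _ s) (v ∷ ws ++ x ∷ y ∷ zs))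
        ≈⟨ *-congˡ (trans (∑-cong (λ v → T-alt k (ψ-alt _ alt) (v ∷ ws) x y zs)) (∑-neg _)) ⟩
      inv k * - ∑ (λ v → T k (ψ _ s) (v ∷ ws ++ y ∷ x ∷ zs)) ≈⟨ -‿distribʳ-* _ _ ⟨
      - (inv k * ∑ (λ v → T k (ψ _ s) (v ∷ ws ++ y ∷ x ∷ zs))) ∎)

    T-long : ∀ k {s} → Alternating s → ∀ zs → n ℕ.< k ℕ.+ length zs → T k s zs ≈ 0#
    T-long zero alt zs l = alternating-long alt zs l
    T-long (suc k) alt zs l = trans (-‿cong (trans (*-congˡ (∑-zero (λ x → T-long k (ψ-alt _ alt) (x ∷ zs)
      (≡.subst (n ℕ.<_) (≡.sym (ℕ.+-suc k (length zs))) l)))) (zeroʳ _))) -0#≈0#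

    -- Laplace expansion along row `i`: the contraction by `i` meets either `s` or one of the
    -- `suc k` columns of `U`. By antisymmetry these columns all contribute equally, and their
    -- number cancels against `inv k`.
    T-contract : ∀ k {s} → Alternating s → ∀ i zs →
      T (suc k) s (i ∷ zs) ≈ T (suc k) (λ ws → s (i ∷ ws)) zs + ∑ (λ x → U i x * T k s (x ∷ zs))
    T-contract k {s} alt i zs = begin
      - (inv k * ∑ (λ x → T k (ψ (col x) s) (x ∷ i ∷ zs)))
        ≈⟨ -‿cong (*-congˡ (∑-cong (λ x → T-alt k (ψ-alt _ alt) [] x i zs))) ⟩
      - (inv k * ∑ (λ x → - T k (ψ (col x) s) (i ∷ x ∷ zs))) ≈⟨ -‿cong (*-congˡ (∑-neg _)) ⟩
      - (inv k * - ∑ (λ x → T k (ψ (col x) s) (i ∷ x ∷ zs)))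
        ≈⟨ solve 2 (λ a x → ⊟ (a ⊠ (⊟ x)) ⊜ a ⊠ x) ≡.refl _ _ ⟩
      inv k * ∑ (λ x → T k (ψ (col x) s) (i ∷ x ∷ zs)) ≈⟨ *-congˡ (pushed k) ⟩
      inv k * (suc k × Z k - Y) ≈⟨ solve 3 (λ a z y → a ⊠ (z ⊖ y) ⊜ a ⊠ z ⊖ a ⊠ y) ≡.refl _ _ _ ⟩
      inv k * (suc k × Z k) - inv k * Y ≈⟨ +-congʳ (inv-law k (Z k)) ⟩
      Z k - inv k * Y ≈⟨ +-comm _ _ ⟩
      - (inv k * Y) + Z k ∎
      where
      col : Fin n → Fin n → Carrier
      col x z = U z x
      s/i : State
      s/i ws = s (i ∷ ws)
      Z : ℕ → Carrier
      Z k = ∑ (λ x → U i x * T k s (x ∷ zs))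
      Y = ∑ (λ x → T k (ψ (col x) s/i) (x ∷ zs))
      step : ∀ k x → T k (λ ws → ψ (col x) s (i ∷ ws)) (x ∷ zs) ≈ U i x * T k s (x ∷ zs) - T k (ψ (col x) s/i) (x ∷ zs)
      step k x = T-linear k (cU i x) s (ψ (col x) s/i) (x ∷ zs)
      pushed : ∀ k → ∑ (λ x → T k (ψ (col x) s) (i ∷ x ∷ zs)) ≈ suc k × Z k - ∑ (λ x → T k (ψ (col x) s/i) (x ∷ zs))
      pushed zero = begin
        ∑ (λ x → ψ (col x) s (i ∷ x ∷ zs)) ≈⟨ trans (∑-cong (step zero)) (∑-minus _ _) ⟩
        Z zero - ∑ (λ x → ψ (col x) s/i (x ∷ zs)) ≈⟨ +-congʳ (sym (+-identityʳ _)) ⟩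
        Z zero + 0# - ∑ (λ x → ψ (col x) s/i (x ∷ zs)) ∎
      pushed (suc k) = begin
        ∑ (λ x → T (suc k) (ψ (col x) s) (i ∷ x ∷ zs))
          ≈⟨ ∑-cong (λ x → T-contract k (ψ-alt (col x) alt) i (x ∷ zs)) ⟩
        ∑ (λ x → T (suc k) (λ ws → ψ (col x) s (i ∷ ws)) (x ∷ zs) + ∑ (λ y → U i y * T k (ψ (col x) s) (y ∷ x ∷ zs)))
          ≈⟨ ∑-distrib-+ _ _ ⟩
        ∑ (λ x → T (suc k) (λ ws → ψ (col x) s (i ∷ ws)) (x ∷ zs)) + ∑ (λ x → ∑ (λ y → U i y * T k (ψ (col x) s) (y ∷ x ∷ zs)))
          ≈⟨ +-cong (trans (∑-cong (step (suc k))) (∑-minus _ _)) (trans (∑-comm _) (∑-cong inner)) ⟩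
        Z (suc k) - ∑ (λ x → T (suc k) (ψ (col x) s/i) (x ∷ zs)) + ∑ (λ y → suc k × (U i y * T (suc k) s (y ∷ zs)))
          ≈⟨ +-congˡ (∑-× (suc k) _) ⟩
        Z (suc k) - ∑ (λ x → T (suc k) (ψ (col x) s/i) (x ∷ zs)) + suc k × Z (suc k)
          ≈⟨ solve 3 (λ z y w → z ⊖ y ⊞ w ⊜ z ⊞ w ⊖ y) ≡.refl _ _ _ ⟩
        Z (suc k) + suc k × Z (suc k) - ∑ (λ x → T (suc k) (ψ (col x) s/i) (x ∷ zs)) ∎
        where
        ∑-× : ∀ m (f : Fin n → Carrier) → ∑ (λ y → m × f y) ≈ m × ∑ f
        ∑-× zero f = ∑-zero (λ _ → refl)
        ∑-× (suc m) f = trans (∑-distrib-+ _ _) (+-congˡ (∑-× m f))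
        inner : ∀ y → ∑ (λ x → U i y * T k (ψ (col x) s) (y ∷ x ∷ zs)) ≈ suc k × (U i y * T (suc k) s (y ∷ zs))
        inner y = begin
          ∑ (λ x → U i y * T k (ψ (col x) s) (y ∷ x ∷ zs))
            ≈⟨ ∑-cong (λ x → *-congˡ (T-alt k (ψ-alt (col x) alt) [] y x zs)) ⟩
          ∑ (λ x → U i y * - T k (ψ (col x) s) (x ∷ y ∷ zs)) ≈⟨ *-distribˡ-∑ (U i y) _ ⟨
          U i y * ∑ (λ x → - T k (ψ (col x) s) (x ∷ y ∷ zs)) ≈⟨ *-congˡ (∑-neg _) ⟩
          U i y * - V ≈⟨ *-congˡ (-‿cong (inv-law k V)) ⟨
          U i y * - (inv k * (suc k × V)) ≈⟨ *-congˡ (-‿cong (×-comm-* (suc k) (inv k) V)) ⟩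
          U i y * - (suc k × (inv k * V)) ≈⟨ *-congˡ (×-neg (suc k) _) ⟩
          U i y * (suc k × T (suc k) s (y ∷ zs)) ≈⟨ ×-comm-* (suc k) (U i y) _ ⟩
          suc k × (U i y * T (suc k) s (y ∷ zs)) ∎
          where
          V = ∑ (λ x → T k (ψ (col x) s) (x ∷ y ∷ zs))
          ×-neg : ∀ m x → - (m × x) ≈ m × (- x)
          ×-neg zero x = -0#≈0#
          ×-neg (suc m) x = trans (sym (-‿+-comm x (m × x))) (+-congˡ (×-neg m x))

    ψ-zero : ∀ c {s : State} → (∀ zs → s zs ≈ 0#) → ∀ zs → ψ c s zs ≈ 0#
    ψ-zero c h [] = refl
    ψ-zero c h (i ∷ zs) = trans (+-cong (trans (*-congˡ (h zs)) (zeroʳ _))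
      (trans (-‿cong (ψ-zero c (λ ws → h (i ∷ ws)) zs)) -0#≈0#)) (+-identityˡ _)

    T-zero : ∀ k {s : State} → (∀ zs → s zs ≈ 0#) → ∀ zs → T k s zs ≈ 0#
    T-zero zero h zs = h zs
    T-zero (suc k) h zs = trans (-‿cong (trans (*-congˡ (∑-zero (λ x → T-zero k (ψ-zero _ h) (x ∷ zs)))) (zeroʳ _))) -0#≈0#

    -- By Cramer's rule, entry `i` of the k-th coefficient of the adjugate applied to the column
    -- `c`.
    minor : ℕ → Fin n → (Fin n → Carrier) → Carrier
    minor k i c = T k (ψ c vacuum) (i ∷ [])

    minor-suc : ∀ k i {c} → (∀ i → Cen (c i)) →
      minor (suc k) i c ≈ c i * T (suc k) vacuum [] + ∑ (λ x → U i x * minor k x c)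
    minor-suc k i {c} cc = trans (T-contract k (ψ-alt c vacuum-alt) i []) (+-congʳ (begin
      T (suc k) (λ ws → c i * vacuum ws - ψ c (λ zs → 0#) ws) [] ≈⟨ T-linear (suc k) (cc i) _ _ [] ⟩
      c i * T (suc k) vacuum [] - T (suc k) (ψ c (λ zs → 0#)) []
        ≈⟨ +-congˡ (trans (-‿cong (T-zero (suc k) (ψ-zero c (λ _ → refl)) [])) -0#≈0#) ⟩
      c i * T (suc k) vacuum [] + 0# ≈⟨ +-identityʳ _ ⟩
      c i * T (suc k) vacuum [] ∎))

    mutual
      -- Row expansion gives the minors the recursion that defines `adj`, with the scalar term
      -- supplied by `vacuum-coef`. That scalar is in turn a trace of minors taken at the columns of
      -- `U`, hence the joint induction.
      minor-adj : ∀ k i {c} → (∀ i → Cen (c i)) → minor k i c ≈ ∑ (λ j → adj U k i j * c j)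
      minor-adj zero i {c} cc = trans (solve 1 (λ c → c ⊠ 𝟙 ⊖ 𝟘 ⊜ c) ≡.refl (c i)) (sym (δ-∑ˡ i c))
      minor-adj (suc k) i {c} cc = begin
        minor (suc k) i c ≈⟨ minor-suc k i cc ⟩
        c i * T (suc k) vacuum [] + ∑ (λ x → U i x * minor k x c)
          ≈⟨ +-cong (cc i _) (∑-cong (λ x → *-congˡ (minor-adj k x cc))) ⟩
        T (suc k) vacuum [] * c i + ∑ (λ x → U i x * ∑ (λ j → adj U k x j * c j))
          ≈⟨ +-cong (*-cong (vacuum-coef (suc k)) (sym (δ-∑ˡ i c))) (∑-cong (λ x → trans (*-distribˡ-∑ (U i x) _) (∑-cong (λ j → sym (*-assoc _ _ _))))) ⟩
        coef U (suc k) * ∑ (λ j → δ i j * c j) + ∑ (λ x → ∑ (λ j → U i x * adj U k x j * c j))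
          ≈⟨ +-cong (trans (*-distribˡ-∑ (coef U (suc k)) (λ j → δ i j * c j)) (∑-cong (λ j → sym (*-assoc (coef U (suc k)) (δ i j) (c j))))) (∑-comm (λ x j → U i x * adj U k x j * c j)) ⟩
        ∑ (λ j → coef U (suc k) * δ i j * c j) + ∑ (λ j → ∑ (λ x → U i x * adj U k x j * c j))
          ≈⟨ ∑-distrib-+ (λ j → coef U (suc k) * δ i j * c j) _ ⟨
        ∑ (λ j → coef U (suc k) * δ i j * c j + ∑ (λ x → U i x * adj U k x j * c j))
          ≈⟨ ∑-cong (λ j → trans (+-congˡ (sym (*-distribʳ-∑ (c j) _))) (trans (+-comm _ _) (sym (distribʳ (c j) _ _)))) ⟩
        ∑ (λ j → adj U (suc k) i j * c j) ∎

      vacuum-coef : ∀ k → T k vacuum [] ≈ coef U k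
      vacuum-coef zero = refl
      vacuum-coef (suc k) = -‿cong (*-congˡ (trans (∑-cong (λ x → minor-adj k x (λ z → cU z x))) (sym (tr-∑ _))))

    -- A minor of level `k` involves k + 1 indices; once n ≤ k some index repeats. For k = n this is
    -- the usual theorem, since the recursion writes `adj U n` as the characteristic polynomial
    -- evaluated at `U`.
    cayley-hamilton : ∀ k → n ℕ.≤ k → ∀ i j → adj U k i j ≈ 0#
    cayley-hamilton k n≤k i j = begin
      adj U k i j ≈⟨ δ-∑ʳ j (adj U k i) ⟨
      ∑ (λ x → adj U k i x * δ x j) ≈⟨ minor-adj k i (λ x → cen-δ x j) ⟨
      minor k i (λ x → δ x j) ≈⟨ T-long k (ψ-alt _ vacuum-alt) (i ∷ []) (≡.subst (n ℕ.<_) (ℕ.+-comm 1 k) (s≤s n≤k)) ⟩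
      0# ∎

-- Powers, scalar matrices and derivatives of powers

module MatrixOps (𝓡 : Ring 0ℓ 0ℓ) (n : ℕ) where
  open Ring 𝓡 hiding (zero)
  open Sums 𝓡
  open Matrices 𝓡 n public
  module MR = Ring matRing
  open MR public using () renaming
    ( refl to reflᴹ; sym to symᴹ; trans to transᴹ
    ; +-cong to ⊕-cong; +-congˡ to ⊕-congˡ; +-congʳ to ⊕-congʳ; -‿cong to ⊝-cong
    ; *-cong to ⊗-cong; *-congˡ to ⊗-congˡ; *-congʳ to ⊗-congʳ; setoid to setoidᴹ
    ; zeroˡ to ⊗-zeroˡ; zeroʳ to ⊗-zeroʳ; distribˡ to ⊗-distribˡ; distribʳ to ⊗-distribʳ
    ; +-identityˡ to ⊕-identityˡ; +-identityʳ to ⊕-identityʳ; *-identityˡ to ⊗-identityˡ; *-identityʳ to ⊗-identityʳ)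
  open NonCommSolver matRing public using () renaming (solve to solveᴹ)

  pow-comm : ∀ {M N} → M ⊗ N ≋ N ⊗ M → ∀ k → pow M k ⊗ N ≋ N ⊗ pow M k
  pow-comm {M} {N} h zero = transᴹ (⊗-identityˡ N) (symᴹ (⊗-identityʳ N))
  pow-comm {M} {N} h (suc k) = begin
    M ⊗ pow M k ⊗ N ≈⟨ ⊗-assoc M (pow M k) N ⟩
    M ⊗ (pow M k ⊗ N) ≈⟨ ⊗-congˡ (pow-comm h k) ⟩
    M ⊗ (N ⊗ pow M k) ≈⟨ ⊗-assoc M N (pow M k) ⟨
    M ⊗ N ⊗ pow M k ≈⟨ ⊗-congʳ h ⟩
    N ⊗ M ⊗ pow M k ≈⟨ ⊗-assoc N M (pow M k) ⟩
    N ⊗ (M ⊗ pow M k) ∎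
    where open import Relation.Binary.Reasoning.Setoid setoidᴹ

  pow-sucʳ : ∀ M k → pow M k ⊗ M ≋ M ⊗ pow M k
  pow-sucʳ M = pow-comm (reflᴹ {M ⊗ M})

  pow-+ : ∀ M k l → pow M (k ℕ.+ l) ≋ pow M k ⊗ pow M l
  pow-+ M zero l = symᴹ (⊗-identityˡ _)
  pow-+ M (suc k) l = transᴹ (⊗-congˡ (pow-+ M k l)) (symᴹ (⊗-assoc M (pow M k) (pow M l)))

  cen-pow : ∀ {M} → CenM M → ∀ k → CenM (pow M k)
  cen-pow c zero = cen-δ
  cen-pow c (suc k) = cen-⊗ c (cen-pow c k)

  ι-⊗ : ∀ a M → ι a ⊗ M ≋ a • M
  ι-⊗ a M i j = trans (∑-cong (λ x → *-assoc a (δ i x) (M x j))) (trans (sym (*-distribˡ-∑ a _)) (*-congˡ (δ-∑ˡ i _)))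

  ι-comm : ∀ {a} → Cen a → ∀ M → ι a ⊗ M ≋ M ⊗ ι a
  ι-comm {a} c M i j = trans (ι-⊗ a M i j) (sym (trans (∑-cong (λ x → cen-left c (M i x) (δ x j))) (trans (sym (*-distribˡ-∑ a _)) (*-congˡ (δ-∑ʳ j (M i))))))

  ι-cong : ∀ {a b} → a ≈ b → ι a ≋ ι b
  ι-cong h i j = *-congʳ h

  ι-+ : ∀ a b → ι (a + b) ≋ ι a ⊕ ι b
  ι-+ a b i j = distribʳ (δ i j) a b

  ι-neg : ∀ a → ι (- a) ≋ ⊝ ι a
  ι-neg a i j = sym (-‿distribˡ-* a (δ i j))

  ι-* : ∀ a b → ι (a * b) ≋ ι a ⊗ ι b
  ι-* a b i j = trans (*-assoc a b (δ i j)) (sym (ι-⊗ a (ι b) i j))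

  ι-0 : ∀ {a} → a ≈ 0# → ι a ≋ 0ᴹ
  ι-0 h i j = trans (*-congʳ h) (zeroˡ _)

  cen-ι : ∀ {a} → Cen a → CenM (ι a)
  cen-ι c i j = cen-* c (cen-δ i j)

  cen-⊕ : ∀ {M N} → CenM M → CenM N → CenM (M ⊕ N)
  cen-⊕ c d i j = cen-+ (c i j) (d i j)

  cen-tr : ∀ {M} → CenM M → Cen (tr M)
  cen-tr {M} c = cen-resp (sym (tr-∑ M)) (cen-∑ (λ i → c i i))

  tr-ι : ∀ a M → tr (ι a ⊗ M) ≈ a * tr M
  tr-ι a M = trans (tr-cong (ι-⊗ a M)) (tr-• a M)

  tr-0 : ∀ {M} → M ≋ 0ᴹ → tr M ≈ 0#
  tr-0 {M} h = trans (tr-∑ M) (∑-zero (λ i → h i i))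

  cen-dpow : ∀ {C e} → CenM C → CenM e → ∀ k → CenM (dpow C e k)
  cen-dpow cC ce zero i j = cen-0
  cen-dpow cC ce (suc k) = cen-⊕ (cen-⊗ cC (cen-dpow cC ce k)) (cen-⊗ ce (cen-pow cC k))

  dpow-cong : ∀ C {e e′} → e ≋ e′ → ∀ k → dpow C e k ≋ dpow C e′ k
  dpow-cong C h zero = reflᴹ {0ᴹ}
  dpow-cong C h (suc k) = ⊕-cong (⊗-congˡ (dpow-cong C h k)) (⊗-congʳ h)

  dpow-⊕ : ∀ C e e′ k → dpow C (e ⊕ e′) k ≋ dpow C e k ⊕ dpow C e′ k
  dpow-⊕ C e e′ zero = symᴹ (⊕-identityˡ 0ᴹ)
  dpow-⊕ C e e′ (suc k) = transᴹ (⊕-congʳ (⊗-congˡ (dpow-⊕ C e e′ k)))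
    (solveᴹ 6 (λ C d d′ e e′ p → C ⊠ (d ⊞ d′) ⊞ (e ⊞ e′) ⊠ p ⊜ (C ⊠ d ⊞ e ⊠ p) ⊞ (C ⊠ d′ ⊞ e′ ⊠ p))
      ≡.refl C (dpow C e k) (dpow C e′ k) e e′ (pow C k))

  -- `A` and `B` commute with `C`, so they slide through the powers of `C` on either side of `e` in
  -- every term of the derivative.
  dpow-conj : ∀ {C A B} → A ⊗ C ≋ C ⊗ A → B ⊗ C ≋ C ⊗ B → ∀ e k → A ⊗ dpow C e k ⊗ B ≋ dpow C (A ⊗ e ⊗ B) k
  dpow-conj {C} {A} {B} hA hB e zero = transᴹ (⊗-congʳ (⊗-zeroʳ A)) (⊗-zeroˡ B)
  dpow-conj {C} {A} {B} hA hB e (suc k) = begin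
    A ⊗ (C ⊗ D ⊕ e ⊗ pow C k) ⊗ B
      ≈⟨ solveᴹ 6 (λ A B C D e p → A ⊠ (C ⊠ D ⊞ e ⊠ p) ⊠ B ⊜ (A ⊠ C) ⊠ D ⊠ B ⊞ A ⊠ e ⊠ (p ⊠ B)) ≡.refl A B C D e (pow C k) ⟩
    (A ⊗ C) ⊗ D ⊗ B ⊕ A ⊗ e ⊗ (pow C k ⊗ B) ≈⟨ ⊕-cong (⊗-congʳ (⊗-congʳ hA)) (⊗-congˡ (pow-comm (symᴹ hB) k)) ⟩
    (C ⊗ A) ⊗ D ⊗ B ⊕ A ⊗ e ⊗ (B ⊗ pow C k)
      ≈⟨ solveᴹ 6 (λ A B C D e p → (C ⊠ A) ⊠ D ⊠ B ⊞ A ⊠ e ⊠ (B ⊠ p) ⊜ C ⊠ (A ⊠ D ⊠ B) ⊞ A ⊠ e ⊠ B ⊠ p) ≡.refl A B C D e (pow C k) ⟩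
    C ⊗ (A ⊗ D ⊗ B) ⊕ A ⊗ e ⊗ B ⊗ pow C k ≈⟨ ⊕-congʳ (⊗-congˡ (dpow-conj hA hB e k)) ⟩
    C ⊗ dpow C (A ⊗ e ⊗ B) k ⊕ A ⊗ e ⊗ B ⊗ pow C k ∎
    where
    D = dpow C e k
    open import Relation.Binary.Reasoning.Setoid setoidᴹ

  dpow-sucʳ : ∀ C e k → dpow C e (suc k) ≋ dpow C e k ⊗ C ⊕ pow C k ⊗ e
  dpow-sucʳ C e zero = solveᴹ 2 (λ C e → C ⊠ 𝟘 ⊞ e ⊠ 𝟙 ⊜ 𝟘 ⊠ C ⊞ 𝟙 ⊠ e) ≡.refl C e
  dpow-sucʳ C e (suc k) = begin
    C ⊗ dpow C e (suc k) ⊕ e ⊗ (C ⊗ pow C k) ≈⟨ ⊕-cong (⊗-congˡ (dpow-sucʳ C e k)) (⊗-congˡ (symᴹ (pow-sucʳ C k))) ⟩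
    C ⊗ (dpow C e k ⊗ C ⊕ pow C k ⊗ e) ⊕ e ⊗ (pow C k ⊗ C)
      ≈⟨ solveᴹ 4 (λ C D e p → C ⊠ (D ⊠ C ⊞ p ⊠ e) ⊞ e ⊠ (p ⊠ C) ⊜ (C ⊠ D ⊞ e ⊠ p) ⊠ C ⊞ (C ⊠ p) ⊠ e) ≡.refl C (dpow C e k) e (pow C k) ⟩
    dpow C e (suc k) ⊗ C ⊕ pow C (suc k) ⊗ e ∎
    where open import Relation.Binary.Reasoning.Setoid setoidᴹ

  tr-rotate : ∀ {C} → CenM C → ∀ M N → tr (C ⊗ M ⊗ N) ≈ tr (M ⊗ N ⊗ C)
  tr-rotate {C} cC M N = trans (tr-cong (⊗-assoc C M N)) (tr-comm (M ⊗ N) cC)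

  -- The map e ↦ ∑ CⁱeCʲ is self-adjoint for the trace pairing, because the central matrix `C` can
  -- be rotated around the trace.
  tr-dpow : ∀ {C} → CenM C → ∀ e c k → tr (dpow C e k ⊗ c) ≈ tr (e ⊗ dpow C c k)
  tr-dpow {C} cC e c zero = trans (tr-0 (⊗-zeroˡ c)) (sym (tr-0 (⊗-zeroʳ e)))
  tr-dpow {C} cC e c (suc k) = begin
    tr ((C ⊗ D ⊕ e ⊗ pow C k) ⊗ c) ≈⟨ trans (tr-cong (⊗-distribʳ c (C ⊗ D) (e ⊗ pow C k))) (tr-+ _ _) ⟩
    tr (C ⊗ D ⊗ c) + tr (e ⊗ pow C k ⊗ c) ≈⟨ +-congʳ (tr-rotate cC D c) ⟩
    tr (D ⊗ c ⊗ C) + tr (e ⊗ pow C k ⊗ c) ≈⟨ +-congʳ (tr-cong (⊗-assoc D c C)) ⟩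
    tr (D ⊗ (c ⊗ C)) + tr (e ⊗ pow C k ⊗ c) ≈⟨ +-congʳ (tr-dpow cC e (c ⊗ C) k) ⟩
    tr (e ⊗ dpow C (c ⊗ C) k) + tr (e ⊗ pow C k ⊗ c)
      ≈⟨ +-cong (tr-cong (⊗-congˡ (symᴹ push))) (tr-cong (⊗-assoc e (pow C k) c)) ⟩
    tr (e ⊗ (dpow C c k ⊗ C)) + tr (e ⊗ (pow C k ⊗ c))
      ≈⟨ trans (tr-cong (⊗-distribˡ e (dpow C c k ⊗ C) (pow C k ⊗ c))) (tr-+ _ _) ⟨
    tr (e ⊗ (dpow C c k ⊗ C ⊕ pow C k ⊗ c)) ≈⟨ tr-cong (⊗-congˡ (dpow-sucʳ C c k)) ⟨
    tr (e ⊗ dpow C c (suc k)) ∎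
    where
    D = dpow C e k
    open import Relation.Binary.Reasoning.Setoid setoid
    push : dpow C c k ⊗ C ≋ dpow C (c ⊗ C) k
    push = transᴹ (⊗-congʳ (symᴹ (⊗-identityˡ (dpow C c k)))) (transᴹ
      (dpow-conj {C} {δ} {C} (transᴹ (⊗-identityˡ C) (symᴹ (⊗-identityʳ C))) (reflᴹ {C ⊗ C}) c k)
      (dpow-cong C (⊗-congʳ (⊗-identityˡ c)) k))

-- Cayley-Hamilton to first order at a matrix with traceless powers

-- C has traceless powers and e is infinitesimal: products of two entries of e vanish.
module FirstOrder (𝓡 : Ring 0ℓ 0ℓ) (div : Divisible 𝓡) (n : ℕ) where
  open Ring 𝓡 hiding (zero)
  open Sums 𝓡
  open Divisible div
  open MatrixOps 𝓡 n
  open CayleyHamilton 𝓡 div n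

  module Nilpotent {C : Mat} (cC : CenM C) (tC : ∀ k → tr (pow C (suc k)) ≈ 0#) where

    coef-nilpotent : ∀ k → adj C k ≋ pow C k → coef C (suc k) ≈ 0#
    coef-nilpotent k h = trans (-‿cong (trans (*-congˡ (trans (tr-cong (transᴹ (⊗-congʳ h) (pow-sucʳ C k))) (tC k))) (zeroʳ _))) -0#≈0#

    adj-nilpotent : ∀ k → adj C k ≋ pow C k
    adj-nilpotent zero = reflᴹ {δ}
    adj-nilpotent (suc k) = transᴹ (⊕-cong (⊗-congˡ (adj-nilpotent k)) (ι-0 (coef-nilpotent k (adj-nilpotent k)))) (⊕-identityʳ _)

    -- Traceless powers annihilate every later coefficient in Newton's recursion, so Cayley-Hamilton
    -- loses all its lower terms.
    nilpotent : ∀ k → n ℕ.≤ k → pow C k ≋ 0ᴹ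
    nilpotent k n≤k i j = trans (sym (adj-nilpotent k i j)) (cayley-hamilton C cC k n≤k i j)

    module Perturbed {e : Mat} (ce : CenM e) (ee : ∀ i j k l → e i j * e k l ≈ 0#) where

      -- Second-order terms are discarded through this property. It passes to sums and to products
      -- with further factors (central ones on the right), so all expressions linear in `e` inherit
      -- it.
      Ann : Mat → Set
      Ann M = ∀ i j k l → M i j * e k l ≈ 0#

      ann-left : ∀ N {M} → Ann M → Ann (N ⊗ M)
      ann-left N h i j k l = trans (*-distribʳ-∑ _ _) (∑-zero (λ x → trans (*-assoc _ _ _) (trans (*-congˡ (h x j k l)) (zeroʳ _))))

      ann-right : ∀ {M} N → CenM N → Ann M → Ann (M ⊗ N)
      ann-right {M} N cN h i j k l = trans (*-distribʳ-∑ _ _) (∑-zero (λ x →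
        trans (*-assoc _ _ _) (trans (*-congˡ (cN x j (e k l))) (trans (sym (*-assoc _ _ _)) (trans (*-congʳ (h i x k l)) (zeroˡ _))))))

      ann-⊕ : ∀ {M N} → Ann M → Ann N → Ann (M ⊕ N)
      ann-⊕ h h′ i j k l = trans (distribʳ _ _ _) (trans (+-cong (h i j k l) (h′ i j k l)) (+-identityˡ _))

      ann-0 : Ann 0ᴹ
      ann-0 i j k l = zeroˡ _

      ann-dpow : ∀ k → Ann (dpow C e k)
      ann-dpow zero = ann-0
      ann-dpow (suc k) = ann-⊕ (ann-left C (ann-dpow k)) (ann-right (pow C k) (cen-pow cC k) ee)

      ann-trpow : ∀ k → Ann (trpow C e k)
      ann-trpow zero = ann-0
      ann-trpow (suc k) = ann-⊕ (ann-left C (ann-trpow k)) λ i j p q →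
        trans (*-assoc _ _ _) (trans (*-congˡ (cen-δ i j _)) (trans (sym (*-assoc _ _ _)) (trans (*-congʳ
          (trans (*-congʳ (tr-∑ _)) (trans (*-distribʳ-∑ _ _) (∑-zero (λ x → ann-right (pow C k) (cen-pow cC k) ee x x p q))))) (zeroˡ _))))

      ann-⊗ : ∀ {M} → Ann M → M ⊗ e ≋ 0ᴹ
      ann-⊗ h i j = ∑-zero (λ x → h i x x j)

      ann-⊗ˡ : ∀ {M} → Ann M → e ⊗ M ≋ 0ᴹ
      ann-⊗ˡ h i j = ∑-zero (λ x → trans (ce i x _) (h x j i x))

      pow-perturbed : ∀ k → pow (C ⊕ e) k ≋ pow C k ⊕ dpow C e k
      pow-perturbed zero = symᴹ (⊕-identityʳ δ)
      pow-perturbed (suc k) = begin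
        (C ⊕ e) ⊗ pow (C ⊕ e) k ≈⟨ ⊗-congˡ (pow-perturbed k) ⟩
        (C ⊕ e) ⊗ (pow C k ⊕ dpow C e k)
          ≈⟨ solveᴹ 4 (λ C e p d → (C ⊞ e) ⊠ (p ⊞ d) ⊜ C ⊠ p ⊞ (C ⊠ d ⊞ e ⊠ p) ⊞ e ⊠ d) ≡.refl C e (pow C k) (dpow C e k) ⟩
        C ⊗ pow C k ⊕ (C ⊗ dpow C e k ⊕ e ⊗ pow C k) ⊕ e ⊗ dpow C e k ≈⟨ ⊕-congˡ (ann-⊗ˡ (ann-dpow k)) ⟩
        C ⊗ pow C k ⊕ (C ⊗ dpow C e k ⊕ e ⊗ pow C k) ⊕ 0ᴹ ≈⟨ ⊕-identityʳ _ ⟩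
        C ⊗ pow C k ⊕ (C ⊗ dpow C e k ⊕ e ⊗ pow C k) ∎
        where open import Relation.Binary.Reasoning.Setoid setoidᴹ

      tr-trpow : ∀ k a → tr (trpow C e k ⊗ pow C (suc a)) ≈ 0#
      tr-trpow zero a = tr-0 (⊗-zeroˡ _)
      tr-trpow (suc k) a = begin
        tr ((C ⊗ Q ⊕ ι t) ⊗ P) ≈⟨ trans (tr-cong (⊗-distribʳ P (C ⊗ Q) (ι t))) (tr-+ _ _) ⟩
        tr (C ⊗ Q ⊗ P) + tr (ι t ⊗ P) ≈⟨ +-cong (tr-rotate cC Q P) (tr-ι t P) ⟩
        tr (Q ⊗ P ⊗ C) + t * tr P ≈⟨ +-cong (tr-cong (transᴹ (⊗-assoc Q P C) (⊗-congˡ (pow-sucʳ C (suc a))))) (*-congˡ (tC a)) ⟩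
        tr (Q ⊗ pow C (suc (suc a))) + t * 0# ≈⟨ +-cong (tr-trpow k (suc a)) (zeroʳ t) ⟩
        0# + 0# ≈⟨ +-identityˡ 0# ⟩
        0# ∎
        where
        open import Relation.Binary.Reasoning.Setoid setoid
        Q = trpow C e k
        P = pow C (suc a)
        t = tr (e ⊗ pow C k)

      tr-dpow-pow : ∀ k a → tr (dpow C e k ⊗ pow C (suc a)) ≈ k × tr (e ⊗ pow C (k ℕ.+ a))
      tr-dpow-pow zero a = tr-0 (⊗-zeroˡ _)
      tr-dpow-pow (suc k) a = begin
        tr ((C ⊗ D ⊕ e ⊗ pow C k) ⊗ P) ≈⟨ trans (tr-cong (⊗-distribʳ P (C ⊗ D) (e ⊗ pow C k))) (tr-+ _ _) ⟩
        tr (C ⊗ D ⊗ P) + tr (e ⊗ pow C k ⊗ P) ≈⟨ +-comm _ _ ⟩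
        tr (e ⊗ pow C k ⊗ P) + tr (C ⊗ D ⊗ P)
          ≈⟨ +-cong (tr-cong (transᴹ (⊗-assoc e (pow C k) P) (⊗-congˡ (symᴹ (pow-+ C k (suc a)))))) (trans (tr-rotate cC D P) (tr-cong (transᴹ (⊗-assoc D P C) (⊗-congˡ (pow-sucʳ C (suc a)))))) ⟩
        tr (e ⊗ pow C (k ℕ.+ suc a)) + tr (D ⊗ pow C (suc (suc a))) ≈⟨ +-congˡ (tr-dpow-pow k (suc a)) ⟩
        suc k × tr (e ⊗ pow C (k ℕ.+ suc a)) ≡⟨ ≡.cong (λ m → suc k × tr (e ⊗ pow C m)) (ℕ.+-suc k a) ⟩
        suc k × tr (e ⊗ pow C (suc k ℕ.+ a)) ∎
        where
        open import Relation.Binary.Reasoning.Setoid setoid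
        D = dpow C e k
        P = pow C (suc a)

      tr-dpow-C : ∀ k → tr (dpow C e k ⊗ C) ≈ k × tr (e ⊗ pow C k)
      tr-dpow-C k = trans (tr-cong (⊗-congˡ (symᴹ (⊗-identityʳ C))))
        (trans (tr-dpow-pow k 0) (reflexive (≡.cong (λ m → k × tr (e ⊗ pow C m)) (ℕ.+-identityʳ k))))

      tr-perturbed : ∀ k → tr (pow (C ⊕ e) (suc k)) ≈ suc k × tr (e ⊗ pow C k)
      tr-perturbed k = begin
        tr (pow (C ⊕ e) (suc k)) ≈⟨ trans (tr-cong (pow-perturbed (suc k))) (tr-+ _ _) ⟩
        tr (pow C (suc k)) + tr (C ⊗ dpow C e k ⊕ e ⊗ pow C k) ≈⟨ +-cong (tC k) (tr-+ _ _) ⟩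
        0# + (tr (C ⊗ dpow C e k) + tr (e ⊗ pow C k)) ≈⟨ +-identityˡ _ ⟩
        tr (C ⊗ dpow C e k) + tr (e ⊗ pow C k) ≈⟨ +-comm _ _ ⟩
        tr (e ⊗ pow C k) + tr (C ⊗ dpow C e k) ≈⟨ +-congˡ (trans (tr-comm _ cC) (tr-dpow-C k)) ⟩
        suc k × tr (e ⊗ pow C k) ∎
        where open import Relation.Binary.Reasoning.Setoid setoid

      mutual
        -- Newton's trace contains tr(e Cᵏ) once from the power and k times from its derivative, and
        -- `inv k` divides by k + 1. The contribution of `trpow` is a combination of traces of
        -- positive powers of C, hence zero.
        coef-perturbed : ∀ k → coef (C ⊕ e) (suc k) ≈ - tr (e ⊗ pow C k)
        coef-perturbed k = -‿cong (begin
          inv k * tr (adj (C ⊕ e) k ⊗ (C ⊕ e)) ≈⟨ *-congˡ (tr-cong (⊗-congʳ (adj-perturbed k))) ⟩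
          inv k * tr ((P ⊕ D ⊖ᴹ Q) ⊗ (C ⊕ e))
            ≈⟨ *-congˡ (tr-cong (solveᴹ 5 (λ P D Q C e → (P ⊞ D ⊖ Q) ⊠ (C ⊞ e) ⊜ (P ⊠ C ⊖ Q ⊠ C) ⊞ (P ⊠ e ⊞ D ⊠ C) ⊞ (D ⊠ e ⊖ Q ⊠ e)) ≡.refl P D Q C e)) ⟩
          inv k * tr ((P ⊗ C ⊖ᴹ Q ⊗ C) ⊕ (P ⊗ e ⊕ D ⊗ C) ⊕ (D ⊗ e ⊖ᴹ Q ⊗ e))
            ≈⟨ *-congˡ (trans (tr-+ _ _) (+-cong (trans (tr-+ _ _) (+-cong left middle)) right)) ⟩
          inv k * (0# + suc k × t + 0#) ≈⟨ *-congˡ (trans (+-identityʳ _) (+-identityˡ _)) ⟩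
          inv k * (suc k × t) ≈⟨ inv-law k t ⟩
          t ∎)
          where
          open import Relation.Binary.Reasoning.Setoid setoid
          P = pow C k
          D = dpow C e k
          Q = trpow C e k
          t = tr (e ⊗ P)
          left : tr (P ⊗ C ⊖ᴹ Q ⊗ C) ≈ 0#
          left = trans (trans (tr-+ _ _) (+-cong (trans (tr-cong (pow-sucʳ C k)) (tC k)) (trans (tr-neg _)
            (trans (-‿cong (trans (tr-cong (⊗-congˡ (symᴹ (⊗-identityʳ C)))) (tr-trpow k 0))) -0#≈0#)))) (+-identityˡ 0#)
          middle : tr (P ⊗ e ⊕ D ⊗ C) ≈ suc k × t
          middle = trans (tr-+ _ _) (+-cong (tr-comm e (cen-pow cC k)) (tr-dpow-C k))
          right : tr (D ⊗ e ⊖ᴹ Q ⊗ e) ≈ 0#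
          right = tr-0 (transᴹ (⊕-cong (ann-⊗ (ann-dpow k)) (⊝-cong (ann-⊗ (ann-trpow k)))) (MR.-‿inverseʳ 0ᴹ))

        adj-perturbed : ∀ k → adj (C ⊕ e) k ≋ pow C k ⊕ dpow C e k ⊖ᴹ trpow C e k
        adj-perturbed zero = solveᴹ 0 (𝟙 ⊜ 𝟙 ⊞ 𝟘 ⊖ 𝟘) ≡.refl
        adj-perturbed (suc k) = begin
          (C ⊕ e) ⊗ adj (C ⊕ e) k ⊕ ι (coef (C ⊕ e) (suc k))
            ≈⟨ ⊕-cong (⊗-congˡ (adj-perturbed k)) (transᴹ (ι-cong (coef-perturbed k)) (ι-neg _)) ⟩
          (C ⊕ e) ⊗ (P ⊕ D ⊖ᴹ Q) ⊖ᴹ ι t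
            ≈⟨ solveᴹ 6 (λ P D Q C e t → (C ⊞ e) ⊠ (P ⊞ D ⊖ Q) ⊖ t ⊜ (C ⊠ P ⊞ (C ⊠ D ⊞ e ⊠ P) ⊖ (C ⊠ Q ⊞ t)) ⊞ (e ⊠ D ⊖ e ⊠ Q)) ≡.refl P D Q C e (ι t) ⟩
          (C ⊗ P ⊕ (C ⊗ D ⊕ e ⊗ P) ⊖ᴹ (C ⊗ Q ⊕ ι t)) ⊕ (e ⊗ D ⊖ᴹ e ⊗ Q)
            ≈⟨ ⊕-congˡ (transᴹ (⊕-cong (ann-⊗ˡ (ann-dpow k)) (⊝-cong (ann-⊗ˡ (ann-trpow k)))) (MR.-‿inverseʳ 0ᴹ)) ⟩
          (C ⊗ P ⊕ (C ⊗ D ⊕ e ⊗ P) ⊖ᴹ (C ⊗ Q ⊕ ι t)) ⊕ 0ᴹ ≈⟨ ⊕-identityʳ _ ⟩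
          C ⊗ P ⊕ (C ⊗ D ⊕ e ⊗ P) ⊖ᴹ (C ⊗ Q ⊕ ι t) ∎
          where
          open import Relation.Binary.Reasoning.Setoid setoidᴹ
          P = pow C k
          D = dpow C e k
          Q = trpow C e k
          t = tr (e ⊗ P)

      -- The part linear in `e` of the Cayley-Hamilton identity of C + e, whose constant part Cⁿ is
      -- zero.
      dpow≋trpow : dpow C e n ≋ trpow C e n
      dpow≋trpow = MR-props.x∙y⁻¹≈ε⇒x≈y _ _ (begin
        D ⊖ᴹ Q ≈⟨ ⊕-congʳ (symᴹ (⊕-identityˡ D)) ⟩
        0ᴹ ⊕ D ⊖ᴹ Q ≈⟨ ⊕-congʳ (⊕-congʳ (symᴹ (nilpotent n ℕ.≤-refl))) ⟩
        pow C n ⊕ D ⊖ᴹ Q ≈⟨ symᴹ (adj-perturbed n) ⟩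
        adj (C ⊕ e) n ≈⟨ cayley-hamilton (C ⊕ e) (cen-⊕ cC ce) n ℕ.≤-refl ⟩
        0ᴹ ∎)
        where
        open import Relation.Binary.Reasoning.Setoid setoidᴹ
        open import Algebra.Properties.Ring matRing as MR-props using ()
        D = dpow C e n
        Q = trpow C e n

-- Squares of matrices with anticommuting entries

module OddMatrix (𝓡 : Ring 0ℓ 0ℓ) (div : Divisible 𝓡) (n : ℕ) where
  open Ring 𝓡 hiding (zero)
  open Sums 𝓡
  open Divisible div
  open MatrixOps 𝓡 n
  open FirstOrder 𝓡 div n
  open NonCommSolver 𝓡 using (solve)

  record Odd (X : Mat) : Set where
    field
      anti : ∀ i j k l → X i j * X k l ≈ - (X k l * X i j)
      pair-cen : ∀ i j k l → Cen (X i j * X k l)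

  module Square {X : Mat} (oX : Odd X) where
    open Odd oX

    C : Mat
    C = X ⊗ X

    cC : CenM C
    cC i j = cen-∑ (λ x → pair-cen i x x j)

    XC : X ⊗ C ≋ C ⊗ X
    XC = symᴹ (⊗-assoc X X X)

    XCᵏ : ∀ k → X ⊗ pow C k ≋ pow C k ⊗ X
    XCᵏ k = symᴹ (pow-comm (symᴹ XC) k)

    Anti : Mat → Set
    Anti M = ∀ i j k l → X i j * M k l ≈ - (M k l * X i j)

    anti-left : ∀ {N M} → CenM N → Anti M → Anti (N ⊗ M)
    anti-left {N} {M} cN aM i j k l = begin
      X i j * ∑ (λ x → N k x * M x l) ≈⟨ *-distribˡ-∑ _ _ ⟩
      ∑ (λ x → X i j * (N k x * M x l))
        ≈⟨ ∑-cong (λ x → trans (cen-left (cN k x) _ _) (trans (*-congˡ (aM i j x l)) (trans (sym (-‿distribʳ-* _ _)) (-‿cong (sym (*-assoc _ _ _)))))) ⟩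
      ∑ (λ x → - (N k x * M x l * X i j)) ≈⟨ ∑-neg _ ⟩
      - ∑ (λ x → N k x * M x l * X i j) ≈⟨ -‿cong (*-distribʳ-∑ _ _) ⟨
      - (∑ (λ x → N k x * M x l) * X i j) ∎
      where open import Relation.Binary.Reasoning.Setoid setoid

    anti-right : ∀ {N M} → CenM N → Anti M → Anti (M ⊗ N)
    anti-right {N} {M} cN aM i j k l = begin
      X i j * ∑ (λ x → M k x * N x l) ≈⟨ *-distribˡ-∑ _ _ ⟩
      ∑ (λ x → X i j * (M k x * N x l))
        ≈⟨ ∑-cong (λ x → trans (sym (*-assoc _ _ _)) (trans (*-congʳ (aM i j k x)) (trans (sym (-‿distribˡ-* _ _)) (-‿cong
          (trans (*-assoc _ _ _) (trans (*-congˡ (sym (cN x l _))) (sym (*-assoc _ _ _)))))))) ⟩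
      ∑ (λ x → - (M k x * N x l * X i j)) ≈⟨ ∑-neg _ ⟩
      - ∑ (λ x → M k x * N x l * X i j) ≈⟨ -‿cong (*-distribʳ-∑ _ _) ⟨
      - (∑ (λ x → M k x * N x l) * X i j) ∎
      where open import Relation.Binary.Reasoning.Setoid setoid

    -- X² is traceless because moving one odd factor around the trace changes its sign.
    tC : ∀ k → tr (pow C (suc k)) ≈ 0#
    tC k = self-neg (begin
      tr (X ⊗ X ⊗ P) ≈⟨ tr-cong (⊗-assoc X X P) ⟩
      tr (X ⊗ (X ⊗ P)) ≈⟨ tr-anticomm (anti-right (cen-pow cC k) anti) ⟩
      - tr (X ⊗ P ⊗ X) ≈⟨ -‿cong (tr-cong (transᴹ (⊗-assoc X P X) (transᴹ (⊗-congˡ (symᴹ (XCᵏ k))) (symᴹ (⊗-assoc X X P))))) ⟩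
      - tr (X ⊗ X ⊗ P) ∎)
      where
      P = pow C k
      open import Relation.Binary.Reasoning.Setoid setoid

    open Nilpotent cC tC public using (nilpotent)

    cXMX : ∀ {M} → CenM M → CenM (X ⊗ M ⊗ X)
    cXMX {M} cM i j = cen-∑ (λ y → cen-resp (sym (*-distribʳ-∑ (X y j) _)) (cen-∑ (λ x →
      cen-resp (sym (trans (*-congʳ (sym (cM x y _))) (*-assoc _ _ _))) (cen-* (cM x y) (pair-cen i x y j)))))

    -- Rotating one `X` around the trace makes it pass the other one, whence the sign.
    tr-XMXN : ∀ {M N} → CenM M → CenM N → tr (X ⊗ M ⊗ X ⊗ N) ≈ - tr (M ⊗ (X ⊗ N ⊗ X))
    tr-XMXN {M} {N} cM cN = begin
      tr (X ⊗ M ⊗ X ⊗ N) ≈⟨ tr-cong (solveᴹ 3 (λ X M N → X ⊠ M ⊠ X ⊠ N ⊜ X ⊠ (M ⊠ (X ⊠ N))) ≡.refl X M N) ⟩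
      tr (X ⊗ (M ⊗ (X ⊗ N))) ≈⟨ tr-anticomm (anti-left cM (anti-right cN anti)) ⟩
      - tr (M ⊗ (X ⊗ N) ⊗ X) ≈⟨ -‿cong (tr-cong (⊗-assoc M (X ⊗ N) X)) ⟩
      - tr (M ⊗ (X ⊗ N ⊗ X)) ∎
      where open import Relation.Binary.Reasoning.Setoid setoid

    XCᵏX : ∀ k → X ⊗ pow C k ⊗ X ≋ pow C (suc k)
    XCᵏX k = transᴹ (⊗-assoc X (pow C k) X) (transᴹ (⊗-congˡ (symᴹ (XCᵏ k))) (symᴹ (⊗-assoc X X (pow C k))))

    tr-XbXCᵏ : ∀ {b} → CenM b → ∀ k → tr (X ⊗ b ⊗ X ⊗ pow C k) ≈ - tr (b ⊗ pow C (suc k))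
    tr-XbXCᵏ cb k = trans (tr-XMXN cb (cen-pow cC k)) (-‿cong (tr-cong (⊗-congˡ (XCᵏX k))))

    module _ {b : Mat} (cb : CenM b) where

      -- Since tr(XbX Cᵏ) = -tr(b Cᵏ⁺¹), the sum for `XbX` is, up to sign, the sum for `b` without
      -- the term of tr(b).
      trpow-shift : ∀ k → trpow C b (suc k) ≋ ι (tr b) ⊗ pow C k ⊖ᴹ trpow C (X ⊗ b ⊗ X) k
      trpow-shift zero = begin
        C ⊗ 0ᴹ ⊕ ι (tr (b ⊗ δ)) ≈⟨ ⊕-congˡ (ι-cong (tr-cong (⊗-identityʳ b))) ⟩
        C ⊗ 0ᴹ ⊕ ι (tr b) ≈⟨ solveᴹ 2 (λ C t → C ⊠ 𝟘 ⊞ t ⊜ t ⊠ 𝟙 ⊖ 𝟘) ≡.refl C (ι (tr b)) ⟩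
        ι (tr b) ⊗ δ ⊖ᴹ 0ᴹ ∎
        where open import Relation.Binary.Reasoning.Setoid setoidᴹ
      trpow-shift (suc k) = begin
        C ⊗ trpow C b (suc k) ⊕ ι (tr (b ⊗ pow C (suc k)))
          ≈⟨ ⊕-cong (⊗-congˡ (trpow-shift k)) (ι-cong (sym (trans (-‿cong (tr-XbXCᵏ cb k)) (-‿involutive _)))) ⟩
        C ⊗ (ι t ⊗ P ⊖ᴹ Q) ⊕ ι (- s) ≈⟨ ⊕-congˡ (ι-neg s) ⟩
        C ⊗ (ι t ⊗ P ⊖ᴹ Q) ⊖ᴹ ι s
          ≈⟨ solveᴹ 5 (λ C t P Q s → C ⊠ (t ⊠ P ⊖ Q) ⊖ s ⊜ (C ⊠ t) ⊠ P ⊖ (C ⊠ Q ⊞ s)) ≡.refl C (ι t) P Q (ι s) ⟩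
        (C ⊗ ι t) ⊗ P ⊖ᴹ (C ⊗ Q ⊕ ι s) ≈⟨ ⊕-congʳ (⊗-congʳ (symᴹ (ι-comm (cen-tr cb) C))) ⟩
        (ι t ⊗ C) ⊗ P ⊖ᴹ (C ⊗ Q ⊕ ι s) ≈⟨ ⊕-congʳ (⊗-assoc (ι t) C P) ⟩
        ι t ⊗ (C ⊗ P) ⊖ᴹ (C ⊗ Q ⊕ ι s) ∎
        where
        open import Relation.Binary.Reasoning.Setoid setoidᴹ
        t = tr b
        P = pow C k
        Q = trpow C (X ⊗ b ⊗ X) k
        s = tr (X ⊗ b ⊗ X ⊗ P)

      -- `trpow C b k` is a polynomial in `C` with central coefficients, so it commutes with `X`.
      conj-trpow : ∀ k → X ⊗ trpow C b k ⊗ X ≋ C ⊗ trpow C b k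
      conj-trpow zero = solveᴹ 2 (λ X C → X ⊠ 𝟘 ⊠ X ⊜ C ⊠ 𝟘) ≡.refl X C
      conj-trpow (suc k) = begin
        X ⊗ (C ⊗ Q ⊕ ι s) ⊗ X
          ≈⟨ solveᴹ 4 (λ X C Q s → X ⊠ (C ⊠ Q ⊞ s) ⊠ X ⊜ (X ⊠ C) ⊠ Q ⊠ X ⊞ (X ⊠ s) ⊠ X) ≡.refl X C Q (ι s) ⟩
        (X ⊗ C) ⊗ Q ⊗ X ⊕ (X ⊗ ι s) ⊗ X ≈⟨ ⊕-cong (⊗-congʳ (⊗-congʳ XC)) (⊗-congʳ (symᴹ (ι-comm cs X))) ⟩
        (C ⊗ X) ⊗ Q ⊗ X ⊕ (ι s ⊗ X) ⊗ X
          ≈⟨ solveᴹ 4 (λ X C Q s → (C ⊠ X) ⊠ Q ⊠ X ⊞ (s ⊠ X) ⊠ X ⊜ C ⊠ (X ⊠ Q ⊠ X) ⊞ s ⊠ (X ⊠ X)) ≡.refl X C Q (ι s) ⟩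
        C ⊗ (X ⊗ Q ⊗ X) ⊕ ι s ⊗ C ≈⟨ ⊕-cong (⊗-congˡ (conj-trpow k)) (ι-comm cs C) ⟩
        C ⊗ (C ⊗ Q) ⊕ C ⊗ ι s ≈⟨ symᴹ (⊗-distribˡ C (C ⊗ Q) (ι s)) ⟩
        C ⊗ (C ⊗ Q ⊕ ι s) ∎
        where
        open import Relation.Binary.Reasoning.Setoid setoidᴹ
        Q = trpow C b k
        s = tr (b ⊗ pow C k)
        cs = cen-tr (cen-⊗ cb (cen-pow cC k))

      module _ (bb : ∀ i j k l → b i j * b k l ≈ 0#) where

        private
          XbX-expand : ∀ i j → (X ⊗ b ⊗ X) i j ≈ ∑ (λ y → ∑ (λ x → b x y * (X i x * X y j)))
          XbX-expand i j = ∑-cong (λ y → trans (*-distribʳ-∑ (X y j) _) (∑-cong (λ x →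
            trans (*-congʳ (sym (cb x y (X i x)))) (*-assoc _ _ _))))

          b-XbX : ∀ p q i j → b p q * (X ⊗ b ⊗ X) i j ≈ 0#
          b-XbX p q i j = trans (*-congˡ (XbX-expand i j)) (trans (*-distribˡ-∑ _ _) (∑-zero (λ y →
            trans (*-distribˡ-∑ _ _) (∑-zero (λ x → trans (sym (*-assoc _ _ _)) (trans (*-congʳ (bb p q x y)) (zeroˡ _)))))))

        XbX-sq : ∀ i j k l → (X ⊗ b ⊗ X) i j * (X ⊗ b ⊗ X) k l ≈ 0#
        XbX-sq i j k l = trans (*-congʳ (XbX-expand i j)) (trans (*-distribʳ-∑ _ _) (∑-zero (λ y →
          trans (*-distribʳ-∑ _ _) (∑-zero (λ x → trans (*-assoc _ _ _) (trans (*-congˡ (pair-cen i x y j _))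
            (trans (sym (*-assoc _ _ _)) (trans (*-congʳ (b-XbX x y k l)) (zeroˡ _)))))))))

        -- The sum turns out to be its own negative. Shifting replaces `b` by `XbX` with a sign;
        -- `dpow≋trpow` turns the sum into a derivative; derivatives along `b` and `XbX` are
        -- conjugate by `X`; and `dpow≋trpow` for `b` leads back.
        trpow-vanish : trpow C b (suc n) ≋ 0ᴹ
        trpow-vanish i j = self-neg (begin
          trpow C b (suc n) i j ≈⟨ trpow-shift n i j ⟩
          (ι (tr b) ⊗ pow C n ⊖ᴹ trpow C (X ⊗ b ⊗ X) n) i j
            ≈⟨ +-congʳ (transᴹ (⊗-congˡ (nilpotent n ℕ.≤-refl)) (⊗-zeroʳ (ι (tr b))) i j) ⟩
          0# - trpow C (X ⊗ b ⊗ X) n i j ≈⟨ +-identityˡ _ ⟩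
          - trpow C (X ⊗ b ⊗ X) n i j ≈⟨ -‿cong (symᴹ (P₂.dpow≋trpow) i j) ⟩
          - dpow C (X ⊗ b ⊗ X) n i j ≈⟨ -‿cong (symᴹ (dpow-conj XC XC b n) i j) ⟩
          - (X ⊗ dpow C b n ⊗ X) i j ≈⟨ -‿cong (⊗-congʳ {X} (⊗-congˡ {X} P₁.dpow≋trpow) i j) ⟩
          - (X ⊗ trpow C b n ⊗ X) i j ≈⟨ -‿cong (conj-trpow n i j) ⟩
          - (C ⊗ trpow C b n) i j ≈⟨ -‿cong (+-identityʳ _) ⟨
          -- The zero stands for the last scalar tr(b Cⁿ) of the recursion, which vanishes because
          -- Cⁿ does.
          - ((C ⊗ trpow C b n) i j + 0#)
            ≈⟨ -‿cong (+-congˡ (ι-0 (tr-0 (transᴹ (⊗-congˡ (nilpotent n ℕ.≤-refl)) (⊗-zeroʳ b))) i j)) ⟨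
          - trpow C b (suc n) i j ∎)
          where
          open import Relation.Binary.Reasoning.Setoid setoid
          module P₁ = Nilpotent.Perturbed cC tC cb bb
          module P₂ = Nilpotent.Perturbed cC tC (cXMX cb) XbX-sq

-- Sums over antidiagonals

-- anti _+_ h k = ∑_{i+j=k} h i j
anti : {A : Set} → (A → A → A) → (ℕ → ℕ → A) → ℕ → A
anti _+_ h zero = h 0 0
anti _+_ h (suc k) = h 0 (suc k) + anti _+_ (λ i j → h (suc i) j) k

module Convolution (𝓡 : Ring 0ℓ 0ℓ) where
  open Ring 𝓡 hiding (zero)
  open Sums 𝓡
  open NonCommSolver 𝓡 using (solve)
  open import Relation.Binary.Reasoning.Setoid setoid

  ad : (ℕ → ℕ → Carrier) → ℕ → Carrier
  ad = anti _+_

  ad-cong : ∀ {h h′ : ℕ → ℕ → Carrier} k → (∀ i j → i ℕ.+ j ≡ k → h i j ≈ h′ i j) → ad h k ≈ ad h′ k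
  ad-cong zero e = e 0 0 ≡.refl
  ad-cong (suc k) e = +-cong (e 0 (suc k) ≡.refl) (ad-cong k (λ i j p → e (suc i) j (≡.cong suc p)))

  ad-last : ∀ (h : ℕ → ℕ → Carrier) k → ad h (suc k) ≈ ad (λ i j → h i (suc j)) k + h (suc k) 0
  ad-last h zero = refl
  ad-last h (suc k) = trans (+-congˡ (ad-last (λ i j → h (suc i) j) k)) (sym (+-assoc _ _ _))

  ad-swap : ∀ (h : ℕ → ℕ → Carrier) k → ad h k ≈ ad (λ i j → h j i) k
  ad-swap h zero = refl
  ad-swap h (suc k) = trans (ad-last h k) (trans (+-comm _ _) (+-congˡ (ad-swap (λ i j → h i (suc j)) k)))

  ad-+ : ∀ (h h′ : ℕ → ℕ → Carrier) k → ad (λ i j → h i j + h′ i j) k ≈ ad h k + ad h′ k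
  ad-+ h h′ zero = refl
  ad-+ h h′ (suc k) = trans (+-congˡ (ad-+ _ _ k)) (solve 4 (λ a b c d → a ⊞ b ⊞ (c ⊞ d) ⊜ a ⊞ c ⊞ (b ⊞ d)) ≡.refl _ _ _ _)

  ad-0 : ∀ {h : ℕ → ℕ → Carrier} k → (∀ i j → i ℕ.+ j ≡ k → h i j ≈ 0#) → ad h k ≈ 0#
  ad-0 zero e = e 0 0 ≡.refl
  ad-0 (suc k) e = trans (+-cong (e 0 (suc k) ≡.refl) (ad-0 k (λ i j p → e (suc i) j (≡.cong suc p)))) (+-identityˡ 0#)

  ad-*ˡ : ∀ x (h : ℕ → ℕ → Carrier) k → x * ad h k ≈ ad (λ i j → x * h i j) k
  ad-*ˡ x h zero = refl
  ad-*ˡ x h (suc k) = trans (distribˡ x _ _) (+-congˡ (ad-*ˡ x _ k))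

  ad-*ʳ : ∀ x (h : ℕ → ℕ → Carrier) k → ad h k * x ≈ ad (λ i j → h i j * x) k
  ad-*ʳ x h zero = refl
  ad-*ʳ x h (suc k) = trans (distribʳ x _ _) (+-congˡ (ad-*ʳ x _ k))

  ad-assoc : ∀ (h : ℕ → ℕ → ℕ → Carrier) k → ad (λ i m → ad (h i) m) k ≈ ad (λ m l → ad (λ i j → h i j l) m) k
  ad-assoc h zero = refl
  ad-assoc h (suc k) = begin
    h 0 0 (suc k) + ad (λ j l → h 0 (suc j) l) k + ad (λ i m → ad (h (suc i)) m) k ≈⟨ +-congˡ (ad-assoc (λ i → h (suc i)) k) ⟩
    h 0 0 (suc k) + ad (λ j l → h 0 (suc j) l) k + ad (λ m l → ad (λ i j → h (suc i) j l) m) k ≈⟨ +-assoc _ _ _ ⟩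
    h 0 0 (suc k) + (ad (λ j l → h 0 (suc j) l) k + ad (λ m l → ad (λ i j → h (suc i) j l) m) k) ≈⟨ +-congˡ (ad-+ _ _ k) ⟨
    h 0 0 (suc k) + ad (λ m l → h 0 (suc m) l + ad (λ i j → h (suc i) j l) m) k ∎

  ad-single : ∀ (h : ℕ → ℕ → Carrier) a b → (∀ i j → i ℕ.+ j ≡ a ℕ.+ b → i ≢ a → h i j ≈ 0#) → ad h (a ℕ.+ b) ≈ h a b
  ad-single h zero zero e = refl
  ad-single h zero (suc b) e = trans (+-congˡ (ad-0 b (λ i j p → e (suc i) j (≡.cong suc p) (λ ())))) (+-identityʳ _)
  ad-single h (suc a) b e = trans (+-cong (e 0 _ ≡.refl (λ ())) (ad-single (λ i j → h (suc i) j) a b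
    (λ i j p i≢a → e (suc i) j (≡.cong suc p) (λ q → i≢a (ℕ.suc-injective q))))) (+-identityˡ _)

  -- u is the geometric series of C applied to c: then so is x * u applied to x * c.
  ad-geometric : ∀ {C} {c u x : ℕ → Carrier} → (∀ i → x i * C ≈ C * x i) → u 0 ≈ c 0 → (∀ m → u (suc m) ≈ C * u m + c (suc m)) →
    ∀ m → ad (λ i j → x i * u j) (suc m) ≈ C * ad (λ i j → x i * u j) m + ad (λ i j → x i * c j) (suc m)
  ad-geometric {C} {c} {u} {x} xC u0 us m = begin
    ad (λ i j → x i * u j) (suc m) ≈⟨ ad-last (λ i j → x i * u j) m ⟩
    ad (λ i j → x i * u (suc j)) m + x (suc m) * u 0
      ≈⟨ +-cong (ad-cong m (λ i j _ → trans (*-congˡ (us j)) (trans (distribˡ _ _ _) (+-congʳ (trans (sym (*-assoc _ _ _)) (trans (*-congʳ (xC i)) (*-assoc _ _ _))))))) (*-congˡ u0) ⟩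
    ad (λ i j → C * (x i * u j) + x i * c (suc j)) m + x (suc m) * c 0 ≈⟨ +-congʳ (ad-+ _ _ m) ⟩
    ad (λ i j → C * (x i * u j)) m + ad (λ i j → x i * c (suc j)) m + x (suc m) * c 0 ≈⟨ +-assoc _ _ _ ⟩
    ad (λ i j → C * (x i * u j)) m + (ad (λ i j → x i * c (suc j)) m + x (suc m) * c 0)
      ≈⟨ +-cong (ad-*ˡ C _ m) (ad-last (λ i j → x i * c j) m) ⟨
    C * ad (λ i j → x i * u j) m + ad (λ i j → x i * c j) (suc m) ∎

iter : {A : Set} → (A → A) → ℕ → A → A
iter f zero x = x
iter f (suc k) x = f (iter f k x)

-- Filtered supercommutative rings

-- A ring with a parity automorphism σ for which it is supercommutative, and a multiplicative
-- filtration with an involution ρ acting by (-1)ʲ on the j-th graded piece.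
record SuperRing : Set₁ where
  no-eta-equality
  infixl 6 _+_
  infixl 7 _*_
  infix 8 -_
  field
    Carrier : Set
    _+_ _*_ : Carrier → Carrier → Carrier
    -_ : Carrier → Carrier
    0# 1# : Carrier
    isRing : IsRing _≡_ _+_ _*_ -_ 0# 1#
    σ ρ : Carrier → Carrier
    σ-+ : ∀ x y → σ (x + y) ≡ σ x + σ y
    σ-* : ∀ x y → σ (x * y) ≡ σ x * σ y
    σ-1 : σ 1# ≡ 1#
    σ-σ : ∀ x → σ (σ x) ≡ x
    ρ-+ : ∀ x y → ρ (x + y) ≡ ρ x + ρ y
    ρ-* : ∀ x y → ρ (x * y) ≡ ρ x * ρ y
    ρ-1 : ρ 1# ≡ 1#
    ρ-ρ : ∀ x → ρ (ρ x) ≡ x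
    σ-ρ : ∀ x → σ (ρ x) ≡ ρ (σ x)
    even-comm : ∀ {x} y → σ x ≡ x → x * y ≡ y * x
    odd-comm : ∀ {x} y → σ x ≡ - x → x * y ≡ σ y * x
    inv : ℕ → Carrier
    inv-cen : ∀ k y → inv k * y ≡ y * inv k
    inv-law : ∀ k x → inv k * Raw._×_ _+_ _*_ -_ 0# 1# (suc k) x ≡ x
    Fil : ℕ → Carrier → Set
    fil-all : ∀ x → Fil 0 x
    fil-zero : ∀ j → Fil j 0#
    fil-+ : ∀ j {x y} → Fil j x → Fil j y → Fil j (x + y)
    fil-neg : ∀ j {x} → Fil j x → Fil j (- x)
    fil-* : ∀ i j {x y} → Fil i x → Fil j y → Fil (i ℕ.+ j) (x * y)
    fil-pred : ∀ j {x} → Fil (suc j) x → Fil j x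
    fil-σ : ∀ j {x} → Fil j x → Fil j (σ x)
    fil-ρ : ∀ j {x} → Fil j x → Fil j (ρ x)
    fil-parity : ∀ j {x} → Fil j x → Fil (suc j) (x + - iter -_ j (ρ x))

  ring : Ring 0ℓ 0ℓ
  ring = record { isRing = isRing }

  open Ring ring public using (+-assoc; +-comm; +-identityˡ; +-identityʳ; -‿inverseˡ; -‿inverseʳ; *-assoc; *-identityˡ; *-identityʳ; distribˡ; distribʳ; zeroˡ; zeroʳ; _-_)
  open Sums ring public using (_×_; ∑; δ; -0#≈0#; -‿involutive; -‿distribˡ-*; -‿distribʳ-*; -‿+-comm)

  divisible : Divisible ring
  divisible = record { inv = inv; inv-cen = inv-cen; inv-law = inv-law }

  module _ (j : ℕ) where
    open NonCommSolver ring using (solve)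
    infix 4 _∼_
    _∼_ : Carrier → Carrier → Set
    x ∼ y = Fil j (x - y)

    fil-*ˡ : ∀ x {y} → Fil j y → Fil j (x * y)
    fil-*ˡ x h = fil-* 0 j (fil-all x) h

    fil-*ʳ : ∀ {x} y → Fil j x → Fil j (x * y)
    fil-*ʳ {x} y h = ≡.subst (λ k → Fil k (x * y)) (ℕ.+-identityʳ j) (fil-* j 0 h (fil-all y))

    ≡⇒∼ : ∀ {x y} → x ≡ y → x ∼ y
    ≡⇒∼ {x} ≡.refl = ≡.subst (Fil j) (≡.sym (-‿inverseʳ x)) (fil-zero j)

    -- Carrier and operations are kept and only the equality is coarsened. A matrix product, a trace
    -- or a Newton coefficient is thus literally the same expression modulo `Fil j`, and every lemma
    -- about rings can be reread there.
    quotient : Ring 0ℓ 0ℓ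
    quotient = record
      { Carrier = Carrier ; _≈_ = _∼_ ; _+_ = _+_ ; _*_ = _*_ ; -_ = -_ ; 0# = 0# ; 1# = 1#
      ; isRing = record
        { +-isAbelianGroup = record
          { isGroup = record
            { isMonoid = record
              { isSemigroup = record
                { isMagma = record
                  { isEquivalence = record
                    { refl = ≡⇒∼ ≡.refl
                    ; sym = λ {x} {y} h → ≡.subst (Fil j) (solve 2 (λ x y → ⊟ (x ⊖ y) ⊜ y ⊖ x) ≡.refl x y) (fil-neg j h)
                    ; trans = λ {x} {y} {z} h h′ → ≡.subst (Fil j) (solve 3 (λ x y z → x ⊖ y ⊞ (y ⊖ z) ⊜ x ⊖ z) ≡.refl x y z) (fil-+ j h h′) }
                  ; ∙-cong = λ {x} {y} {u} {v} h h′ → ≡.subst (Fil j)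
                      (solve 4 (λ x y u v → x ⊖ y ⊞ (u ⊖ v) ⊜ x ⊞ u ⊖ (y ⊞ v)) ≡.refl x y u v) (fil-+ j h h′) }
                ; assoc = λ x y z → ≡⇒∼ (+-assoc x y z) }
              ; identity = (λ x → ≡⇒∼ (+-identityˡ x)) , (λ x → ≡⇒∼ (+-identityʳ x)) }
            ; inverse = (λ x → ≡⇒∼ (-‿inverseˡ x)) , (λ x → ≡⇒∼ (-‿inverseʳ x))
            ; ⁻¹-cong = λ {x} {y} h → ≡.subst (Fil j) (solve 2 (λ x y → ⊟ (x ⊖ y) ⊜ ⊟ x ⊖ ⊟ y) ≡.refl x y) (fil-neg j h) }
          ; comm = λ x y → ≡⇒∼ (+-comm x y) }
        ; *-cong = λ {x} {y} {u} {v} h h′ → ≡.subst (Fil j)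
            (solve 4 (λ x y u v → (x ⊖ y) ⊠ u ⊞ y ⊠ (u ⊖ v) ⊜ x ⊠ u ⊖ y ⊠ v) ≡.refl x y u v) (fil-+ j (fil-*ʳ u h) (fil-*ˡ y h′))
        ; *-assoc = λ x y z → ≡⇒∼ (*-assoc x y z)
        ; *-identity = (λ x → ≡⇒∼ (*-identityˡ x)) , (λ x → ≡⇒∼ (*-identityʳ x))
        ; distrib = (λ x y z → ≡⇒∼ (distribˡ x y z)) , (λ x y z → ≡⇒∼ (distribʳ x y z)) } }

    quotient-divisible : Divisible quotient
    quotient-divisible = record { inv = inv; inv-cen = λ k y → ≡⇒∼ (inv-cen k y); inv-law = λ k x → ≡⇒∼ (inv-law k x) }

    fil⇒∼ : ∀ {x} → Fil j x → x ∼ 0#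
    fil⇒∼ {x} h = ≡.subst (Fil j) (solve 1 (λ x → x ⊜ x ⊖ 𝟘) ≡.refl x) h

    ∼⇒fil : ∀ {x} → x ∼ 0# → Fil j x
    ∼⇒fil {x} h = ≡.subst (Fil j) (solve 1 (λ x → x ⊖ 𝟘 ⊜ x) ≡.refl x) h

    fil-half : ∀ {x} → Fil j (x + x) → Fil j x
    fil-half {x} h = ∼⇒fil (Divisible.double-cancel quotient-divisible (fil⇒∼ h))

  fil-≤ : ∀ {i j} → i ℕ.≤ j → ∀ {x} → Fil j x → Fil i x
  fil-≤ i≤j h = go (ℕ.≤⇒≤′ i≤j) h
    where
    go : ∀ {i j} → i ℕ.≤′ j → ∀ {x} → Fil j x → Fil i x
    go ℕ.≤′-refl h = h
    go (ℕ.≤′-step l) h = go l (fil-pred _ h)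

  ρ-0 : ρ 0# ≡ 0#
  ρ-0 = Sums.x+x≈x⇒x≈0 ring (ρ 0#) (≡.trans (≡.sym (ρ-+ 0# 0#)) (≡.cong ρ (+-identityˡ 0#)))

  σ-0 : σ 0# ≡ 0#
  σ-0 = Sums.x+x≈x⇒x≈0 ring (σ 0#) (≡.trans (≡.sym (σ-+ 0# 0#)) (≡.cong σ (+-identityˡ 0#)))

  σ-neg : ∀ x → σ (- x) ≡ - σ x
  σ-neg x = Sums.+-inverseʳ-unique ring (σ x) (σ (- x)) (≡.trans (≡.sym (σ-+ x (- x))) (≡.trans (≡.cong σ (-‿inverseʳ x)) σ-0))

  σ-∑ : ∀ {n} (f : Fin n → Carrier) → σ (∑ f) ≡ ∑ (λ i → σ (f i))
  σ-∑ {zero} f = ≡.trans (≡.cong σ (fold-zero _+_ 0# f)) (≡.trans σ-0 (≡.sym (fold-zero _+_ 0# _)))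
  σ-∑ {suc n} f = ≡.trans (≡.cong σ (fold-suc _+_ 0# f)) (≡.trans (σ-+ _ _)
    (≡.trans (≡.cong₂ _+_ ≡.refl (σ-∑ (λ i → f (suc i)))) (≡.sym (fold-suc _+_ 0# _))))

  ρ-neg : ∀ x → ρ (- x) ≡ - ρ x
  ρ-neg x = Sums.+-inverseʳ-unique ring (ρ x) (ρ (- x)) (≡.trans (≡.sym (ρ-+ x (- x))) (≡.trans (≡.cong ρ (-‿inverseʳ x)) ρ-0))

  ρ-∑ : ∀ {n} (f : Fin n → Carrier) → ρ (∑ f) ≡ ∑ (λ i → ρ (f i))
  ρ-∑ {zero} f = ≡.trans (≡.cong ρ (fold-zero _+_ 0# f)) (≡.trans ρ-0 (≡.sym (fold-zero _+_ 0# _)))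
  ρ-∑ {suc n} f = ≡.trans (≡.cong ρ (fold-suc _+_ 0# f)) (≡.trans (ρ-+ _ _)
    (≡.trans (≡.cong₂ _+_ ≡.refl (ρ-∑ (λ i → f (suc i)))) (≡.sym (fold-suc _+_ 0# _))))

  ρ-× : ∀ k x → ρ (k × x) ≡ k × ρ x
  ρ-× zero x = ρ-0
  ρ-× (suc k) x = ≡.trans (ρ-+ _ _) (≡.cong₂ _+_ ≡.refl (ρ-× k x))

  ρ-inv : ∀ k → ρ (inv k) ≡ inv k
  ρ-inv k = begin
    ρ (inv k) ≡⟨ inv-law k (ρ (inv k)) ⟨
    inv k * (suc k × ρ (inv k)) ≡⟨ ≡.cong (inv k *_) (ρ-× (suc k) (inv k)) ⟨
    inv k * ρ (suc k × inv k) ≡⟨ ≡.cong (λ x → inv k * ρ x) one ⟩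
    inv k * ρ 1# ≡⟨ ≡.cong (inv k *_) ρ-1 ⟩
    inv k * 1# ≡⟨ *-identityʳ _ ⟩
    inv k ∎
    where
    open ≡.≡-Reasoning
    one : suc k × inv k ≡ 1#
    one = begin
      suc k × inv k ≡⟨ Sums.×-cong ring (suc k) (*-identityʳ (inv k)) ⟨
      suc k × (inv k * 1#) ≡⟨ Sums.×-comm-* ring (suc k) (inv k) 1# ⟨
      inv k * (suc k × 1#) ≡⟨ inv-law k 1# ⟩
      1# ∎

  fil-∑ : ∀ j {n} {f : Fin n → Carrier} → (∀ i → Fil j (f i)) → Fil j (∑ f)
  fil-∑ j h = ∼⇒fil j (Sums.∑-zero (quotient j) (λ i → fil⇒∼ j (h i)))

  -- An element of Fil j on which ρ acts with the wrong sign lies one step deeper.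
  fil-odd : ∀ {x} → ρ x ≡ - x → Fil 2 x → Fil 3 x
  fil-odd {x} e h = fil-half 3 (≡.subst (Fil 3) (≡.trans (≡.cong (λ y → x + - - - y) e)
    (NonCommSolver.solve ring 1 (λ x → x ⊞ ⊟ ⊟ ⊟ ⊟ x ⊜ x ⊞ x) ≡.refl x)) (fil-parity 2 h))

  fil-even : ∀ {x} → ρ x ≡ x → Fil 3 x → Fil 4 x
  fil-even {x} e h = fil-half 4 (≡.subst (Fil 4) (≡.trans (≡.cong (λ y → x + - - - - y) e)
    (NonCommSolver.solve ring 1 (λ x → x ⊞ ⊟ ⊟ ⊟ ⊟ x ⊜ x ⊞ x) ≡.refl x)) (fil-parity 3 h))

module Filtered (S : SuperRing) (n : ℕ) where
  open SuperRing S public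
  open Sums ring public using (Cen; cen-resp; cen-*; cen-+; cen-neg; cen-∑; cen-0; cen-1; cen-left)
  open MatrixOps ring n public
  module Q (j : ℕ) where
    open Ring (quotient j) public using (refl; sym; trans; reflexive; +-cong; +-congˡ; +-congʳ; *-cong; *-congˡ; *-congʳ; -‿cong; setoid)
    open MatrixOps (quotient j) n public
      using (_≋_; reflᴹ; symᴹ; transᴹ; ⊕-cong; ⊕-congˡ; ⊕-congʳ; ⊝-cong; ⊗-cong; ⊗-congˡ; ⊗-congʳ; setoidᴹ; matRing; module MR; tr-cong; ι-cong; ι-0)

  FilM : ℕ → Mat → Set
  FilM j M = ∀ i k → Fil j (M i k)

  ≋⇒∼ : ∀ j {M N} → M ≋ N → Q._≋_ j M N
  ≋⇒∼ j h i k = ≡⇒∼ j (h i k)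

  filM-⊗ : ∀ i j {M N} → FilM i M → FilM j N → FilM (i ℕ.+ j) (M ⊗ N)
  filM-⊗ i j h h′ k l = fil-∑ (i ℕ.+ j) (λ x → fil-* i j (h k x) (h′ x l))

  filM-⊗ˡ : ∀ j M {N} → FilM j N → FilM j (M ⊗ N)
  filM-⊗ˡ j M h = filM-⊗ 0 j {M} (λ _ _ → fil-all _) h

  filM-⊗ʳ : ∀ j {M} N → FilM j M → FilM j (M ⊗ N)
  filM-⊗ʳ j N h k l = fil-∑ j (λ x → fil-*ʳ j (N x l) (h k x))

  filM-⊕ : ∀ j {M N} → FilM j M → FilM j N → FilM j (M ⊕ N)
  filM-⊕ j h h′ k l = fil-+ j (h k l) (h′ k l)

  filM-ι : ∀ j {a} → Fil j a → FilM j (ι a)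
  filM-ι j h k l = fil-*ʳ j (δ k l) h

  filM-resp : ∀ j {M N} → M ≋ N → FilM j M → FilM j N
  filM-resp j h f k l = ≡.subst (Fil j) (h k l) (f k l)

  fil-tr : ∀ j {M} → FilM j M → Fil j (tr M)
  fil-tr j {M} h = ≡.subst (Fil j) (≡.sym (tr-∑ M)) (fil-∑ j (λ i → h i i))

  ρᴹ : Mat → Mat
  ρᴹ M i j = ρ (M i j)

  ρ-⊗ : ∀ M N → ρᴹ (M ⊗ N) ≋ ρᴹ M ⊗ ρᴹ N
  ρ-⊗ M N i j = ≡.trans (ρ-∑ _) (Sums.∑-cong ring (λ x → ρ-* _ _))

  ρ-tr : ∀ M → ρ (tr M) ≡ tr (ρᴹ M)
  ρ-tr M = ≡.trans (≡.cong ρ (tr-∑ M)) (≡.trans (ρ-∑ _) (≡.sym (tr-∑ _)))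

  ρ-δ : ∀ {m} (i j : Fin m) → ρ (δ i j) ≡ δ i j
  ρ-δ zero zero = ρ-1
  ρ-δ zero (suc _) = ρ-0
  ρ-δ (suc _) zero = ρ-0
  ρ-δ (suc i) (suc j) = ρ-δ i j

  ρ-ι : ∀ a → ρᴹ (ι a) ≋ ι (ρ a)
  ρ-ι a i j = ≡.trans (ρ-* _ _) (≡.cong (ρ a *_) (ρ-δ i j))

  ρ-pow : ∀ M k → ρᴹ (pow M k) ≋ pow (ρᴹ M) k
  ρ-pow M zero = ρ-δ
  ρ-pow M (suc k) = transᴹ (ρ-⊗ M (pow M k)) (⊗-congˡ (ρ-pow M k))

  pow-cong : ∀ {M N} → M ≋ N → ∀ k → pow M k ≋ pow N k
  pow-cong h zero = reflᴹ {δ}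
  pow-cong h (suc k) = ⊗-cong h (pow-cong h k)

  ρ-anti : ∀ (h : ℕ → ℕ → Carrier) k → ρ (anti _+_ h k) ≡ anti _+_ (λ i j → ρ (h i j)) k
  ρ-anti h zero = ≡.refl
  ρ-anti h (suc k) = ≡.trans (ρ-+ _ _) (≡.cong₂ _+_ ≡.refl (ρ-anti _ k))

  cen-anti : ∀ (h : ℕ → ℕ → Carrier) k → (∀ i j → Cen (h i j)) → Cen (anti _+_ h k)
  cen-anti h zero c = c 0 0
  cen-anti h (suc k) c = cen-+ (c 0 (suc k)) (cen-anti _ k (λ i j → c (suc i) j))

  -- The geometric series of b, for b⁴ = 0.
  geometric : Mat → Mat
  geometric b = δ ⊕ b ⊕ b ⊗ b ⊕ b ⊗ (b ⊗ b)

  -- The sum of all words with k letters X, in which a letter b changes sign when it passes a letter X.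
  walks : Mat → Mat → ℕ → Mat
  walks X b zero = geometric b
  walks X b (suc k) = geometric b ⊗ (X ⊗ ρᴹ (walks X b k))

  -- Under these conditions `ρ` is the substitution b ↦ -b with X fixed, and each factor `b` raises
  -- the filtration degree by one.
  record Graded (X b : Mat) : Set where
    field
      X-odd : ∀ i j → σ (X i j) ≡ - X i j
      X-ρ : ∀ i j → ρ (X i j) ≡ X i j
      b-even : ∀ i j → σ (b i j) ≡ b i j
      b-ρ : ∀ i j → ρ (b i j) ≡ - b i j
      b-fil : ∀ i j → Fil 1 (b i j)

    cb : CenM b
    cb i j y = even-comm y (b-even i j)

  odd-anti : ∀ {x y} → σ x ≡ - x → σ y ≡ - y → x * y ≡ - (y * x)
  odd-anti {x} {y} hx hy = ≡.trans (odd-comm y hx) (≡.trans (≡.cong (_* x) hy) (≡.sym (-‿distribˡ-* y x)))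

  odd-pair : ∀ {x y} → σ x ≡ - x → σ y ≡ - y → Cen (x * y)
  odd-pair {x} {y} hx hy z = even-comm z (≡.trans (σ-* x y) (≡.trans (≡.cong₂ _*_ hx hy)
    (NonCommSolver.solve ring 2 (λ x y → ⊟ x ⊠ ⊟ y ⊜ x ⊠ y) ≡.refl x y)))

  module O = OddMatrix ring divisible n

  odd-matrix : ∀ {X} → (∀ i j → σ (X i j) ≡ - X i j) → O.Odd X
  odd-matrix h = record { anti = λ i j k l → odd-anti (h i j) (h k l) ; pair-cen = λ i j k l → odd-pair (h i j) (h k l) }

  odd-matrix-∼ : ∀ d {X} → (∀ i j → σ (X i j) ≡ - X i j) → OddMatrix.Odd (quotient d) (quotient-divisible d) n X
  odd-matrix-∼ d h = record
    { anti = λ i j k l → ≡⇒∼ d (odd-anti (h i j) (h k l))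
    ; pair-cen = λ i j k l y → ≡⇒∼ d (odd-pair (h i j) (h k l) y) }

-- The traces γ and their convolution q

module Gamma (S : SuperRing) (nil : ∀ {x} → SuperRing.Fil S 4 x → x ≡ SuperRing.0# S) (n : ℕ)
             {X b : Filtered.Mat S n} (gr : Filtered.Graded S n X b) where
  open Filtered S n
  open Graded gr
  open O.Square (odd-matrix X-odd) public using (C; cC; XC; XCᵏ; tC; nilpotent; cXMX; tr-XMXN; tr-XbXCᵏ; XCᵏX)
  open import Relation.Binary.Reasoning.Setoid setoidᴹ

  ρC : ρᴹ C ≋ C
  ρC = transᴹ (ρ-⊗ X X) (⊗-cong X-ρ X-ρ)

  ρ-powC : ∀ k → ρᴹ (pow C k) ≋ pow C k
  ρ-powC k = transᴹ (ρ-pow C k) (pow-cong ρC k)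

  -- The first order term of U = X g′ X g.
  e : Mat
  e = C ⊗ b ⊖ᴹ X ⊗ b ⊗ X

  -- The value at 0 is set to zero instead of tr b. The traces of powers of U only produce tr(b Cᵏ)
  -- with k ≥ 1, so the convolution `q` must run over positive indices.
  γ : ℕ → Carrier
  γ zero = 0#
  γ (suc k) = tr (b ⊗ pow C (suc k))

  q : ℕ → Carrier
  q = anti _+_ (λ i j → γ i * γ j)

  -- `u m` is ∑ γᵢ Cᵐ⁻ⁱ, the sum that appears in the first-order Cayley-Hamilton identities.
  u : ℕ → Mat
  u zero = 0ᴹ
  u (suc m) = C ⊗ u m ⊕ ι (γ (suc m))

  γ-cen : ∀ k → Cen (γ k)
  γ-cen zero = cen-0
  γ-cen (suc k) = cen-tr (cen-⊗ cb (cen-pow cC (suc k)))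

  γ-fil : ∀ k → Fil 1 (γ k)
  γ-fil zero = fil-zero 1
  γ-fil (suc k) = fil-tr 1 (filM-⊗ʳ 1 (pow C (suc k)) b-fil)

  γ-ρ : ∀ k → ρ (γ k) ≡ - γ k
  γ-ρ zero = ≡.trans ρ-0 (≡.sym -0#≈0#)
  γ-ρ (suc k) = ≡.trans (ρ-tr _) (≡.trans (tr-cong (transᴹ (ρ-⊗ b (pow C (suc k))) (transᴹ (⊗-cong b-ρ (ρ-powC (suc k))) neg-left))) (tr-neg _))
    where
    neg-left : ⊝ b ⊗ pow C (suc k) ≋ ⊝ (b ⊗ pow C (suc k))
    neg-left = solveᴹ 2 (λ b p → ⊟ b ⊠ p ⊜ ⊟ (b ⊠ p)) ≡.refl b (pow C (suc k))

  γ-vanish : ∀ k → n ℕ.≤ k → γ k ≡ 0#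
  γ-vanish zero n≤k = ≡.refl
  γ-vanish (suc k) n≤k = tr-0 (transᴹ (⊗-congˡ (nilpotent (suc k) n≤k)) (⊗-zeroʳ b))

  γγ-ρ : ∀ i j → ρ (γ i * γ j) ≡ γ i * γ j
  γγ-ρ i j = ≡.trans (ρ-* _ _) (≡.trans (≡.cong₂ _*_ (γ-ρ i) (γ-ρ j))
    (NonCommSolver.solve ring 2 (λ x y → ⊟ x ⊠ ⊟ y ⊜ x ⊠ y) ≡.refl (γ i) (γ j)))

  q-ρ : ∀ k → ρ (q k) ≡ q k
  q-ρ k = ≡.trans (ρ-anti _ k) (Convolution.ad-cong ring k (λ i j _ → γγ-ρ i j))

  q-fil : ∀ k → Fil 2 (q k)
  q-fil k = ∼⇒fil 2 (Convolution.ad-0 (quotient 2) k (λ i j _ → fil⇒∼ 2 (fil-* 1 1 (γ-fil i) (γ-fil j))))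

  q-cen : ∀ k → Cen (q k)
  q-cen k = cen-anti _ k (λ i j → cen-* (γ-cen i) (γ-cen j))

  u-fil : ∀ m → FilM 1 (u m)
  u-fil zero i j = fil-zero 1
  u-fil (suc m) = filM-⊕ 1 (filM-⊗ˡ 1 C (u-fil m)) (filM-ι 1 (γ-fil (suc m)))

  u-comm : ∀ m → u m ⊗ C ≋ C ⊗ u m
  u-comm zero = transᴹ (⊗-zeroˡ C) (symᴹ (⊗-zeroʳ C))
  u-comm (suc m) = begin
    (C ⊗ u m ⊕ g) ⊗ C ≈⟨ solveᴹ 3 (λ C u g → (C ⊠ u ⊞ g) ⊠ C ⊜ C ⊠ (u ⊠ C) ⊞ g ⊠ C) ≡.refl C (u m) g ⟩
    C ⊗ (u m ⊗ C) ⊕ g ⊗ C ≈⟨ ⊕-cong (⊗-congˡ (u-comm m)) (ι-comm (γ-cen (suc m)) C) ⟩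
    C ⊗ (C ⊗ u m) ⊕ C ⊗ g ≈⟨ symᴹ (⊗-distribˡ C (C ⊗ u m) g) ⟩
    C ⊗ (C ⊗ u m ⊕ g) ∎
    where g = ι (γ (suc m))

  trpow-u : ∀ m → trpow C b (suc m) ≋ u m ⊕ pow C m ⊗ ι (tr b)
  trpow-u zero = begin
    C ⊗ 0ᴹ ⊕ ι (tr (b ⊗ δ)) ≈⟨ ⊕-congˡ (ι-cong (tr-cong (⊗-identityʳ b))) ⟩
    C ⊗ 0ᴹ ⊕ ι (tr b) ≈⟨ solveᴹ 2 (λ C t → C ⊠ 𝟘 ⊞ t ⊜ 𝟘 ⊞ 𝟙 ⊠ t) ≡.refl C (ι (tr b)) ⟩
    0ᴹ ⊕ δ ⊗ ι (tr b) ∎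
  trpow-u (suc m) = begin
    C ⊗ trpow C b (suc m) ⊕ g ≈⟨ ⊕-congʳ (⊗-congˡ (trpow-u m)) ⟩
    C ⊗ (u m ⊕ pow C m ⊗ t) ⊕ g
      ≈⟨ solveᴹ 5 (λ C u p t g → C ⊠ (u ⊞ p ⊠ t) ⊞ g ⊜ C ⊠ u ⊞ g ⊞ C ⊠ p ⊠ t) ≡.refl C (u m) (pow C m) t g ⟩
    C ⊗ u m ⊕ g ⊕ C ⊗ pow C m ⊗ t ∎
    where
    g = ι (γ (suc m))
    t = ι (tr b)

  -- For m = n the difference from `trpow C b (suc n)` is Cⁿ tr b = 0, and `trpow-vanish` applies
  -- modulo `Fil 2`, where entries of `b` multiply to zero. Beyond n only multiplication by `C`
  -- occurs, since `γ` has become zero.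
  u-deep : ∀ m → n ℕ.≤ m → FilM 2 (u m)
  u-deep m n≤m = go (ℕ.≤⇒≤′ n≤m)
    where
    module Q₂ = OddMatrix (quotient 2) (quotient-divisible 2) n
    base : FilM 2 (u n)
    base i j = ∼⇒fil 2 (Q.trans 2 (≡⇒∼ 2 (≡.sym (u-trpow i j))) (vanish i j))
      where
      u-trpow : trpow C b (suc n) ≋ u n
      u-trpow = transᴹ (trpow-u n) (transᴹ (⊕-congˡ (transᴹ (⊗-congʳ (nilpotent n ℕ.≤-refl)) (⊗-zeroˡ (ι (tr b))))) (⊕-identityʳ (u n)))
      vanish : Q._≋_ 2 (trpow C b (suc n)) 0ᴹ
      vanish = Q₂.Square.trpow-vanish (odd-matrix-∼ 2 X-odd) (λ i j y → ≡⇒∼ 2 (cb i j y))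
        (λ i j k l → fil⇒∼ 2 (fil-* 1 1 (b-fil i j) (b-fil k l)))
    go : ∀ {m} → n ℕ.≤′ m → FilM 2 (u m)
    go ℕ.≤′-refl = base
    go (ℕ.≤′-step {m} l) = filM-⊕ 2 (filM-⊗ˡ 2 C (go l))
      (filM-ι 2 (≡.subst (Fil 2) (≡.sym (γ-vanish (suc m) (ℕ.m≤n⇒m≤1+n (ℕ.≤′⇒≤ l)))) (fil-zero 2)))

  tr-bCu : ∀ m a → tr (b ⊗ pow C a ⊗ u m) ≡ anti _+_ (λ i j → γ i * tr (b ⊗ pow C (a ℕ.+ j))) m
  tr-bCu zero a = ≡.trans (tr-0 (⊗-zeroʳ (b ⊗ pow C a))) (≡.sym (zeroˡ _))
  tr-bCu (suc m) a = E.begin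
    tr (b ⊗ P ⊗ (C ⊗ u m ⊕ ι g))
      E.≡⟨ tr-cong (solveᴹ 5 (λ b P C u g → b ⊠ P ⊠ (C ⊠ u ⊞ g) ⊜ b ⊠ (P ⊠ C) ⊠ u ⊞ (b ⊠ P) ⊠ g) ≡.refl b P C (u m) (ι g)) ⟩
    tr (b ⊗ (P ⊗ C) ⊗ u m ⊕ b ⊗ P ⊗ ι g) E.≡⟨ tr-+ _ _ ⟩
    tr (b ⊗ (P ⊗ C) ⊗ u m) + tr (b ⊗ P ⊗ ι g)
      E.≡⟨ ≡.cong₂ _+_ (tr-cong (⊗-congʳ (⊗-congˡ (pow-sucʳ C a)))) (≡.trans (tr-cong (symᴹ (ι-comm (γ-cen (suc m)) (b ⊗ P)))) (tr-ι g (b ⊗ P))) ⟩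
    tr (b ⊗ pow C (suc a) ⊗ u m) + g * tr (b ⊗ P) E.≡⟨ ≡.cong₂ _+_ (tr-bCu m (suc a)) ≡.refl ⟩
    anti _+_ (λ i j → γ i * tr (b ⊗ pow C (suc a ℕ.+ j))) m + g * tr (b ⊗ P)
      E.≡⟨ ≡.cong₂ _+_ (K.ad-cong m (λ i j _ → ≡.cong (λ k → γ i * tr (b ⊗ pow C k)) (≡.sym (ℕ.+-suc a j)))) (≡.cong (λ k → g * tr (b ⊗ pow C k)) (≡.sym (ℕ.+-identityʳ a))) ⟩
    anti _+_ (λ i j → γ i * tr (b ⊗ pow C (a ℕ.+ suc j))) m + g * tr (b ⊗ pow C (a ℕ.+ 0))
      E.≡⟨ K.ad-last (λ i j → γ i * tr (b ⊗ pow C (a ℕ.+ j))) m ⟨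
    anti _+_ (λ i j → γ i * tr (b ⊗ pow C (a ℕ.+ j))) (suc m) E.∎
    where
    module E = ≡.≡-Reasoning
    module K = Convolution ring
    P = pow C a
    g = γ (suc m)

  -- Contracting `u k` with `b` gives `q k`. The extra `b` raises the order from 2 to 3, and
  -- invariance under `ρ` raises it to 4.
  q-vanish : ∀ k → n ℕ.≤ k → q k ≡ 0#
  q-vanish k n≤k = nil (fil-even (q-ρ k) (≡.subst (Fil 3) (≡.trans (tr-bCu k 0) (Convolution.ad-cong ring k same))
    (fil-tr 3 (filM-⊗ 1 2 (filM-⊗ʳ 1 (pow C 0) b-fil) (u-deep k n≤k)))))
    where
    same : ∀ i j → i ℕ.+ j ≡ k → γ i * tr (b ⊗ pow C j) ≡ γ i * γ j
    same i (suc j) _ = ≡.refl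
    -- Here tr b stands in place of γ 0 = 0, but it is multiplied by γ i with i = k ≥ n, which
    -- vanishes.
    same i zero eq = ≡.trans (≡.cong (_* tr (b ⊗ pow C 0)) γ0) (≡.trans (zeroˡ _) (≡.sym (zeroʳ (γ i))))
      where γ0 = γ-vanish i (≡.subst (n ℕ.≤_) (≡.trans (≡.sym eq) (ℕ.+-identityʳ i)) n≤k)

-- q annihilates the last nonzero power of X²

-- With t = γ * u and s = u * u (convolutions), both t and s in degree 2n-2 are u_{n-1}² modulo Fil 3, while
-- the recursions for t and s give q_{n-1}Cⁿ⁻¹ and n q_{n-1}Cⁿ⁻¹.
module Obstruction (S : SuperRing) (nil : ∀ {x} → SuperRing.Fil S 4 x → x ≡ SuperRing.0# S) (m : ℕ)
             {X b : Filtered.Mat S (2 ℕ.+ m)} (gr : Filtered.Graded S (2 ℕ.+ m) X b) where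
  n n′ : ℕ
  n = 2 ℕ.+ m
  n′ = 1 ℕ.+ m
  open Filtered S n
  open Gamma S nil n gr
  private module KM = Convolution matRing
  open import Relation.Binary.Reasoning.Setoid setoidᴹ

  t s : ℕ → Mat
  t = anti _⊕_ (λ i j → ι (γ i) ⊗ u j)
  s = anti _⊕_ (λ i j → u i ⊗ u j)

  ι-anti : ∀ (h : ℕ → ℕ → Carrier) k → anti _⊕_ (λ i j → ι (h i j)) k ≋ ι (anti _+_ h k)
  ι-anti h zero = reflᴹ {ι (h 0 0)}
  ι-anti h (suc k) = transᴹ (⊕-congˡ (ι-anti _ k)) (symᴹ (ι-+ _ _))

  u0 : u 0 ≋ ι (γ 0)
  u0 = symᴹ (ι-0 ≡.refl)

  t-suc : ∀ k → t (suc k) ≋ C ⊗ t k ⊕ ι (q (suc k))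
  t-suc k = transᴹ (KM.ad-geometric {C} {λ i → ι (γ i)} {u} {λ i → ι (γ i)} (λ i → ι-comm (γ-cen i) C) u0 (λ k → reflᴹ {u (suc k)}) k)
    (⊕-congˡ (transᴹ (KM.ad-cong (suc k) (λ i j _ → symᴹ (ι-* (γ i) (γ j)))) (ι-anti (λ i j → γ i * γ j) (suc k))))

  s-suc : ∀ k → s (suc k) ≋ C ⊗ s k ⊕ t (suc k)
  s-suc k = transᴹ (KM.ad-geometric {C} {λ i → ι (γ i)} {u} {u} u-comm u0 (λ k → reflᴹ {u (suc k)}) k)
    (⊕-congˡ (transᴹ (KM.ad-swap (λ i j → u i ⊗ ι (γ j)) (suc k)) (KM.ad-cong (suc k) (λ i j _ → symᴹ (ι-comm (γ-cen i) (u j))))))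

  t-high : ∀ a → t (a ℕ.+ n′) ≋ pow C a ⊗ t n′
  t-high zero = symᴹ (⊗-identityˡ (t n′))
  t-high (suc a) = begin
    t (suc (a ℕ.+ n′)) ≈⟨ t-suc (a ℕ.+ n′) ⟩
    C ⊗ t (a ℕ.+ n′) ⊕ ι (q (suc (a ℕ.+ n′))) ≈⟨ ⊕-cong (⊗-congˡ (t-high a)) (ι-0 (q-vanish _ (s≤s (ℕ.m≤n+m n′ a)))) ⟩
    C ⊗ (pow C a ⊗ t n′) ⊕ 0ᴹ ≈⟨ transᴹ (⊕-identityʳ _) (symᴹ (⊗-assoc C (pow C a) (t n′))) ⟩
    C ⊗ pow C a ⊗ t n′ ∎

  J : Mat
  J = pow C n′ ⊗ t n′

  _×ᴹ_ : ℕ → Mat → Mat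
  _×ᴹ_ = Sums._×_ matRing

  -- In this range `t` only gets multiplied by `C`, so each step of the recursion for `s` adds one
  -- more copy of the same term.
  s-high : ∀ a → s (a ℕ.+ n′) ≋ pow C a ⊗ s n′ ⊕ a ×ᴹ (pow C a ⊗ t n′)
  s-high zero = solveᴹ 1 (λ x → x ⊜ 𝟙 ⊠ x ⊞ 𝟘) ≡.refl (s n′)
  s-high (suc a) = begin
    s (suc (a ℕ.+ n′)) ≈⟨ s-suc (a ℕ.+ n′) ⟩
    C ⊗ s (a ℕ.+ n′) ⊕ t (suc a ℕ.+ n′) ≈⟨ ⊕-cong (⊗-congˡ (s-high a)) (t-high (suc a)) ⟩
    C ⊗ (pow C a ⊗ s n′ ⊕ a ×ᴹ (pow C a ⊗ t n′)) ⊕ C ⊗ pow C a ⊗ t n′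
      ≈⟨ solveᴹ 5 (λ C P s x t → C ⊠ (P ⊠ s ⊞ x) ⊞ C ⊠ P ⊠ t ⊜ C ⊠ P ⊠ s ⊞ (C ⊠ P ⊠ t ⊞ C ⊠ x)) ≡.refl C (pow C a) (s n′) (a ×ᴹ (pow C a ⊗ t n′)) (t n′) ⟩
    C ⊗ pow C a ⊗ s n′ ⊕ (C ⊗ pow C a ⊗ t n′ ⊕ C ⊗ (a ×ᴹ (pow C a ⊗ t n′)))
      ≈⟨ ⊕-congˡ {C ⊗ pow C a ⊗ s n′} (⊕-congˡ {C ⊗ pow C a ⊗ t n′} (transᴹ (Sums.×-comm-* matRing a C (pow C a ⊗ t n′)) (Sums.×-cong matRing a (symᴹ (⊗-assoc C (pow C a) (t n′)))))) ⟩
    C ⊗ pow C a ⊗ s n′ ⊕ suc a ×ᴹ (C ⊗ pow C a ⊗ t n′) ∎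

  Cⁿ′C : ∀ M → pow C n′ ⊗ (C ⊗ M) ≋ 0ᴹ
  Cⁿ′C M = transᴹ (symᴹ (⊗-assoc (pow C n′) C M)) (transᴹ (⊗-congʳ (transᴹ (pow-sucʳ C n′) (nilpotent n ℕ.≤-refl))) (⊗-zeroˡ M))

  J-q : J ≋ q n′ • pow C n′
  J-q = begin
    pow C n′ ⊗ t n′ ≈⟨ ⊗-congˡ (t-suc m) ⟩
    pow C n′ ⊗ (C ⊗ t m ⊕ ι (q n′)) ≈⟨ ⊗-distribˡ (pow C n′) (C ⊗ t m) (ι (q n′)) ⟩
    pow C n′ ⊗ (C ⊗ t m) ⊕ pow C n′ ⊗ ι (q n′) ≈⟨ ⊕-cong (Cⁿ′C (t m)) (symᴹ (ι-comm (q-cen n′) (pow C n′))) ⟩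
    0ᴹ ⊕ ι (q n′) ⊗ pow C n′ ≈⟨ transᴹ (⊕-identityˡ _) (ι-⊗ (q n′) (pow C n′)) ⟩
    q n′ • pow C n′ ∎

  s-top : s (n′ ℕ.+ n′) ≋ n ×ᴹ J
  s-top = begin
    s (n′ ℕ.+ n′) ≈⟨ s-high n′ ⟩
    pow C n′ ⊗ s n′ ⊕ n′ ×ᴹ J ≈⟨ ⊕-congʳ (transᴹ (⊗-congˡ (s-suc m)) (⊗-distribˡ (pow C n′) (C ⊗ s m) (t n′))) ⟩
    pow C n′ ⊗ (C ⊗ s m) ⊕ J ⊕ n′ ×ᴹ J ≈⟨ ⊕-congʳ (transᴹ (⊕-congʳ (Cⁿ′C (s m))) (⊕-identityˡ J)) ⟩
    J ⊕ n′ ×ᴹ J ∎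

  split : ∀ {i j} → i ℕ.+ j ≡ n′ ℕ.+ n′ → i ≢ n′ → i ℕ.< n′ → n ℕ.≤ j
  split {i} {j} eq i≢ i<n′ = ℕ.≰⇒> (λ j≤n′ → ℕ.<⇒≢ (ℕ.+-mono-<-≤ i<n′ j≤n′) eq)

  -- If i < n - 1 then j ≥ n and `u j` has order 2, so the product has order 3; if i > n - 1 then γ
  -- i is zero.
  t-mid : Q._≋_ 3 (t (n′ ℕ.+ n′)) (ι (γ n′) ⊗ u n′)
  t-mid = Convolution.ad-single (Q.matRing 3) (λ i j → ι (γ i) ⊗ u j) n′ n′ off
    where
    off : ∀ i j → i ℕ.+ j ≡ n′ ℕ.+ n′ → i ≢ n′ → Q._≋_ 3 (ι (γ i) ⊗ u j) 0ᴹ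
    off i j eq i≢ with ℕ.<-cmp i n′
    ... | tri< i<n′ _ _ = λ k l → fil⇒∼ 3 (filM-⊗ 1 2 (filM-ι 1 (γ-fil i)) (u-deep j (split eq i≢ i<n′)) k l)
    ... | tri≈ _ i≡ _ = contradiction i≡ i≢
    ... | tri> _ _ i>n′ = ≋⇒∼ 3 (transᴹ (⊗-congʳ (ι-0 (γ-vanish i i>n′))) (⊗-zeroˡ (u j)))
  s-mid : Q._≋_ 3 (s (n′ ℕ.+ n′)) (u n′ ⊗ u n′)
  s-mid = Convolution.ad-single (Q.matRing 3) (λ i j → u i ⊗ u j) n′ n′ off
    where
    off : ∀ i j → i ℕ.+ j ≡ n′ ℕ.+ n′ → i ≢ n′ → Q._≋_ 3 (u i ⊗ u j) 0ᴹ
    off i j eq i≢ with ℕ.<-cmp i n′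
    ... | tri< i<n′ _ _ = λ k l → fil⇒∼ 3 (filM-⊗ 1 2 (u-fil i) (u-deep j (split eq i≢ i<n′)) k l)
    ... | tri≈ _ i≡ _ = contradiction i≡ i≢
    ... | tri> _ _ i>n′ = λ k l → fil⇒∼ 3 (filM-⊗ 2 1 (u-deep i i>n′) (u-fil j) k l)

  -- Unrolling the first factor as C u + γ, its `C` can be moved to the second factor. There it
  -- produces `u n`, which has order 2, so that this part has order 3.
  u-square : Q._≋_ 3 (u n′ ⊗ u n′) (ι (γ n′) ⊗ u n′)
  u-square = Q.transᴹ 3 (≋⇒∼ 3 expand) (Q.transᴹ 3 (Q.⊕-congʳ 3 (λ k l → fil⇒∼ 3 (deep k l))) (Q.MR.+-identityˡ 3 (ι (γ n′) ⊗ u n′)))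
    where
    expand : u n′ ⊗ u n′ ≋ u m ⊗ (C ⊗ u n′) ⊕ ι (γ n′) ⊗ u n′
    expand = transᴹ (⊗-distribʳ (u n′) (C ⊗ u m) (ι (γ n′))) (⊕-congʳ (transᴹ (⊗-congʳ (symᴹ (u-comm m))) (⊗-assoc (u m) C (u n′))))
    Cu : u n ≋ C ⊗ u n′
    Cu = transᴹ (⊕-congˡ (ι-0 (γ-vanish n ℕ.≤-refl))) (⊕-identityʳ _)
    deep : FilM 3 (u m ⊗ (C ⊗ u n′))
    deep = filM-⊗ 1 2 (u-fil m) (filM-resp 2 Cu (u-deep n ℕ.≤-refl))

  -- Modulo order 3, n copies of `J` agree with a single one; the n - 1 = `suc m` copies left over
  -- are divided out.
  J-deep : FilM 3 J
  J-deep i j = ∼⇒fil 3 (Divisible.×-cancel (quotient-divisible 3) m (cancel _ _ chain))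
    where
    cancel : ∀ x y → Fil 3 ((x + y) - x) → Fil 3 (y - 0#)
    cancel x y = ≡.subst (Fil 3) (NonCommSolver.solve ring 2 (λ x y → x ⊞ y ⊖ x ⊜ y ⊖ 𝟘) ≡.refl x y)
    ×-entry : ∀ k M → (k ×ᴹ M) i j ≡ k × M i j
    ×-entry zero M = ≡.refl
    ×-entry (suc k) M = ≡.cong₂ _+_ ≡.refl (×-entry k M)
    chain : Fil 3 ((J i j + n′ × J i j) - J i j)
    chain = Q.trans 3 (≡⇒∼ 3 (≡.trans (≡.sym (×-entry n J)) (≡.sym (s-top i j)))) (Q.trans 3 (s-mid i j) (Q.trans 3 (u-square i j)
      (Q.trans 3 (Q.sym 3 (t-mid i j)) (≡⇒∼ 3 (t-high n′ i j)))))

  qC-vanish : ∀ i j → q n′ * pow C n′ i j ≡ 0#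
  qC-vanish i j = nil (fil-even (≡.trans (ρ-* _ _) (≡.cong₂ _*_ (q-ρ n′) (ρ-powC n′ i j))) (filM-resp 3 J-q J-deep i j))

-- Adjoining one generator of square zero

-- The ring of elements x + z y, where the new generator z has square zero, is odd or even, and is
-- (if shift holds) of filtration degree one and negated by ρ.
module Extension (S : SuperRing) (odd shift : Bool) where
  open SuperRing S
  open NonCommSolver ring using (solve)
  open ≡ using (cong; cong₂; sym; trans; refl)

  sg : Bool → Carrier → Carrier
  sg true x = - x
  sg false x = x

  -- The effect of moving the new generator z to the left of a coefficient: x z = z (tw x). The sign
  -- that an automorphism gives to z itself is `sg`.
  tw : Bool → Carrier → Carrier
  tw true = σ
  tw false x = x

  sg-+ : ∀ s x y → sg s (x + y) ≡ sg s x + sg s y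
  sg-+ true x y = sym (-‿+-comm x y)
  sg-+ false x y = refl

  sg-*ˡ : ∀ s x y → sg s (x * y) ≡ sg s x * y
  sg-*ˡ true x y = -‿distribˡ-* x y
  sg-*ˡ false x y = refl

  sg-*ʳ : ∀ s x y → sg s (x * y) ≡ x * sg s y
  sg-*ʳ true x y = -‿distribʳ-* x y
  sg-*ʳ false x y = refl

  tw-+ : ∀ t x y → tw t (x + y) ≡ tw t x + tw t y
  tw-+ true = σ-+
  tw-+ false x y = refl

  tw-* : ∀ t x y → tw t (x * y) ≡ tw t x * tw t y
  tw-* true = σ-*
  tw-* false x y = refl

  tw-1 : ∀ t → tw t 1# ≡ 1#
  tw-1 true = σ-1
  tw-1 false = refl

  tw-σ : ∀ t x → tw t (σ x) ≡ σ (tw t x)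
  tw-σ true x = refl
  tw-σ false x = refl

  tw-ρ : ∀ t x → tw t (ρ x) ≡ ρ (tw t x)
  tw-ρ true x = σ-ρ x
  tw-ρ false x = refl

  σ-inv : ∀ k → σ (inv k) ≡ inv k
  σ-inv k = trans (sym (inv-law k (σ (inv k)))) (trans (cong (inv k *_) (trans (sym (σ-× (suc k) (inv k))) (cong σ one))) (trans (cong (inv k *_) σ-1) (*-identityʳ _)))
    where
    σ-× : ∀ k x → σ (k × x) ≡ k × σ x
    σ-× zero x = σ-0
    σ-× (suc k) x = trans (σ-+ _ _) (cong₂ _+_ refl (σ-× k x))
    one : suc k × inv k ≡ 1#
    one = trans (sym (Sums.×-cong ring (suc k) (*-identityʳ (inv k)))) (trans (sym (Sums.×-comm-* ring (suc k) (inv k) 1#)) (inv-law k 1#))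

  tw-inv : ∀ t k → tw t (inv k) ≡ inv k
  tw-inv true = σ-inv
  tw-inv false k = refl

  Pair : Set
  Pair = Carrier ⨯ Carrier

  infixl 6 _+′_
  infixl 7 _*′_
  _+′_ _*′_ : Pair → Pair → Pair
  (x , y) +′ (x′ , y′) = x + x′ , y + y′
  (x , y) *′ (x′ , y′) = x * x′ , tw odd x * y′ + y * x′

  -′_ σ′ ρ′ : Pair → Pair
  -′ (x , y) = - x , - y
  σ′ (x , y) = σ x , sg odd (σ y)
  ρ′ (x , y) = ρ x , sg shift (ρ y)

  0′ 1′ : Pair
  0′ = 0# , 0#
  1′ = 1# , 0#

  -- If z has order one, its coefficient needs one order less. Truncation at 0 is harmless because
  -- order 0 is no condition.
  down : Bool → ℕ → ℕ
  down true j = ℕ.pred j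
  down false j = j

  Fil′ : ℕ → Pair → Set
  Fil′ j (x , y) = Fil j x ⨯ Fil (down shift j) y

  *′-assoc : ∀ p q r → (p *′ q) *′ r ≡ p *′ (q *′ r)
  *′-assoc (x , y) (x′ , y′) (x″ , y″) = cong₂ _,_ (*-assoc x x′ x″) (trans
    (cong (λ w → w * y″ + (tw odd x * y′ + y * x′) * x″) (tw-* odd x x′))
    (solve 7 (λ a b y y′ y″ x′ x″ → a ⊠ b ⊠ y″ ⊞ (a ⊠ y′ ⊞ y ⊠ x′) ⊠ x″ ⊜ a ⊠ (b ⊠ y″ ⊞ y′ ⊠ x″) ⊞ y ⊠ (x′ ⊠ x″)) ≡.refl
      (tw odd x) (tw odd x′) y y′ y″ x′ x″))

  isRing′ : IsRing _≡_ _+′_ _*′_ -′_ 0′ 1′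
  isRing′ = record
    { +-isAbelianGroup = record
      { isGroup = record
        { isMonoid = record
          { isSemigroup = record
            { isMagma = record { isEquivalence = ≡.isEquivalence ; ∙-cong = cong₂ _+′_ }
            ; assoc = λ _ _ _ → cong₂ _,_ (+-assoc _ _ _) (+-assoc _ _ _) }
          ; identity = (λ _ → cong₂ _,_ (+-identityˡ _) (+-identityˡ _)) , (λ _ → cong₂ _,_ (+-identityʳ _) (+-identityʳ _)) }
        ; inverse = (λ _ → cong₂ _,_ (-‿inverseˡ _) (-‿inverseˡ _)) , (λ _ → cong₂ _,_ (-‿inverseʳ _) (-‿inverseʳ _))
        ; ⁻¹-cong = cong -′_ }
      ; comm = λ _ _ → cong₂ _,_ (+-comm _ _) (+-comm _ _) }
    ; *-cong = cong₂ _*′_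
    ; *-assoc = *′-assoc
    ; *-identity =
        (λ (x , y) → cong₂ _,_ (*-identityˡ x) (trans (cong (λ w → w * y + 0# * x) (tw-1 odd)) (solve 2 (λ x y → 𝟙 ⊠ y ⊞ 𝟘 ⊠ x ⊜ y) ≡.refl x y)))
      , (λ (x , y) → cong₂ _,_ (*-identityʳ x) (solve 2 (λ x y → x ⊠ 𝟘 ⊞ y ⊠ 𝟙 ⊜ y) ≡.refl (tw odd x) y))
    ; distrib =
        (λ (x , y) (x′ , y′) (x″ , y″) → cong₂ _,_ (distribˡ x x′ x″)
          (solve 6 (λ a y x′ y′ x″ y″ → a ⊠ (y′ ⊞ y″) ⊞ y ⊠ (x′ ⊞ x″) ⊜ a ⊠ y′ ⊞ y ⊠ x′ ⊞ (a ⊠ y″ ⊞ y ⊠ x″)) ≡.refl (tw odd x) y x′ y′ x″ y″))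
      , (λ (x , y) (x′ , y′) (x″ , y″) → cong₂ _,_ (distribʳ x x′ x″) (trans (cong (λ w → w * y + (y′ + y″) * x) (tw-+ odd x′ x″))
          (solve 6 (λ x y a y′ c y″ → (a ⊞ c) ⊠ y ⊞ (y′ ⊞ y″) ⊠ x ⊜ a ⊠ y ⊞ y′ ⊠ x ⊞ (c ⊠ y ⊞ y″ ⊠ x)) ≡.refl x y (tw odd x′) y′ (tw odd x″) y″)))
    }

  private
    hom-* : ∀ (φ : Carrier → Carrier) s → (∀ x y → φ (x + y) ≡ φ x + φ y) → (∀ x y → φ (x * y) ≡ φ x * φ y) →
      (∀ x → tw odd (φ x) ≡ φ (tw odd x)) → ∀ x y x′ y′ →
      sg s (φ (tw odd x * y′ + y * x′)) ≡ tw odd (φ x) * sg s (φ y′) + sg s (φ y) * φ x′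
    hom-* φ s φ+ φ* tφ x y x′ y′ = trans (cong (sg s) (trans (φ+ _ _) (cong₂ _+_ (trans (φ* _ _) (cong (_* φ y′) (sym (tφ x)))) (φ* y x′))))
      (trans (sg-+ s _ _) (cong₂ _+_ (sg-*ʳ s _ _) (sg-*ˡ s _ _)))

    sg-φ : ∀ (φ : Carrier → Carrier) s → (∀ x → φ (- x) ≡ - φ x) → ∀ x → φ (sg s x) ≡ sg s (φ x)
    sg-φ φ true h x = h x
    sg-φ φ false h x = refl

    sg-sg : ∀ s x → sg s (sg s x) ≡ x
    sg-sg true x = -‿involutive x
    sg-sg false x = refl

    sg-0 : ∀ s → sg s 0# ≡ 0#
    sg-0 true = -0#≈0#
    sg-0 false = refl

    sg-swap : ∀ s s′ x → sg s (sg s′ x) ≡ sg s′ (sg s x)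
    sg-swap true true x = refl
    sg-swap true false x = refl
    sg-swap false s′ x = refl

  even-comm′ : ∀ {p} q → σ′ p ≡ p → p *′ q ≡ q *′ p
  even-comm′ {x , y} (x′ , y′) e = cong₂ _,_ (even-comm x′ ex) (second odd (cong proj₂ e))
    where
    ex = cong proj₁ e
    second : ∀ o → sg o (σ y) ≡ y → tw o x * y′ + y * x′ ≡ tw o x′ * y + y′ * x
    second true ey = trans (cong₂ _+_ (trans (cong (_* y′) ex) (even-comm y′ ex))
      (odd-comm x′ (trans (sym (-‿involutive (σ y))) (cong -_ ey)))) (+-comm _ _)
    second false ey = trans (cong₂ _+_ (even-comm y′ ex) (even-comm x′ ey)) (+-comm _ _)

  odd-comm′ : ∀ {p} q → σ′ p ≡ -′ p → p *′ q ≡ σ′ q *′ p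
  odd-comm′ {x , y} (x′ , y′) e = cong₂ _,_ (odd-comm x′ ex) (second odd (cong proj₂ e))
    where
    ex = cong proj₁ e
    second : ∀ o → sg o (σ y) ≡ - y → tw o x * y′ + y * x′ ≡ tw o (σ x′) * y + sg o (σ y′) * x
    second true ey = trans (cong₂ _+_
      (trans (cong (_* y′) ex) (trans (sym (-‿distribˡ-* x y′)) (trans (cong -_ (odd-comm y′ ex)) (-‿distribˡ-* (σ y′) x))))
      (trans (even-comm x′ (trans (sym (-‿involutive (σ y))) (trans (cong -_ ey) (-‿involutive y)))) (cong (_* y) (sym (σ-σ x′)))))
      (+-comm _ _)
    second false ey = trans (cong₂ _+_ (odd-comm y′ ex) (odd-comm x′ ey)) (+-comm _ _)

  private
    module R′ = Raw _+′_ _*′_ -′_ 0′ 1′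

    ×-pair : ∀ k x y → (k R′.× (x , y)) ≡ (k × x , k × y)
    ×-pair zero x y = refl
    ×-pair (suc k) x y = cong ((x , y) +′_) (×-pair k x y)

    fil-tw : ∀ t j {x} → Fil j x → Fil j (tw t x)
    fil-tw true j = fil-σ j
    fil-tw false j h = h

    fil-sg : ∀ s j {x} → Fil j x → Fil j (sg s x)
    fil-sg true j = fil-neg j
    fil-sg false j h = h

    down-+ʳ : ∀ s i j → down s (i ℕ.+ j) ℕ.≤ i ℕ.+ down s j
    down-+ʳ true i zero = ℕ.pred[n]≤n
    down-+ʳ true i (suc j) = ℕ.≤-reflexive (cong ℕ.pred (ℕ.+-suc i j))
    down-+ʳ false i j = ℕ.≤-refl

    down-+ˡ : ∀ s i j → down s (i ℕ.+ j) ℕ.≤ down s i ℕ.+ j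
    down-+ˡ true zero j = ℕ.pred[n]≤n
    down-+ˡ true (suc i) j = ℕ.≤-refl
    down-+ˡ false i j = ℕ.≤-refl

    down-pred : ∀ s j → down s j ℕ.≤ down s (suc j)
    down-pred true j = ℕ.pred[n]≤n
    down-pred false j = ℕ.n≤1+n j

    iter-pair : ∀ j x y → iter -′_ j (x , y) ≡ (iter -_ j x , iter -_ j y)
    iter-pair zero x y = refl
    iter-pair (suc j) x y = cong -′_ (iter-pair j x y)

    iter-neg : ∀ j x → iter -_ j (- x) ≡ - iter -_ j x
    iter-neg zero x = refl
    iter-neg (suc j) x = cong -_ (iter-neg j x)

    parity : ∀ s j {y} → Fil (down s j) y → Fil (down s (suc j)) (y + - iter -_ j (sg s (ρ y)))
    parity false j h = fil-parity j h
    parity true zero h = fil-all _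
    parity true (suc j) {y} h = ≡.subst (λ w → Fil (suc j) (y + - w))
      (sym (trans (cong -_ (iter-neg j (ρ y))) (-‿involutive _))) (fil-parity j h)

  private
    down-0 : ∀ s → down s 0 ≡ 0
    down-0 true = refl
    down-0 false = refl

  extension : SuperRing
  extension .SuperRing.Carrier = Pair
  extension .SuperRing._+_ = _+′_
  extension .SuperRing._*_ = _*′_
  extension .SuperRing.-_ = -′_
  extension .SuperRing.0# = 0′
  extension .SuperRing.1# = 1′
  extension .SuperRing.isRing = isRing′
  extension .SuperRing.σ = σ′
  extension .SuperRing.ρ = ρ′
  extension .SuperRing.σ-+ = λ (x , y) (x′ , y′) → cong₂ _,_ (σ-+ x x′) (trans (cong (sg odd) (σ-+ y y′)) (sg-+ odd _ _))
  extension .SuperRing.σ-* = λ (x , y) (x′ , y′) → cong₂ _,_ (σ-* x x′) (hom-* σ odd σ-+ σ-* (tw-σ odd) x y x′ y′)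
  extension .SuperRing.σ-1 = cong₂ _,_ σ-1 (trans (cong (sg odd) σ-0) (sg-0 odd))
  extension .SuperRing.σ-σ = λ (x , y) → cong₂ _,_ (σ-σ x) (trans (cong (sg odd) (sg-φ σ odd σ-neg (σ y))) (trans (sg-sg odd _) (σ-σ y)))
  extension .SuperRing.ρ-+ = λ (x , y) (x′ , y′) → cong₂ _,_ (ρ-+ x x′) (trans (cong (sg shift) (ρ-+ y y′)) (sg-+ shift _ _))
  extension .SuperRing.ρ-* = λ (x , y) (x′ , y′) → cong₂ _,_ (ρ-* x x′) (hom-* ρ shift ρ-+ ρ-* (tw-ρ odd) x y x′ y′)
  extension .SuperRing.ρ-1 = cong₂ _,_ ρ-1 (trans (cong (sg shift) ρ-0) (sg-0 shift))
  extension .SuperRing.ρ-ρ = λ (x , y) → cong₂ _,_ (ρ-ρ x) (trans (cong (sg shift) (sg-φ ρ shift ρ-neg (ρ y))) (trans (sg-sg shift _) (ρ-ρ y)))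
  extension .SuperRing.σ-ρ = λ (x , y) → cong₂ _,_ (σ-ρ x) (trans (cong (sg odd) (trans (sg-φ σ shift σ-neg (ρ y)) (cong (sg shift) (σ-ρ y))))
        (trans (sg-swap odd shift _) (cong (sg shift) (sym (sg-φ ρ odd ρ-neg (σ y))))))
  extension .SuperRing.even-comm = even-comm′
  extension .SuperRing.odd-comm = odd-comm′
  extension .SuperRing.inv = λ k → inv k , 0#
  extension .SuperRing.inv-cen = λ k (x , y) → cong₂ _,_ (inv-cen k x) (trans (cong (λ w → w * y + 0# * x) (tw-inv odd k))
        (trans (cong (_+ 0# * x) (inv-cen k y)) (solve 4 (λ i a x y → y ⊠ i ⊞ 𝟘 ⊠ x ⊜ a ⊠ 𝟘 ⊞ y ⊠ i) ≡.refl (inv k) (tw odd x) x y)))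
  extension .SuperRing.inv-law = λ k (x , y) → trans (cong ((inv k , 0#) *′_) (×-pair (suc k) x y))
        (cong₂ _,_ (inv-law k x) (trans (cong (λ w → w * (suc k × y) + 0# * (suc k × x)) (tw-inv odd k))
          (trans (cong₂ _+_ (inv-law k y) (zeroˡ _)) (+-identityʳ y))))
  extension .SuperRing.Fil = Fil′
  extension .SuperRing.fil-all = λ (x , y) → fil-all x , ≡.subst (λ j → Fil j y) (sym (down-0 shift)) (fil-all y)
  extension .SuperRing.fil-zero = λ j → fil-zero j , fil-zero _
  extension .SuperRing.fil-+ = λ j (h , k) (h′ , k′) → fil-+ j h h′ , fil-+ _ k k′
  extension .SuperRing.fil-neg = λ j (h , k) → fil-neg j h , fil-neg _ k
  extension .SuperRing.fil-* = λ i j (h , k) (h′ , k′) → fil-* i j h h′ , fil-+ _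
        (fil-≤ (down-+ʳ shift i j) (fil-* i _ (fil-tw odd i h) k′)) (fil-≤ (down-+ˡ shift i j) (fil-* _ j k h′))
  extension .SuperRing.fil-pred = λ j (h , k) → fil-pred j h , fil-≤ (down-pred shift j) k
  extension .SuperRing.fil-σ = λ j (h , k) → fil-σ j h , fil-sg odd _ (fil-σ _ k)
  extension .SuperRing.fil-ρ = λ j (h , k) → fil-ρ j h , fil-sg shift _ (fil-ρ _ k)
  extension .SuperRing.fil-parity = λ j {(x , y)} (h , k) → ≡.subst (λ p → Fil′ (suc j) ((x , y) +′ -′ p)) (sym (iter-pair j _ _))
        (fil-parity j h , parity shift j k)

-- Differentiation along X ↦ cX

module Variation (S : SuperRing) (nil : ∀ {x} → SuperRing.Fil S 4 x → x ≡ SuperRing.0# S) (m : ℕ)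
             {X b : Filtered.Mat S (2 ℕ.+ m)} (gr : Filtered.Graded S (2 ℕ.+ m) X b)
             (c : Filtered.Mat S (2 ℕ.+ m)) (c-even : ∀ i j → SuperRing.σ S (c i j) ≡ c i j)
             (c-ρ : ∀ i j → SuperRing.ρ S (c i j) ≡ c i j) where
  private
    n n′ : ℕ
    n = 2 ℕ.+ m
    n′ = 1 ℕ.+ m
  open Filtered S n
  open Graded gr
  open Gamma S nil n gr
  open Obstruction S nil m gr using (qC-vanish; split)
  open ≡ using (cong; cong₂; sym; trans; refl)
  open Extension S false false using (extension; _+′_; 0′)
  private
    module F′ = Filtered extension n
    module K = Convolution ring

  -- The dual numbers of S, with η even and of order 0, again form a super ring in which order 4
  -- vanishes. Hence all identities hold for X + η c X, and their η-components are the derivatives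
  -- of the original ones.
  Xη bη : F′.Mat
  Xη i j = X i j , (c ⊗ X) i j
  bη i j = b i j , 0#

  nil′ : ∀ {p} → F′.Fil 4 p → p ≡ 0′
  nil′ (h , h′) = cong₂ _,_ (nil h) (nil h′)

  gr′ : F′.Graded Xη bη
  gr′ = record
    { X-odd = λ i j → cong₂ _,_ (X-odd i j) (trans (σ-∑ _) (trans (Sums.∑-cong ring (λ x →
        trans (σ-* _ _) (trans (cong₂ _*_ (c-even i x) (X-odd x j)) (sym (-‿distribʳ-* _ _))))) (Sums.∑-neg ring _)))
    ; X-ρ = λ i j → cong₂ _,_ (X-ρ i j) (trans (ρ-∑ _) (Sums.∑-cong ring (λ x → trans (ρ-* _ _) (cong₂ _*_ (c-ρ i x) (X-ρ x j)))))
    ; b-even = λ i j → cong₂ _,_ (b-even i j) σ-0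
    ; b-ρ = λ i j → cong₂ _,_ (b-ρ i j) (trans ρ-0 (sym -0#≈0#))
    ; b-fil = λ i j → b-fil i j , fil-zero 1 }

  private
    module G′ = Gamma extension nil′ n gr′
    module O′ = Obstruction extension nil′ m gr′

  fold-pair : ∀ {k} (f g : Fin k → Carrier) → fold _+′_ 0′ (λ i → f i , g i) ≡ (∑ f , ∑ g)
  fold-pair {zero} f g = trans (fold-zero _+′_ 0′ _) (sym (cong₂ _,_ (fold-zero _+_ 0# f) (fold-zero _+_ 0# g)))
  fold-pair {suc k} f g = trans (fold-suc _+′_ 0′ _) (trans (cong (_ +′_) (fold-pair (λ i → f (suc i)) (λ i → g (suc i))))
    (sym (cong₂ _,_ (fold-suc _+_ 0# f) (fold-suc _+_ 0# g))))

  pairᴹ : Mat → Mat → F′.Mat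
  pairᴹ M N i j = M i j , N i j

  ⊗-pair : ∀ M N M₁ N₁ → pairᴹ M N F′.⊗ pairᴹ M₁ N₁ F′.≋ pairᴹ (M ⊗ M₁) (M ⊗ N₁ ⊕ N ⊗ M₁)
  ⊗-pair M N M₁ N₁ i j = trans (fold-pair _ _) (cong₂ _,_ refl (Sums.∑-distrib-+ ring _ _))

  tr-pair : ∀ M N → F′.tr (pairᴹ M N) ≡ (tr M , tr N)
  tr-pair M N = trans (F′.tr-∑ _) (trans (fold-pair _ _) (sym (cong₂ _,_ (tr-∑ M) (tr-∑ N))))

  Ċ : Mat
  Ċ = X ⊗ (c ⊗ X) ⊕ (c ⊗ X) ⊗ X

  cc : CenM c
  cc i j y = even-comm y (c-even i j)

  cĊ : CenM Ċ
  cĊ i j = cen-+ (cen-resp (⊗-assoc X c X i j) (cXMX cc i j)) (cen-resp (sym (⊗-assoc c X X i j)) (cen-⊗ cc cC i j))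

  C-pair : G′.C F′.≋ pairᴹ C Ċ
  C-pair = ⊗-pair X (c ⊗ X) X (c ⊗ X)

  δ-pair : ∀ {k} (i j : Fin k) → F′.δ i j ≡ (δ i j , 0#)
  δ-pair zero zero = refl
  δ-pair zero (suc _) = refl
  δ-pair (suc _) zero = refl
  δ-pair (suc i) (suc j) = δ-pair i j

  pow-pair : ∀ k → F′.pow G′.C k F′.≋ pairᴹ (pow C k) (dpow C Ċ k)
  pow-pair zero = δ-pair
  pow-pair (suc k) = F′.transᴹ (F′.⊗-cong C-pair (pow-pair k)) (⊗-pair C Ċ (pow C k) (dpow C Ċ k))

  γ̇ : ℕ → Carrier
  γ̇ zero = 0#
  γ̇ (suc k) = tr (b ⊗ dpow C Ċ (suc k))

  γ̇-cen : ∀ k → Cen (γ̇ k)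
  γ̇-cen zero = cen-0
  γ̇-cen (suc k) = cen-tr (cen-⊗ cb (cen-dpow cC cĊ (suc k)))

  γ-pair : ∀ k → G′.γ k ≡ (γ k , γ̇ k)
  γ-pair zero = refl
  γ-pair (suc k) = trans (F′.tr-cong (F′.transᴹ (F′.⊗-congˡ {bη} (pow-pair (suc k))) (⊗-pair b 0ᴹ (pow C (suc k)) (dpow C Ċ (suc k)))))
    (trans (tr-pair (b ⊗ pow C (suc k)) (b ⊗ dpow C Ċ (suc k) ⊕ 0ᴹ ⊗ pow C (suc k)))
      (cong₂ _,_ refl (tr-cong (transᴹ (⊕-congˡ (⊗-zeroˡ (pow C (suc k)))) (⊕-identityʳ _)))))

  anti-pair : ∀ (h h′ : ℕ → ℕ → Carrier) k → anti _+′_ (λ i j → h i j , h′ i j) k ≡ (anti _+_ h k , anti _+_ h′ k)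
  anti-pair h h′ zero = refl
  anti-pair h h′ (suc k) = cong (_ +′_) (anti-pair _ _ k)

  -- `q̇` is the derivative of `q` by the product rule. Centrality makes its two halves equal, and
  -- `r` is one of them.
  r q̇ : ℕ → Carrier
  r = anti _+_ (λ i j → γ i * γ̇ j)
  q̇ = anti _+_ (λ i j → γ i * γ̇ j + γ̇ i * γ j)

  q-pair : ∀ k → G′.q k ≡ (q k , q̇ k)
  q-pair k = trans (Convolution.ad-cong F′.ring k (λ i j _ → cong₂ F′._*_ (γ-pair i) (γ-pair j))) (anti-pair _ _ k)

  q̇-r : ∀ k → q̇ k ≡ r k + r k
  q̇-r k = trans (K.ad-+ _ _ k) (cong₂ _+_ refl (trans (K.ad-swap _ k) (K.ad-cong k (λ i j _ → sym (γ-cen i (γ̇ j))))))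

  r-vanish : ∀ k → n ℕ.≤ k → r k ≡ 0#
  r-vanish k n≤k = Divisible.double-cancel divisible (trans (sym (q̇-r k)) (cong proj₂ (trans (sym (q-pair k)) (G′.q-vanish k n≤k))))

  γ̇-vanish : ∀ k → n ℕ.≤ k → γ̇ k ≡ 0#
  γ̇-vanish k n≤k = cong proj₂ (trans (sym (γ-pair k)) (G′.γ-vanish k n≤k))

  W : Carrier
  W = q n′ * γ̇ n′

  -- The derivative of q Cⁿ⁻¹ = 0, multiplied by `b` and traced.
  leibniz : W + γ n′ * q̇ n′ ≡ 0#
  leibniz = begin
    W + γ n′ * q̇ n′ ≡⟨ cong (W +_) (γ-cen n′ (q̇ n′)) ⟩
    q n′ * tr (b ⊗ D) + q̇ n′ * tr (b ⊗ P) ≡⟨ cong₂ _+_ (contract (q n′) D (q-cen n′)) (contract (q̇ n′) P q̇-cen) ⟨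
    tr (b ⊗ (q n′ • D)) + tr (b ⊗ (q̇ n′ • P)) ≡⟨ tr-+ _ _ ⟨
    tr (b ⊗ (q n′ • D) ⊕ b ⊗ (q̇ n′ • P)) ≡⟨ tr-cong (⊗-distribˡ b _ _) ⟨
    tr (b ⊗ (q n′ • D ⊕ q̇ n′ • P)) ≡⟨ tr-0 (transᴹ (⊗-congˡ vanish) (⊗-zeroʳ b)) ⟩
    0# ∎
    where
    open ≡.≡-Reasoning
    D = dpow C Ċ n′
    P = pow C n′
    q̇-cen : Cen (q̇ n′)
    q̇-cen = cen-anti _ n′ (λ i j → cen-+ (cen-* (γ-cen i) (γ̇-cen j)) (cen-* (γ̇-cen i) (γ-cen j)))
    contract : ∀ a M → Cen a → tr (b ⊗ (a • M)) ≡ a * tr (b ⊗ M)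
    contract a M ca = trans (tr-cong (λ i j → trans (Sums.∑-cong ring (λ x → cen-left ca (b i x) (M x j))) (sym (Sums.*-distribˡ-∑ ring a _)))) (tr-• a (b ⊗ M))
    vanish : q n′ • D ⊕ q̇ n′ • P ≋ 0ᴹ
    vanish i j = cong proj₂ (trans (cong₂ F′._*_ (sym (q-pair n′)) (sym (pow-pair n′ i j))) (O′.qC-vanish i j))

  -- Both sides are the triple convolution of γ, γ and γ̇ in degree 2n - 2, bracketed in two ways.
  -- In either bracketing every term but the middle one has a factor of index at least n, which
  -- vanishes.
  W-triple : W ≡ γ n′ * r n′
  W-triple = begin
    q n′ * γ̇ n′ ≡⟨ K.ad-single (λ k l → q k * γ̇ l) n′ n′ off₁ ⟨
    anti _+_ (λ k l → q k * γ̇ l) (n′ ℕ.+ n′) ≡⟨ K.ad-cong (n′ ℕ.+ n′) (λ k l _ → K.ad-*ʳ (γ̇ l) (λ i j → γ i * γ j) k) ⟩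
    anti _+_ (λ k l → anti _+_ (λ i j → γ i * γ j * γ̇ l) k) (n′ ℕ.+ n′) ≡⟨ K.ad-assoc (λ i j l → γ i * γ j * γ̇ l) (n′ ℕ.+ n′) ⟨
    anti _+_ (λ i k → anti _+_ (λ j l → γ i * γ j * γ̇ l) k) (n′ ℕ.+ n′)
      ≡⟨ K.ad-cong (n′ ℕ.+ n′) (λ i k _ → trans (K.ad-cong k (λ j l _ → *-assoc _ _ _)) (sym (K.ad-*ˡ (γ i) (λ j l → γ j * γ̇ l) k))) ⟩
    anti _+_ (λ i k → γ i * r k) (n′ ℕ.+ n′) ≡⟨ K.ad-single (λ i k → γ i * r k) n′ n′ off₂ ⟩
    γ n′ * r n′ ∎
    where
    open ≡.≡-Reasoning
    off₁ : ∀ k l → k ℕ.+ l ≡ n′ ℕ.+ n′ → k ≢ n′ → q k * γ̇ l ≡ 0#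
    off₁ k l eq k≢ with ℕ.<-cmp k n′
    ... | tri< k<n′ _ _ = trans (cong (q k *_) (γ̇-vanish l (split eq k≢ k<n′))) (zeroʳ _)
    ... | tri≈ _ k≡ _ = contradiction k≡ k≢
    ... | tri> _ _ k>n′ = trans (cong (_* γ̇ l) (q-vanish k k>n′)) (zeroˡ _)
    off₂ : ∀ i k → i ℕ.+ k ≡ n′ ℕ.+ n′ → i ≢ n′ → γ i * r k ≡ 0#
    off₂ i k eq i≢ with ℕ.<-cmp i n′
    ... | tri< i<n′ _ _ = trans (cong (γ i *_) (r-vanish k (split eq i≢ i<n′))) (zeroʳ _)
    ... | tri≈ _ i≡ _ = contradiction i≡ i≢
    ... | tri> _ _ i>n′ = trans (cong (_* r k) (γ-vanish i i>n′)) (zeroˡ _)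

  -- The derivative of q is 2r, so `leibniz` says W + 2W = 0.
  W-vanish : W ≡ 0#
  W-vanish = Divisible.×-cancel divisible 2 (begin
    W + (W + (W + 0#)) ≡⟨ NonCommSolver.solve ring 1 (λ w → w ⊞ (w ⊞ (w ⊞ 𝟘)) ⊜ w ⊞ (w ⊞ w)) refl W ⟩
    W + (W + W) ≡⟨ cong (W +_) (cong₂ _+_ W-triple W-triple) ⟩
    W + (γ n′ * r n′ + γ n′ * r n′) ≡⟨ cong (W +_) (distribˡ _ _ _) ⟨
    W + γ n′ * (r n′ + r n′) ≡⟨ cong (λ w → W + γ n′ * w) (q̇-r n′) ⟨
    W + γ n′ * q̇ n′ ≡⟨ leibniz ⟩
    0# ∎)
    where open ≡.≡-Reasoning

  -- Both derivatives are transposed: e = Cb - XbX paired with `c` matches Ċ = XcX + cC paired with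
  -- `b`, the sign in `e` being undone by the rotation of an odd factor.
  tr-dpow-e : ∀ k → tr (dpow C e k ⊗ c) ≡ tr (b ⊗ dpow C Ċ k)
  tr-dpow-e k = begin
    tr (dpow C e k ⊗ c) ≡⟨ tr-dpow cC e c k ⟩
    tr (e ⊗ D) ≡⟨ tr-cong (solveᴹ 4 (λ C b X D → (C ⊠ b ⊖ X ⊠ b ⊠ X) ⊠ D ⊜ C ⊠ b ⊠ D ⊞ ⊟ (X ⊠ b ⊠ X ⊠ D)) refl C b X D) ⟩
    tr (C ⊗ b ⊗ D ⊕ ⊝ (X ⊗ b ⊗ X ⊗ D))
      ≡⟨ trans (tr-+ _ _) (cong₂ _+_ (tr-rotate cC b D) (trans (tr-neg _) (cong -_ (tr-XMXN cb cD)))) ⟩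
    tr (b ⊗ D ⊗ C) + - - tr (b ⊗ (X ⊗ D ⊗ X)) ≡⟨ cong₂ _+_ (tr-cong (⊗-assoc b D C)) (-‿involutive _) ⟩
    tr (b ⊗ (D ⊗ C)) + tr (b ⊗ (X ⊗ D ⊗ X)) ≡⟨ trans (tr-cong (⊗-distribˡ b (D ⊗ C) (X ⊗ D ⊗ X))) (tr-+ _ _) ⟨
    tr (b ⊗ (D ⊗ C ⊕ X ⊗ D ⊗ X)) ≡⟨ tr-cong (⊗-congˡ collect) ⟩
    tr (b ⊗ dpow C Ċ k) ∎
    where
    open ≡.≡-Reasoning
    D = dpow C c k
    cD : CenM D
    cD = cen-dpow cC cc k
    collect : D ⊗ C ⊕ X ⊗ D ⊗ X ≋ dpow C Ċ k
    collect = transᴹ (⊕-cong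
        (transᴹ (⊗-congʳ (symᴹ (⊗-identityˡ D))) (dpow-conj {C} {δ} {C} (transᴹ (⊗-identityˡ C) (symᴹ (⊗-identityʳ C))) (reflᴹ {C ⊗ C}) c k))
        (dpow-conj XC XC c k))
      (transᴹ (symᴹ (dpow-⊕ C (δ ⊗ c ⊗ C) (X ⊗ c ⊗ X) k))
        (dpow-cong C (solveᴹ 2 (λ c X → 𝟙 ⊠ c ⊠ (X ⊠ X) ⊞ X ⊠ c ⊠ X ⊜ X ⊠ (c ⊠ X) ⊞ (c ⊠ X) ⊠ X) refl c X) k))

  q-dpow-vanish : q n′ * tr (dpow C e n′ ⊗ c) ≡ 0#
  q-dpow-vanish = trans (cong (q n′ *_) (tr-dpow-e n′)) W-vanish

-- The characteristic polynomial of U = X g′ X g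

module Twisted (S : SuperRing) (nil : ∀ {x} → SuperRing.Fil S 4 x → x ≡ SuperRing.0# S) (n : ℕ)
             {X b : Filtered.Mat S n} (gr : Filtered.Graded S n X b) where
  open Filtered S n
  open Graded gr
  open Gamma S nil n gr public
  open ≡ using (cong; cong₂; sym; trans; refl)

  bb bbb g g′ : Mat
  bb = b ⊗ b
  bbb = b ⊗ bb
  g = geometric b
  g′ = δ ⊖ᴹ b ⊕ bb ⊖ᴹ bbb

  b⁴ : b ⊗ bbb ≋ 0ᴹ
  b⁴ i j = nil (filM-⊗ 1 3 b-fil (filM-⊗ 1 2 b-fil (filM-⊗ 1 1 b-fil b-fil)) i j)

  g-rec : g ≋ δ ⊕ b ⊗ g
  g-rec = transᴹ (symᴹ (⊕-identityʳ g)) (transᴹ (⊕-congˡ (symᴹ b⁴))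
    (solveᴹ 1 (λ b → 𝟙 ⊞ b ⊞ b ⊠ b ⊞ b ⊠ (b ⊠ b) ⊞ b ⊠ (b ⊠ (b ⊠ b)) ⊜
      𝟙 ⊞ b ⊠ (𝟙 ⊞ b ⊞ b ⊠ b ⊞ b ⊠ (b ⊠ b))) refl b))

  g′-inverse : g′ ⊗ (δ ⊕ b) ≋ δ
  g′-inverse = transᴹ (solveᴹ 1 (λ b → (𝟙 ⊖ b ⊞ b ⊠ b ⊖ b ⊠ (b ⊠ b)) ⊠ (𝟙 ⊞ b) ⊜ 𝟙 ⊖ b ⊠ (b ⊠ (b ⊠ b))) refl b)
    (transᴹ (⊕-congˡ (⊝-cong b⁴)) (solveᴹ 0 (𝟙 ⊖ 𝟘 ⊜ 𝟙) refl))

  σᴹ : Mat → Mat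
  σᴹ M i j = σ (M i j)

  σ-⊗ : ∀ M N → σᴹ (M ⊗ N) ≋ σᴹ M ⊗ σᴹ N
  σ-⊗ M N i j = trans (σ-∑ _) (Sums.∑-cong ring (λ x → σ-* _ _))

  σ-δ : ∀ {m} (i j : Fin m) → σ (δ i j) ≡ δ i j
  σ-δ zero zero = σ-1
  σ-δ zero (suc _) = σ-0
  σ-δ (suc _) zero = σ-0
  σ-δ (suc i) (suc j) = σ-δ i j

  EvenM OddM : Mat → Set
  EvenM M = ∀ i j → σ (M i j) ≡ M i j
  OddM M = ∀ i j → σ (M i j) ≡ - M i j

  even-⊕ : ∀ {M N} → EvenM M → EvenM N → EvenM (M ⊕ N)
  even-⊕ h h′ i j = trans (σ-+ _ _) (cong₂ _+_ (h i j) (h′ i j))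

  even-⊝ : ∀ {M} → EvenM M → EvenM (⊝ M)
  even-⊝ h i j = trans (σ-neg _) (cong -_ (h i j))

  even-⊗ : ∀ {M N} → EvenM M → EvenM N → EvenM (M ⊗ N)
  even-⊗ {M} {N} h h′ = transᴹ (σ-⊗ M N) (⊗-cong h h′)

  odd-even : ∀ {M N} → OddM M → EvenM N → OddM (M ⊗ N)
  odd-even {M} {N} h h′ = transᴹ (σ-⊗ M N) (transᴹ (⊗-cong h h′) (solveᴹ 2 (λ M N → ⊟ M ⊠ N ⊜ ⊟ (M ⊠ N)) refl M N))

  odd-odd : ∀ {M N} → OddM M → OddM N → EvenM (M ⊗ N)
  odd-odd {M} {N} h h′ = transᴹ (σ-⊗ M N) (transᴹ (⊗-cong h h′) (solveᴹ 2 (λ M N → ⊟ M ⊠ ⊟ N ⊜ M ⊠ N) refl M N))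

  even-pow : ∀ {M} → EvenM M → ∀ k → EvenM (pow M k)
  even-pow h zero = σ-δ
  even-pow h (suc k) = even-⊗ h (even-pow h k)

  even-cen : ∀ {M} → EvenM M → CenM M
  even-cen h i j y = even-comm y (h i j)

  bb-even : EvenM bb
  bb-even = even-⊗ b-even b-even

  g-even : EvenM g
  g-even = even-⊕ (even-⊕ (even-⊕ σ-δ b-even) bb-even) (even-⊗ b-even bb-even)

  g′-even : EvenM g′
  g′-even = even-⊕ (even-⊕ (even-⊕ σ-δ (even-⊝ b-even)) bb-even) (even-⊝ (even-⊗ b-even bb-even))

  ρ-bb : ρᴹ bb ≋ bb
  ρ-bb = transᴹ (ρ-⊗ b b) (transᴹ (⊗-cong b-ρ b-ρ) (solveᴹ 1 (λ b → ⊟ b ⊠ ⊟ b ⊜ b ⊠ b) refl b))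

  ρ-bbb : ρᴹ bbb ≋ ⊝ bbb
  ρ-bbb = transᴹ (ρ-⊗ b bb) (transᴹ (⊗-cong b-ρ ρ-bb) (solveᴹ 2 (λ b c → ⊟ b ⊠ c ⊜ ⊟ (b ⊠ c)) refl b bb))

  ρ-g : ρᴹ g ≋ g′
  ρ-g i j = trans (ρ-+ _ _) (cong₂ _+_ (trans (ρ-+ _ _) (cong₂ _+_ (trans (ρ-+ _ _) (cong₂ _+_ (ρ-δ i j) (b-ρ i j))) (ρ-bb i j))) (ρ-bbb i j))

  ρ-g′ : ρᴹ g′ ≋ g
  ρ-g′ i j = trans (cong ρ (sym (ρ-g i j))) (ρ-ρ (g i j))

  -- `ρ` exchanges `A` and `B`, hence `U` and `U′`; at the same time AU′ = UA. This double relation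
  -- is what makes the parity of traces and coefficients accessible.
  A B U U′ : Mat
  A = X ⊗ g′
  B = X ⊗ g
  U = A ⊗ B
  U′ = B ⊗ A

  A-odd : OddM A
  A-odd = odd-even X-odd g′-even

  B-odd : OddM B
  B-odd = odd-even X-odd g-even

  ρ-A : ρᴹ A ≋ B
  ρ-A = transᴹ (ρ-⊗ X g′) (⊗-cong X-ρ ρ-g′)

  ρ-B : ρᴹ B ≋ A
  ρ-B = transᴹ (ρ-⊗ X g) (⊗-cong X-ρ ρ-g)

  ρ-U : ρᴹ U ≋ U′
  ρ-U = transᴹ (ρ-⊗ A B) (⊗-cong ρ-A ρ-B)

  U-even : EvenM U
  U-even = odd-odd A-odd B-odd

  U′-even : EvenM U′
  U′-even = odd-odd B-odd A-odd

  cU : CenM U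
  cU = even-cen U-even

  cU′ : CenM U′
  cU′ = even-cen U′-even

  slide : ∀ k → A ⊗ pow U′ k ≋ pow U k ⊗ A
  slide zero = transᴹ (⊗-identityʳ A) (symᴹ (⊗-identityˡ A))
  slide (suc k) = begin
    A ⊗ (B ⊗ A ⊗ pow U′ k) ≈⟨ solveᴹ 3 (λ A B P → A ⊠ (B ⊠ A ⊠ P) ⊜ A ⊠ B ⊠ (A ⊠ P)) refl A B (pow U′ k) ⟩
    U ⊗ (A ⊗ pow U′ k) ≈⟨ ⊗-congˡ (slide k) ⟩
    U ⊗ (pow U k ⊗ A) ≈⟨ symᴹ (⊗-assoc U (pow U k) A) ⟩
    U ⊗ pow U k ⊗ A ∎
    where open import Relation.Binary.Reasoning.Setoid setoidᴹ

  p : ℕ → Carrier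
  p k = tr (pow U k)

  -- `ρ` turns AB into BA; rotating the odd factor `B` around the trace restores AB at the price of
  -- a sign.
  p-ρ : ∀ k → ρ (p (suc k)) ≡ - p (suc k)
  p-ρ k = begin
    ρ (tr (pow U (suc k))) ≡⟨ trans (ρ-tr _) (tr-cong (transᴹ (ρ-pow U (suc k)) (pow-cong ρ-U (suc k)))) ⟩
    tr (B ⊗ A ⊗ pow U′ k) ≡⟨ tr-cong (transᴹ (⊗-assoc B A (pow U′ k)) (⊗-congˡ (slide k))) ⟩
    tr (B ⊗ (pow U k ⊗ A)) ≡⟨ tr-anticomm (λ i j k′ l → odd-anti (B-odd i j) (oP k′ l)) ⟩
    - tr (pow U k ⊗ A ⊗ B) ≡⟨ cong -_ (tr-cong (transᴹ (⊗-assoc (pow U k) A B) (pow-sucʳ U k))) ⟩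
    - tr (pow U (suc k)) ∎
    where
    open ≡.≡-Reasoning
    oP : OddM (pow U k ⊗ A)
    oP i j = trans (cong σ (sym (slide k i j))) (trans (odd-even A-odd (even-pow U′-even k) i j) (cong -_ (slide k i j)))

  e-fil : FilM 1 e
  e-fil = filM-⊕ 1 (filM-⊗ˡ 1 C b-fil) (λ i j → fil-neg 1 (filM-⊗ʳ 1 X (filM-⊗ˡ 1 X b-fil) i j))

  ce : CenM e
  ce i j = cen-+ (cen-⊗ cC cb i j) (cen-neg (cXMX cb i j))

  bb-fil : FilM 2 bb
  bb-fil = filM-⊗ 1 1 b-fil b-fil

  U-first : Q._≋_ 2 U (C ⊕ e)
  U-first i j = ≡.subst (Fil 2) (trans (sym (expand i j)) refl) (deep i j)
    where
    w : Mat
    w = bb ⊖ᴹ bbb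
    w′ : Mat
    w′ = bb ⊕ bbb
    expand : U ⊖ᴹ (C ⊕ e) ≋ X ⊗ w ⊗ (X ⊗ g) ⊕ X ⊗ (δ ⊖ᴹ b) ⊗ (X ⊗ w′) ⊖ᴹ (X ⊗ b ⊗ X) ⊗ b
    expand = solveᴹ 4 (λ X b w w′ → X ⊠ (𝟙 ⊖ b ⊞ w ⊖ w′) ⊠ (X ⊠ (𝟙 ⊞ b ⊞ w ⊞ w′)) ⊖ (X ⊠ X ⊞ (X ⊠ X ⊠ b ⊖ X ⊠ b ⊠ X)) ⊜
      X ⊠ (w ⊖ w′) ⊠ (X ⊠ (𝟙 ⊞ b ⊞ w ⊞ w′)) ⊞ X ⊠ (𝟙 ⊖ b) ⊠ (X ⊠ (w ⊞ w′)) ⊖ (X ⊠ b ⊠ X) ⊠ b) refl X b bb bbb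
    bbb-fil : FilM 2 bbb
    bbb-fil = filM-⊗ˡ 2 b bb-fil
    deep : FilM 2 (X ⊗ w ⊗ (X ⊗ g) ⊕ X ⊗ (δ ⊖ᴹ b) ⊗ (X ⊗ w′) ⊖ᴹ (X ⊗ b ⊗ X) ⊗ b)
    deep = filM-⊕ 2 (filM-⊕ 2
      (filM-⊗ʳ 2 (X ⊗ g) (filM-⊗ˡ 2 X (filM-⊕ 2 bb-fil (λ i j → fil-neg 2 (bbb-fil i j)))))
      (filM-⊗ˡ 2 (X ⊗ (δ ⊖ᴹ b)) (filM-⊗ˡ 2 X (filM-⊕ 2 bb-fil bbb-fil))))
      (λ i j → fil-neg 2 (filM-⊗ 1 1 (filM-⊗ʳ 1 X (filM-⊗ˡ 1 X b-fil)) b-fil i j))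

  -- The two terms of `e` contribute equally, since an odd rotation in XbX compensates its sign.
  tr-e : ∀ k → tr (e ⊗ pow C k) ≡ γ (suc k) + γ (suc k)
  tr-e k = begin
    tr (e ⊗ P) ≡⟨ tr-cong (solveᴹ 4 (λ C b X P → (C ⊠ b ⊖ X ⊠ b ⊠ X) ⊠ P ⊜ C ⊠ b ⊠ P ⊞ ⊟ (X ⊠ b ⊠ X ⊠ P)) refl C b X P) ⟩
    tr (C ⊗ b ⊗ P ⊕ ⊝ (X ⊗ b ⊗ X ⊗ P))
      ≡⟨ trans (tr-+ _ _) (cong₂ _+_ (tr-rotate cC b P) (trans (tr-neg _) (cong -_ (tr-XbXCᵏ cb k)))) ⟩
    tr (b ⊗ P ⊗ C) + - - γ (suc k) ≡⟨ cong₂ _+_ (tr-cong (transᴹ (⊗-assoc b P C) (⊗-congˡ (pow-sucʳ C k)))) (-‿involutive _) ⟩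
    γ (suc k) + γ (suc k) ∎
    where
    open ≡.≡-Reasoning
    P = pow C k

  private
    module Q₂ = FirstOrder (quotient 2) (quotient-divisible 2) n
    module N₂ = Q₂.Nilpotent {C} (λ i j y → ≡⇒∼ 2 (cC i j y)) (λ k → ≡⇒∼ 2 (tC k))
    module P₂ = N₂.Perturbed {e} (λ i j y → ≡⇒∼ 2 (ce i j y)) (λ i j k l → fil⇒∼ 2 (fil-* 1 1 (e-fil i j) (e-fil k l)))

  open Newton inv public

  pow-cong₂ : ∀ {M N} → Q._≋_ 2 M N → ∀ k → Q._≋_ 2 (pow M k) (pow N k)
  pow-cong₂ h zero = Q.reflᴹ 2 {δ}
  pow-cong₂ h (suc k) = Q.⊗-cong 2 h (pow-cong₂ h k)

  U-pow-first : ∀ k → Q._≋_ 2 (pow U k) (pow C k ⊕ dpow C e k)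
  U-pow-first k = Q.transᴹ 2 (pow-cong₂ U-first k) (P₂.pow-perturbed k)

  trpow-e : ∀ k → trpow C e k ≋ u k ⊕ u k
  trpow-e zero = symᴹ (⊕-identityˡ 0ᴹ)
  trpow-e (suc k) = transᴹ (⊕-cong (⊗-congˡ (trpow-e k)) (transᴹ (ι-cong (tr-e k)) (ι-+ _ _)))
    (solveᴹ 3 (λ C u g → C ⊠ (u ⊞ u) ⊞ (g ⊞ g) ⊜ (C ⊠ u ⊞ g) ⊞ (C ⊠ u ⊞ g)) refl C (u k) (ι (γ (suc k))))

  -- To first order Uⁿ is the derivative of Cⁿ along `e`, which equals `trpow C e n` = 2 u n and so
  -- has order 2.
  U-nilpotent : FilM 2 (pow U n)
  U-nilpotent i j = ∼⇒fil 2 (Q.trans 2 (U-pow-first n i j) (Q.trans 2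
    (Q.+-cong 2 (≡⇒∼ 2 (nilpotent n ℕ.≤-refl i j)) (P₂.dpow≋trpow i j))
    (Q.trans 2 (≡⇒∼ 2 (trans (+-identityˡ _) (trpow-e n i j)))
      (fil⇒∼ 2 (fil-+ 2 (u-deep n ℕ.≤-refl i j) (u-deep n ℕ.≤-refl i j))))))

  twoγ : ℕ → Carrier
  twoγ k = γ k + γ k

  -- The perturbation formula gives this modulo order 2; as `ρ` negates both sides, the difference
  -- has no second-order part.
  p-third : ∀ k → Fil 3 (p (suc k) - suc k × twoγ (suc k))
  p-third k = fil-odd odd (Q.trans 2 (Q.tr-cong 2 (pow-cong₂ U-first (suc k))) (Q.trans 2 (P₂.tr-perturbed k) (≡⇒∼ 2 (Sums.×-cong ring (suc k) (tr-e k)))))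
    where
    neg-× : ∀ k x → k × (- x) ≡ - (k × x)
    neg-× zero x = sym -0#≈0#
    neg-× (suc k) x = trans (cong₂ _+_ refl (neg-× k x)) (-‿+-comm _ _)
    two-ρ : ρ (twoγ (suc k)) ≡ - twoγ (suc k)
    two-ρ = trans (ρ-+ _ _) (trans (cong₂ _+_ (γ-ρ (suc k)) (γ-ρ (suc k))) (-‿+-comm _ _))
    odd : ρ (p (suc k) - suc k × twoγ (suc k)) ≡ - (p (suc k) - suc k × twoγ (suc k))
    odd = trans (ρ-+ _ _) (trans (cong₂ _+_ (p-ρ k) (trans (ρ-neg _) (cong -_ (trans (ρ-× (suc k) _) (trans (Sums.×-cong ring (suc k) two-ρ) (neg-× (suc k) _)))))) (-‿+-comm _ _))

  twoγ-fil : ∀ k → Fil 1 (twoγ k)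
  twoγ-fil k = fil-+ 1 (γ-fil k) (γ-fil k)

  p-fil : ∀ k → Fil 1 (p (suc k))
  p-fil k = ∼⇒fil 1 (Q.trans 1 (fil-≤ (s≤s z≤n) (p-third k)) (fil⇒∼ 1 (×-fil (suc k))))
    where
    ×-fil : ∀ l → Fil 1 (l × twoγ (suc k))
    ×-fil zero = fil-zero 1
    ×-fil (suc l) = fil-+ 1 (twoγ-fil (suc k)) (×-fil l)

  coef-second : ∀ k → Fil 2 (coef U (suc k) - - twoγ (suc k))
  coef-second k = Q.trans 2 (CayleyHamilton.coef-cong (quotient 2) (quotient-divisible 2) n U-first (suc k))
    (Q.trans 2 (P₂.coef-perturbed k) (≡⇒∼ 2 (cong -_ (tr-e k))))

  -- Newton's identities in convolution form, `adj U k` being ∑ cᵢ Uᵏ⁻ⁱ with cᵢ the characteristic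
  -- coefficients.
  tr-adj : ∀ k a → tr (adj U k ⊗ pow U (suc a)) ≡ anti _+_ (λ i j → coef U i * p (suc a ℕ.+ j)) k
  tr-adj zero a = trans (tr-cong (⊗-identityˡ _)) (sym (trans (*-identityˡ _) (cong p (ℕ.+-identityʳ (suc a)))))
  tr-adj (suc k) a = begin
    tr ((U ⊗ N ⊕ ι c) ⊗ P) ≡⟨ trans (tr-cong (⊗-distribʳ P (U ⊗ N) (ι c))) (tr-+ _ _) ⟩
    tr (U ⊗ N ⊗ P) + tr (ι c ⊗ P)
      ≡⟨ cong₂ _+_ (trans (tr-rotate cU N P) (tr-cong (transᴹ (⊗-assoc N P U) (⊗-congˡ (pow-sucʳ U (suc a)))))) (tr-ι c P) ⟩
    tr (N ⊗ pow U (suc (suc a))) + c * p (suc a)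
      ≡⟨ cong₂ _+_ (tr-adj k (suc a)) (cong (λ m → c * p m) (sym (ℕ.+-identityʳ (suc a)))) ⟩
    anti _+_ (λ i j → coef U i * p (suc (suc a) ℕ.+ j)) k + c * p (suc a ℕ.+ 0)
      ≡⟨ cong₂ _+_ (K.ad-cong k (λ i j _ → cong (λ m → coef U i * p m) (sym (ℕ.+-suc (suc a) j)))) refl ⟩
    anti _+_ (λ i j → coef U i * p (suc a ℕ.+ suc j)) k + c * p (suc a ℕ.+ 0)
      ≡⟨ K.ad-last (λ i j → coef U i * p (suc a ℕ.+ j)) k ⟨
    anti _+_ (λ i j → coef U i * p (suc a ℕ.+ j)) (suc k) ∎
    where
    open ≡.≡-Reasoning
    module K = Convolution ring
    N = adj U k
    P = pow U (suc a)
    c = coef U (suc k)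

  twoq : ℕ → Carrier
  twoq k = q k + q k

  private
    module K = Convolution ring
    module S₀ = Sums ring
    open NonCommSolver ring using (solve)

  q-inner : ∀ k → q (suc (suc k)) ≡ anti _+_ (λ i j → γ (suc i) * γ (suc j)) k
  q-inner k = trans (cong₂ _+_ (zeroˡ _) (trans (K.ad-last (λ i j → γ (suc i) * γ j) k) (trans (cong₂ _+_ refl (zeroʳ _)) (+-identityʳ _)))) (+-identityˡ _)

  ×-+ : ∀ k l x → (k ℕ.+ l) × x ≡ k × x + l × x
  ×-+ zero l x = sym (+-identityˡ _)
  ×-+ (suc k) l x = trans (cong (x +_) (×-+ k l x)) (sym (+-assoc _ _ _))

  ×-distrib : ∀ k x y → k × (x + y) ≡ k × x + k × y
  ×-distrib zero x y = sym (+-identityˡ 0#)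
  ×-distrib (suc k) x y = trans (cong (x + y +_) (×-distrib k x y)) (solve 4 (λ x y a c → x ⊞ y ⊞ (a ⊞ c) ⊜ x ⊞ a ⊞ (y ⊞ c)) refl _ _ _ _)

  ad-× : ∀ l (h : ℕ → ℕ → Carrier) k → anti _+_ (λ i j → l × h i j) k ≡ l × anti _+_ h k
  ad-× l h zero = refl
  ad-× l h (suc k) = trans (cong₂ _+_ refl (ad-× l _ k)) (sym (×-distrib l _ _))

  -- Exchanging the factors replaces the weight j + 1 by i + 1, and the two weights add up to the
  -- total degree. For generating functions this is (γ²)′ = 2γγ′.
  euler : ∀ k → anti _+_ (λ i j → suc j × (γ (suc i) * γ (suc j))) k + anti _+_ (λ i j → suc j × (γ (suc i) * γ (suc j))) k ≡ suc (suc k) × q (suc (suc k))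
  euler k = begin
    E + E ≡⟨ cong (E +_) (trans (K.ad-swap _ k) (K.ad-cong k (λ i j _ → S₀.×-cong (suc i) (γ-cen (suc j) (γ (suc i)))))) ⟩
    E + anti _+_ (λ i j → suc i × h i j) k ≡⟨ K.ad-+ _ _ k ⟨
    anti _+_ (λ i j → suc j × h i j + suc i × h i j) k
      ≡⟨ K.ad-cong k (λ i j eq → trans (sym (×-+ (suc j) (suc i) (h i j))) (cong (_× h i j) (weight i j eq))) ⟩
    anti _+_ (λ i j → suc (suc k) × h i j) k ≡⟨ ad-× (suc (suc k)) h k ⟩
    suc (suc k) × anti _+_ h k ≡⟨ cong (suc (suc k) ×_) (q-inner k) ⟨
    suc (suc k) × q (suc (suc k)) ∎
    where
    open ≡.≡-Reasoning
    h : ℕ → ℕ → Carrier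
    h i j = γ (suc i) * γ (suc j)
    E = anti _+_ (λ i j → suc j × h i j) k
    weight : ∀ i j → i ℕ.+ j ≡ k → suc j ℕ.+ suc i ≡ suc (suc k)
    weight i j eq = cong suc (trans (ℕ.+-suc j i) (cong suc (trans (ℕ.+-comm j i) eq)))

  -- As pₖ = 2kγₖ modulo order 3, the generating function of the coefficients is exp(-2γ) = 1 - 2γ +
  -- 2γ², and q is γ². The same result is obtained here through Newton's recursion.
  newton-sum : ∀ k → Fil 3 (tr (adj U k ⊗ U) - suc k × (twoγ (suc k) - twoq (suc k)))
  newton-sum k = Q.trans 3 (≡⇒∼ 3 (trans (tr-cong (⊗-congˡ (symᴹ (⊗-identityʳ U)))) (tr-adj k 0))) (go k)
    where
    q1 : q 1 ≡ 0#
    q1 = trans (cong₂ _+_ (zeroˡ _) (zeroʳ _)) (+-identityˡ 0#)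
    go : ∀ k → Fil 3 (anti _+_ (λ i j → coef U i * p (suc j)) k - suc k × (twoγ (suc k) - twoq (suc k)))
    go zero = Q.trans 3 (≡⇒∼ 3 (*-identityˡ _)) (Q.trans 3 (p-third 0) (≡⇒∼ 3 (cong (1 ×_)
      (trans (solve 1 (λ x → x ⊜ x ⊖ (𝟘 ⊞ 𝟘)) refl (twoγ 1)) (cong (λ w → twoγ 1 - (w + w)) (sym q1))))))
    -- The term with i = 0 is the power sum itself. In the others both factors have order 1, so the
    -- coefficient is needed only modulo order 2.
    go (suc k) = Q.trans 3 (Q.+-cong 3 (Q.trans 3 (≡⇒∼ 3 (*-identityˡ _)) (p-third (suc k))) inner) (≡⇒∼ 3 final)
      where
      h : ℕ → ℕ → Carrier
      h i j = γ (suc i) * γ (suc j)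
      E = anti _+_ (λ i j → suc j × h i j) k
      rearrange : ∀ i j → - twoγ (suc i) * (suc j × twoγ (suc j)) ≡ - (suc j × h i j + suc j × h i j + (suc j × h i j + suc j × h i j))
      rearrange i j = begin
        - twoγ (suc i) * (suc j × twoγ (suc j)) ≡⟨ S₀.×-comm-* (suc j) _ _ ⟩
        suc j × (- (x + x) * (y + y))
          ≡⟨ S₀.×-cong (suc j) (solve 2 (λ x y → ⊟ (x ⊞ x) ⊠ (y ⊞ y) ⊜ ⊟ 𝟙 ⊠ (x ⊠ y ⊞ x ⊠ y ⊞ (x ⊠ y ⊞ x ⊠ y))) refl x y) ⟩
        suc j × (- 1# * (h i j + h i j + (h i j + h i j))) ≡⟨ S₀.×-comm-* (suc j) _ _ ⟨
        - 1# * (suc j × (h i j + h i j + (h i j + h i j))) ≡⟨ S₀.-1*x≈-x _ ⟩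
        - (suc j × (h i j + h i j + (h i j + h i j)))
          ≡⟨ cong -_ (trans (×-distrib (suc j) _ _) (cong₂ _+_ (×-distrib (suc j) _ _) (×-distrib (suc j) _ _))) ⟩
        - (suc j × h i j + suc j × h i j + (suc j × h i j + suc j × h i j)) ∎
        where
        open ≡.≡-Reasoning
        x = γ (suc i)
        y = γ (suc j)
      mul : ∀ i j → Fil 3 (coef U (suc i) * p (suc j) - - twoγ (suc i) * (suc j × twoγ (suc j)))
      mul i j = ≡.subst (Fil 3) (solve 4 (λ a a′ y y′ → (a ⊖ a′) ⊠ y ⊞ a′ ⊠ (y ⊖ y′) ⊜ a ⊠ y ⊖ a′ ⊠ y′) refl (coef U (suc i)) (- twoγ (suc i)) (p (suc j)) (suc j × twoγ (suc j)))
        (fil-+ 3 (fil-* 2 1 (coef-second i) (p-fil j)) (fil-*ˡ 3 (- twoγ (suc i)) (p-third j)))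
      inner : Fil 3 (anti _+_ (λ i j → coef U (suc i) * p (suc j)) k - - (E + E + (E + E)))
      inner = Q.trans 3 (Convolution.ad-cong (quotient 3) k (λ i j _ → mul i j)) (≡⇒∼ 3 (trans (K.ad-cong k (λ i j _ → trans (rearrange i j) (sym (S₀.-1*x≈-x _))))
        (trans (sym (K.ad-*ˡ (- 1#) _ k)) (trans (S₀.-1*x≈-x _) (cong -_ (trans (K.ad-+ _ _ k) (cong₂ _+_ (K.ad-+ _ _ k) (K.ad-+ _ _ k))))))))
      final : suc (suc k) × twoγ (suc (suc k)) + - (E + E + (E + E)) ≡ suc (suc k) × (twoγ (suc (suc k)) - twoq (suc (suc k)))
      final = trans (cong₂ (λ v w → suc (suc k) × twoγ (suc (suc k)) + - (v + w)) (euler k) (euler k))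
        (trans (cong (suc (suc k) × twoγ (suc (suc k)) +_) (trans (cong -_ (sym (×-distrib (suc (suc k)) _ _))) (×-neg (suc (suc k)) _)))
          (sym (×-distrib (suc (suc k)) _ _)))
        where
        ×-neg : ∀ l x → - (l × x) ≡ l × (- x)
        ×-neg zero x = -0#≈0#
        ×-neg (suc l) x = trans (sym (-‿+-comm _ _)) (cong₂ _+_ refl (×-neg l x))

  coef-third : ∀ k → Fil 3 (coef U (suc k) - - (twoγ (suc k) - twoq (suc k)))
  coef-third k = Q.-‿cong 3 (Q.trans 3 (Q.*-congˡ 3 {inv k} (newton-sum k)) (≡⇒∼ 3 (inv-law k _)))

  -- The sum of the coefficients of `U` and `U′`, which removes the parts of odd order: it is 2 in
  -- degree 0 and 4q in positive degree.
  v : ℕ → Carrier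
  v k = coef U k + ρ (coef U k)

  v-q : ∀ k → v (suc k) ≡ twoq (suc k) + twoq (suc k)
  v-q k = S₀.x∙y⁻¹≈ε⇒x≈y _ _ (nil (fil-even even deep))
    where
    c = coef U (suc k)
    l = - (twoγ (suc k) - twoq (suc k))
    ρl : ρ l ≡ twoγ (suc k) + twoq (suc k)
    ρl = trans (ρ-neg _) (trans (cong -_ (trans (ρ-+ _ _) (cong₂ _+_ (trans (ρ-+ _ _) (cong₂ _+_ (γ-ρ (suc k)) (γ-ρ (suc k))))
      (trans (ρ-neg _) (cong -_ (trans (ρ-+ _ _) (cong₂ _+_ (q-ρ (suc k)) (q-ρ (suc k))))))))) (solve 2 (λ x y → ⊟ (⊟ x ⊞ ⊟ x ⊞ ⊟ (y ⊞ y)) ⊜ x ⊞ x ⊞ (y ⊞ y)) refl _ _))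
    deep : Fil 3 (v (suc k) - (twoq (suc k) + twoq (suc k)))
    deep = ≡.subst (Fil 3) (trans (cong (λ w → c - l + (ρ c + - w)) ρl)
      (solve 4 (λ c r g q → c ⊖ ⊟ (g ⊖ q) ⊞ (r ⊖ (g ⊞ q)) ⊜ c ⊞ r ⊖ (q ⊞ q)) refl c (ρ c) (twoγ (suc k)) (twoq (suc k))))
      (fil-+ 3 (coef-third k) (≡.subst (Fil 3) (trans (ρ-+ c (- l)) (cong (ρ c +_) (ρ-neg l))) (fil-ρ 3 (coef-third k))))
    even : ρ (v (suc k) - (twoq (suc k) + twoq (suc k))) ≡ v (suc k) - (twoq (suc k) + twoq (suc k))
    even = trans (ρ-+ _ _) (cong₂ _+_ (trans (ρ-+ _ _) (trans (cong₂ _+_ refl (ρ-ρ _)) (+-comm _ _)))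
      (trans (ρ-neg _) (cong -_ (trans (ρ-+ _ _) (cong₂ _+_ qq qq)))))
      where
      qq : ρ (twoq (suc k)) ≡ twoq (suc k)
      qq = trans (ρ-+ _ _) (cong₂ _+_ (q-ρ (suc k)) (q-ρ (suc k)))

  v-fil : ∀ k → Fil 2 (v (suc k))
  v-fil k = ≡.subst (Fil 2) (sym (v-q k)) (fil-+ 2 (fil-+ 2 (q-fil (suc k)) (q-fil (suc k))) (fil-+ 2 (q-fil (suc k)) (q-fil (suc k))))

  v-vanish : ∀ k → n ℕ.≤ suc k → v (suc k) ≡ 0#
  v-vanish k h = trans (v-q k) (trans (cong (λ w → w + w + (w + w)) (q-vanish (suc k) h)) (solve 0 (𝟘 ⊞ 𝟘 ⊞ (𝟘 ⊞ 𝟘) ⊜ 𝟘) refl))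

  module CH = CayleyHamilton ring divisible n

  cen-adj : ∀ {V} → CenM V → ∀ k → CenM (adj V k)
  cen-coef : ∀ {V} → CenM V → ∀ k → Cen (coef V k)
  cen-adj cV zero = cen-δ
  cen-adj cV (suc k) = cen-⊕ (cen-⊗ cV (cen-adj cV k)) (cen-ι (cen-coef cV (suc k)))
  cen-coef cV zero = cen-1
  cen-coef cV (suc k) = cen-neg (cen-* (inv-cen k) (cen-tr (cen-⊗ (cen-adj cV k) cV)))

  adj-comm : ∀ {V} → CenM V → ∀ k → adj V k ⊗ V ≋ V ⊗ adj V k
  adj-comm {V} cV zero = transᴹ (⊗-identityˡ V) (symᴹ (⊗-identityʳ V))
  adj-comm {V} cV (suc k) = begin
    (V ⊗ N ⊕ c) ⊗ V ≈⟨ solveᴹ 3 (λ V N c → (V ⊠ N ⊞ c) ⊠ V ⊜ V ⊠ (N ⊠ V) ⊞ c ⊠ V) refl V N c ⟩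
    V ⊗ (N ⊗ V) ⊕ c ⊗ V ≈⟨ ⊕-cong (⊗-congˡ (adj-comm cV k)) (ι-comm (cen-coef cV (suc k)) V) ⟩
    V ⊗ (V ⊗ N) ⊕ V ⊗ c ≈⟨ symᴹ (⊗-distribˡ V (V ⊗ N) c) ⟩
    V ⊗ (V ⊗ N ⊕ c) ∎
    where
    open import Relation.Binary.Reasoning.Setoid setoidᴹ
    N = adj V k
    c = ι (coef V (suc k))

  ρ-coef : ∀ V k → ρ (coef V k) ≡ coef (ρᴹ V) k
  ρ-adj : ∀ V k → ρᴹ (adj V k) ≋ adj (ρᴹ V) k
  ρ-coef V zero = ρ-1
  ρ-coef V (suc k) = trans (ρ-neg _) (cong -_ (trans (ρ-* _ _) (cong₂ _*_ (ρ-inv k) (trans (ρ-tr _) (tr-cong (transᴹ (ρ-⊗ (adj V k) V) (⊗-congʳ (ρ-adj V k))))))))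
  ρ-adj V zero = ρ-δ
  ρ-adj V (suc k) i j = trans (ρ-+ _ _) (cong₂ _+_ (transᴹ (ρ-⊗ V (adj V k)) (⊗-congˡ (ρ-adj V k)) i j)
    (trans (ρ-ι (coef V (suc k)) i j) (ι-cong (ρ-coef V (suc k)) i j)))

  coef-U′ : ∀ k → coef U′ k ≡ ρ (coef U k)
  coef-U′ k = sym (trans (ρ-coef U k) (CH.coef-cong ρ-U k))

  -- `w k` is ∑ vᵢ Uᵏ⁻ⁱ, the sum of the Cayley-Hamilton expressions of `U` and `U′`, both written in
  -- `U`.
  w : ℕ → Mat
  w zero = δ ⊕ δ
  w (suc k) = w k ⊗ U ⊕ ι (v (suc k))

  -- AU′ = UA carries the expression for `U′` over to `U`. The multiplication by `A` is harmless
  -- because U = AB.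
  w-A : ∀ k → w k ⊗ A ≋ adj U k ⊗ A ⊕ A ⊗ adj U′ k
  w-A zero = solveᴹ 1 (λ A → (𝟙 ⊞ 𝟙) ⊠ A ⊜ 𝟙 ⊠ A ⊞ A ⊠ 𝟙) refl A
  w-A (suc k) = begin
    (w k ⊗ (A ⊗ B) ⊕ ι (v (suc k))) ⊗ A
      ≈⟨ solveᴹ 4 (λ W A B v → (W ⊠ (A ⊠ B) ⊞ v) ⊠ A ⊜ W ⊠ A ⊠ (B ⊠ A) ⊞ v ⊠ A) refl (w k) A B (ι (v (suc k))) ⟩
    w k ⊗ A ⊗ U′ ⊕ ι (v (suc k)) ⊗ A
      ≈⟨ ⊕-cong (⊗-congʳ (w-A k)) (⊗-congʳ (transᴹ (ι-cong (cong (c +_) (sym (coef-U′ (suc k))))) (ι-+ c c′))) ⟩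
    (N ⊗ A ⊕ A ⊗ N′) ⊗ U′ ⊕ (ι c ⊕ ι c′) ⊗ A
      ≈⟨ solveᴹ 6 (λ N A B N′ c c′ → (N ⊠ A ⊞ A ⊠ N′) ⊠ (B ⊠ A) ⊞ (c ⊞ c′) ⊠ A ⊜ (N ⊠ (A ⊠ B)) ⊠ A ⊞ c ⊠ A ⊞ (A ⊠ (N′ ⊠ (B ⊠ A)) ⊞ c′ ⊠ A)) refl N A B N′ (ι c) (ι c′) ⟩
    N ⊗ U ⊗ A ⊕ ι c ⊗ A ⊕ (A ⊗ (N′ ⊗ U′) ⊕ ι c′ ⊗ A)
      ≈⟨ ⊕-cong (⊕-congʳ (⊗-congʳ (adj-comm cU k))) (⊕-cong (⊗-congˡ (adj-comm cU′ k)) (ι-comm (cen-coef cU′ (suc k)) A)) ⟩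
    U ⊗ N ⊗ A ⊕ ι c ⊗ A ⊕ (A ⊗ (U′ ⊗ N′) ⊕ A ⊗ ι c′)
      ≈⟨ ⊕-cong (symᴹ (⊗-distribʳ A (U ⊗ N) (ι c))) (symᴹ (⊗-distribˡ A (U′ ⊗ N′) (ι c′))) ⟩
    (U ⊗ N ⊕ ι c) ⊗ A ⊕ A ⊗ (U′ ⊗ N′ ⊕ ι c′) ∎
    where
    open import Relation.Binary.Reasoning.Setoid setoidᴹ
    N = adj U k
    N′ = adj U′ k
    c = coef U (suc k)
    c′ = coef U′ (suc k)

  w-U : ∀ k → n ℕ.≤ k → w k ⊗ U ≋ 0ᴹ
  w-U k n≤k = transᴹ (symᴹ (⊗-assoc (w k) A B)) (transᴹ (⊗-congʳ (transᴹ (w-A k)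
    (transᴹ (⊕-cong (transᴹ (⊗-congʳ (CH.cayley-hamilton U cU k n≤k)) (⊗-zeroˡ A)) (transᴹ (⊗-congˡ (CH.cayley-hamilton U′ cU′ k n≤k)) (⊗-zeroʳ A))) (⊕-identityˡ 0ᴹ)))) (⊗-zeroˡ B))

  w-vanish : ∀ k → n ℕ.≤ k → w (suc k) ≋ 0ᴹ
  w-vanish k n≤k = transᴹ (⊕-cong (w-U k n≤k) (ι-0 (v-vanish k (ℕ.m≤n⇒m≤1+n n≤k)))) (⊕-identityˡ 0ᴹ)

  w-first : ∀ k → Q._≋_ 2 (w k) (pow U k ⊕ pow U k)
  w-first zero = Q.reflᴹ 2 {δ ⊕ δ}
  w-first (suc k) = Q.transᴹ 2 (Q.⊕-cong 2 (Q.⊗-congʳ 2 (w-first k)) (λ i j → fil⇒∼ 2 (filM-ι 2 (v-fil k) i j)))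
    (≋⇒∼ 2 (transᴹ (⊕-identityʳ _) (transᴹ (⊗-distribʳ U (pow U k) (pow U k)) (⊕-cong (pow-sucʳ U k) (pow-sucʳ U k)))))

-- Vanishing of the power of U for at least three vertices

module Large (S : SuperRing) (nil : ∀ {x} → SuperRing.Fil S 4 x → x ≡ SuperRing.0# S) (m : ℕ)
             {X b : Filtered.Mat S (3 ℕ.+ m)} (gr : Filtered.Graded S (3 ℕ.+ m) X b) where
  private
    n n′ n″ : ℕ
    n = 3 ℕ.+ m
    n′ = 2 ℕ.+ m
    n″ = 1 ℕ.+ m
  open Filtered S n
  open Twisted S nil n gr
  open ≡ using (cong; cong₂; sym; trans; refl)

  -- The elementary matrix that picks out one entry under the trace; it is even and fixed by `ρ`,
  -- hence an admissible direction `c`.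
  unit : Fin n → Fin n → Mat
  unit i j x y = δ x j * δ i y

  tr-unit : ∀ M i j → tr (M ⊗ unit i j) ≡ M i j
  tr-unit M i j = begin
    tr (M ⊗ unit i j) ≡⟨ tr-∑ _ ⟩
    ∑ (λ x → ∑ (λ y → M x y * (δ y j * δ i x)))
      ≡⟨ ∑-cong (λ x → trans (∑-cong (λ y → sym (*-assoc _ _ _))) (trans (sym (*-distribʳ-∑ (δ i x) _)) (cong (_* δ i x) (δ-∑ʳ j (M x))))) ⟩
    ∑ (λ x → M x j * δ i x) ≡⟨ ∑-cong (λ x → sym (cen-δ i x (M x j))) ⟩
    ∑ (λ x → δ i x * M x j) ≡⟨ δ-∑ˡ i (λ x → M x j) ⟩
    M i j ∎
    where
    open ≡.≡-Reasoning
    open Sums ring using (∑-cong; *-distribʳ-∑)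

  q-dpow : ∀ i j → q n′ * dpow C e n′ i j ≡ 0#
  q-dpow i j = trans (cong (q n′ *_) (sym (tr-unit (dpow C e n′) i j)))
    (Variation.q-dpow-vanish S nil (1 ℕ.+ m) gr (unit i j)
      (λ x y → trans (σ-* _ _) (cong₂ _*_ (σ-δ x j) (σ-δ i y))) (λ x y → trans (ρ-* _ _) (cong₂ _*_ (ρ-δ x j) (ρ-δ i y))))

  -- `q` has order 2, so only the orders 0 and 1 of Uⁿ⁻¹ matter. The first is handled by
  -- `qC-vanish`, the second by the derivative tested against all elementary matrices.
  qU-vanish : ∀ i j → q n′ * pow U n′ i j ≡ 0#
  qU-vanish i j = begin
    q n′ * pow U n′ i j
      ≡⟨ solve 4 (λ q u c d → q ⊠ u ⊜ q ⊠ (u ⊖ (c ⊞ d)) ⊞ (q ⊠ c ⊞ q ⊠ d)) refl (q n′) (pow U n′ i j) (pow C n′ i j) (dpow C e n′ i j) ⟩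
    q n′ * (pow U n′ i j - (pow C n′ i j + dpow C e n′ i j)) + (q n′ * pow C n′ i j + q n′ * dpow C e n′ i j)
      ≡⟨ cong₂ _+_ (nil (fil-* 2 2 (q-fil n′) (U-pow-first n′ i j))) (cong₂ _+_ (Obstruction.qC-vanish S nil (1 ℕ.+ m) gr i j) (q-dpow i j)) ⟩
    0# + (0# + 0#) ≡⟨ solve 0 (𝟘 ⊞ (𝟘 ⊞ 𝟘) ⊜ 𝟘) refl ⟩
    0# ∎
    where
    open ≡.≡-Reasoning
    open NonCommSolver ring using (solve)

  w-high : ∀ a → w (a ℕ.+ n′) ≋ w n′ ⊗ pow U a
  w-high zero = symᴹ (⊗-identityʳ (w n′))
  w-high (suc a) = begin
    w (a ℕ.+ n′) ⊗ U ⊕ ι (v (suc (a ℕ.+ n′))) ≈⟨ ⊕-cong (⊗-congʳ (w-high a)) (ι-0 (v-vanish (a ℕ.+ n′) (s≤s (ℕ.m≤n+m n′ a)))) ⟩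
    w n′ ⊗ pow U a ⊗ U ⊕ 0ᴹ ≈⟨ transᴹ (⊕-identityʳ _) (⊗-assoc (w n′) (pow U a) U) ⟩
    w n′ ⊗ (pow U a ⊗ U) ≈⟨ ⊗-congˡ (pow-sucʳ U a) ⟩
    w n′ ⊗ (U ⊗ pow U a) ∎
    where open import Relation.Binary.Reasoning.Setoid setoidᴹ

  -- `w n″` is 2Uⁿ⁻² up to order 2, and Uⁿ has order 2, so the error has order 4.
  w-product : w n″ ⊗ pow U n ≋ pow U (n″ ℕ.+ n) ⊕ pow U (n″ ℕ.+ n)
  w-product i j = trans (Sums.x∙y⁻¹≈ε⇒x≈y ring _ _ (nil (deep i j))) (symᴹ double i j)
    where
    P = pow U n
    Y = pow U n″ ⊕ pow U n″
    double : pow U (n″ ℕ.+ n) ⊕ pow U (n″ ℕ.+ n) ≋ Y ⊗ P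
    double = transᴹ (⊕-cong (pow-+ U n″ n) (pow-+ U n″ n)) (symᴹ (⊗-distribʳ P (pow U n″) (pow U n″)))
    deep : FilM 4 (w n″ ⊗ P ⊖ᴹ Y ⊗ P)
    deep = filM-resp 4 (solveᴹ 3 (λ W Y P → (W ⊖ Y) ⊠ P ⊜ W ⊠ P ⊖ Y ⊠ P) refl (w n″) Y P)
      (filM-⊗ 2 2 (w-first n″) U-nilpotent)

  -- In degree 2n - 2 the relation w = 0 reads 2U²ⁿ⁻² + 4q Uⁿ⁻¹ = 0. It is available from degree n +
  -- 1 on, and 2n - 2 reaches this exactly when n ≥ 3.
  U-vanish : pow U (n″ ℕ.+ n) ≋ 0ᴹ
  U-vanish i j = Divisible.double-cancel divisible (begin
    pow U (n″ ℕ.+ n) i j + pow U (n″ ℕ.+ n) i j ≡⟨ w-product i j ⟨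
    (w n″ ⊗ pow U n) i j ≡⟨ +-identityʳ _ ⟨
    (w n″ ⊗ pow U n) i j + 0# ≡⟨ cong₂ _+_ refl (sym (vU i j)) ⟩
    (w n″ ⊗ (U ⊗ pow U n′) ⊕ ι (v n′) ⊗ pow U n′) i j
      ≡⟨ solveᴹ 4 (λ W U P v → W ⊠ (U ⊠ P) ⊞ v ⊠ P ⊜ (W ⊠ U ⊞ v) ⊠ P) refl (w n″) U (pow U n′) (ι (v n′)) i j ⟩
    (w n′ ⊗ pow U n′) i j ≡⟨ w-high n′ i j ⟨
    w (n′ ℕ.+ n′) i j ≡⟨ w-vanish (suc m ℕ.+ n′) (s≤s (ℕ.m≤n+m n′ m)) i j ⟩
    0# ∎)
    where
    open ≡.≡-Reasoning
    vU : ι (v n′) ⊗ pow U n′ ≋ 0ᴹ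
    vU k l = trans (ι-⊗ (v n′) (pow U n′) k l) (trans (cong (_* pow U n′ k l) (v-q n″))
      (trans (NonCommSolver.solve ring 2 (λ q u → (q ⊞ q ⊞ (q ⊞ q)) ⊠ u ⊜ q ⊠ u ⊞ q ⊠ u ⊞ (q ⊠ u ⊞ q ⊠ u)) refl (q n′) (pow U n′ k l))
        (trans (cong (λ z → z + z + (z + z)) (qU-vanish k l)) (NonCommSolver.solve ring 0 (𝟘 ⊞ 𝟘 ⊞ (𝟘 ⊞ 𝟘) ⊜ 𝟘) refl))))

-- The case of two vertices

-- For two vertices the entries of a squared odd matrix only involve three odd elements, so their products vanish.
module Two (S : SuperRing) (nil : ∀ {x} → SuperRing.Fil S 4 x → x ≡ SuperRing.0# S)
             {X b : Filtered.Mat S 2} (gr : Filtered.Graded S 2 X b) where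
  open Filtered S 2
  open Twisted S nil 2 gr hiding (q)
  open ≡ using (cong; cong₂; sym; trans; refl)
  open NonCommSolver ring using (solve)

  Odd₁ : Carrier → Set
  Odd₁ x = σ x ≡ - x

  odd-square : ∀ {x} → Odd₁ x → x * x ≡ 0#
  odd-square h = Divisible.self-neg divisible (odd-anti h h)

  shared : ∀ {x y} z → Odd₁ x → Odd₁ y → x * y * (x * z) ≡ 0#
  shared {x} {y} z hx hy = begin
    x * y * (x * z) ≡⟨ *-assoc _ _ _ ⟨
    x * y * x * z ≡⟨ cong (_* z) (odd-pair hx hy x) ⟩
    x * (x * y) * z ≡⟨ cong (_* z) (*-assoc _ _ _) ⟨
    x * x * y * z ≡⟨ cong (λ w → w * y * z) (odd-square hx) ⟩
    0# * y * z ≡⟨ solve 2 (λ y z → 𝟘 ⊠ y ⊠ z ⊜ 𝟘) refl y z ⟩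
    0# ∎
    where open ≡.≡-Reasoning

  D : Mat
  D = A ⊗ A

  private
    a₀₀ = A zero zero
    a₀₁ = A zero (suc zero)
    a₁₀ = A (suc zero) zero
    a₁₁ = A (suc zero) (suc zero)
    d = a₀₀ - a₁₁

  d-odd : Odd₁ d
  d-odd = trans (σ-+ _ _) (trans (cong₂ _+_ (A-odd zero zero) (trans (σ-neg _) (cong -_ (A-odd (suc zero) (suc zero))))) (-‿+-comm _ _))

  ∑₂ : (f : Fin 2 → Carrier) → ∑ f ≡ f zero + f (suc zero)
  ∑₂ f = trans (fold-suc _+_ 0# f) (cong₂ _+_ refl (trans (fold-suc _+_ 0# _) (trans (cong₂ _+_ refl (fold-zero _+_ 0# _)) (+-identityʳ _))))

  -- The entries of `D` up to sign. Any two of them share one of the odd elements `d`, `a₀₁`, `a₁₀`,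
  -- whose square is zero.
  x₀ x₁ x₂ : Carrier
  x₀ = a₀₁ * a₁₀
  x₁ = d * a₀₁
  x₂ = a₁₀ * d

  D₀₀ : D zero zero ≡ x₀
  D₀₀ = trans (∑₂ _) (trans (cong₂ _+_ (odd-square (A-odd zero zero)) refl) (+-identityˡ _))

  D₀₁ : D zero (suc zero) ≡ x₁
  D₀₁ = trans (∑₂ _) (trans (cong₂ _+_ refl (odd-anti (A-odd zero (suc zero)) (A-odd (suc zero) (suc zero))))
    (solve 3 (λ p q s → p ⊠ q ⊞ ⊟ (s ⊠ q) ⊜ (p ⊖ s) ⊠ q) refl a₀₀ a₀₁ a₁₁))

  D₁₀ : D (suc zero) zero ≡ x₂
  D₁₀ = trans (∑₂ _) (trans (cong₂ _+_ refl (odd-anti (A-odd (suc zero) (suc zero)) (A-odd (suc zero) zero)))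
    (solve 3 (λ p r s → r ⊠ p ⊞ ⊟ (r ⊠ s) ⊜ r ⊠ (p ⊖ s)) refl a₀₀ a₁₀ a₁₁))

  D₁₁ : D (suc zero) (suc zero) ≡ - x₀
  D₁₁ = trans (∑₂ _) (trans (cong₂ _+_ (odd-anti (A-odd (suc zero) zero) (A-odd zero (suc zero))) (odd-square (A-odd (suc zero) (suc zero)))) (+-identityʳ _))

  Kills : Carrier → Set
  Kills y = ∀ i j → D i j * y ≡ 0#

  kills : ∀ {y} → x₀ * y ≡ 0# → x₁ * y ≡ 0# → x₂ * y ≡ 0# → Kills y
  kills {y} h₀ h₁ h₂ zero zero = trans (cong (_* y) D₀₀) h₀
  kills {y} h₀ h₁ h₂ zero (suc zero) = trans (cong (_* y) D₀₁) h₁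
  kills {y} h₀ h₁ h₂ (suc zero) zero = trans (cong (_* y) D₁₀) h₂
  kills {y} h₀ h₁ h₂ (suc zero) (suc zero) = trans (cong (_* y) D₁₁) (trans (sym (-‿distribˡ-* _ _)) (trans (cong -_ h₀) -0#≈0#))

  private
    q r : Carrier
    q = a₀₁
    r = a₁₀
    q-odd = A-odd zero (suc zero)
    r-odd = A-odd (suc zero) zero

    rotate : ∀ {x y} z → Odd₁ x → Odd₁ y → Odd₁ z → x * y * (z * x) ≡ 0#
    rotate {x} {y} z hx hy hz = trans (cong (x * y *_) (odd-anti hz hx)) (trans (sym (-‿distribʳ-* _ _)) (trans (cong -_ (shared z hx hy)) -0#≈0#))

    flip-zero : ∀ {x y} → Cen x → x * y ≡ 0# → y * x ≡ 0#
    flip-zero {x} {y} c h = trans (sym (c y)) h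

    c₀ : Cen x₀
    c₀ = odd-pair q-odd r-odd
    c₁ : Cen x₁
    c₁ = odd-pair d-odd q-odd
    x₀x₁ : x₀ * x₁ ≡ 0#
    x₀x₁ = rotate d q-odd r-odd d-odd
    x₁x₂ : x₁ * x₂ ≡ 0#
    x₁x₂ = rotate r d-odd q-odd r-odd
    x₂x₀ : x₂ * x₀ ≡ 0#
    x₂x₀ = rotate q r-odd d-odd q-odd
    c₂ : Cen x₂
    c₂ = odd-pair r-odd d-odd

  D-products : ∀ i j k l → D i j * D k l ≡ 0#
  D-products i j zero zero = trans (cong (D i j *_) D₀₀) (kills (shared r q-odd r-odd) (flip-zero c₀ x₀x₁) x₂x₀ i j)
  D-products i j zero (suc zero) = trans (cong (D i j *_) D₀₁) (kills x₀x₁ (shared q d-odd q-odd) (flip-zero c₁ x₁x₂) i j)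
  D-products i j (suc zero) zero = trans (cong (D i j *_) D₁₀) (kills (flip-zero c₂ x₂x₀) x₁x₂ (shared d r-odd d-odd) i j)
  D-products i j (suc zero) (suc zero) = trans (cong (D i j *_) D₁₁) (trans (sym (-‿distribʳ-* _ _))
    (trans (cong -_ (kills (shared r q-odd r-odd) (flip-zero c₀ x₀x₁) x₂x₀ i j)) -0#≈0#))

  U-vanish : pow U 2 ≋ 0ᴹ
  U-vanish = begin
    U ⊗ (U ⊗ δ) ≈⟨ ⊗-cong factor (transᴹ (⊗-identityʳ U) factor) ⟩
    D ⊗ K ⊗ (D ⊗ K) ≈⟨ solveᴹ 2 (λ D K → D ⊠ K ⊠ (D ⊠ K) ⊜ (D ⊠ K ⊠ D) ⊠ K) refl D K ⟩
    (D ⊗ K ⊗ D) ⊗ K ≈⟨ ⊗-congʳ sandwich ⟩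
    0ᴹ ⊗ K ≈⟨ ⊗-zeroˡ K ⟩
    0ᴹ ∎
    where
    open import Relation.Binary.Reasoning.Setoid setoidᴹ
    open Filtered.Graded gr using (cb)
    -- As `g′` inverts 1 + b, X = A(1 + b); thus U = AXg = A² K, and the central entries of `K` can
    -- be moved out of DKD.
    K = (δ ⊕ b) ⊗ g
    factor : U ≋ D ⊗ K
    factor = transᴹ (⊗-congˡ (⊗-congʳ (transᴹ (symᴹ (⊗-identityʳ X)) (⊗-congˡ (symᴹ g′-inverse)))))
      (solveᴹ 4 (λ X g′ h g → X ⊠ g′ ⊠ (X ⊠ (g′ ⊠ h) ⊠ g) ⊜ X ⊠ g′ ⊠ (X ⊠ g′) ⊠ (h ⊠ g)) refl X g′ (δ ⊕ b) g)
    sandwich : D ⊗ K ⊗ D ≋ 0ᴹ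
    sandwich i j = Sums.∑-zero ring (λ y → trans (Sums.*-distribʳ-∑ ring _ _) (Sums.∑-zero ring (λ x →
      trans (cong (_* D y j) (sym (cK x y (D i x)))) (trans (*-assoc _ _ _) (trans (cong (K x y *_) (D-products i x y j)) (zeroʳ _))))))
      where
      cK : CenM K
      cK = cen-⊗ (cen-⊕ cen-δ cb) (even-cen g-even)

-- From powers of U to alternating walks

module Vanishing (S : SuperRing) (nil : ∀ {x} → SuperRing.Fil S 4 x → x ≡ SuperRing.0# S) (m : ℕ)
             {X b : Filtered.Mat S (2 ℕ.+ m)} (gr : Filtered.Graded S (2 ℕ.+ m) X b) where
  private
    n : ℕ
    n = 2 ℕ.+ m
  open Filtered S n
  open Filtered.Graded gr
  open Twisted S nil n gr
  open ≡ using (cong; cong₂; sym; trans; refl)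

  U-zero : pow U (m ℕ.+ n) ≋ 0ᴹ
  U-zero = go m gr
    where
    go : ∀ m {X b} (gr : Filtered.Graded S (2 ℕ.+ m) X b) →
      Filtered._≋_ S (2 ℕ.+ m) (Filtered.pow S (2 ℕ.+ m) (Twisted.U S nil (2 ℕ.+ m) gr) (m ℕ.+ (2 ℕ.+ m))) (Filtered.0ᴹ S (2 ℕ.+ m))
    go zero gr = Two.U-vanish S nil gr
    go (suc m) gr = Large.U-vanish S nil m gr

  G : ℕ → Mat
  G = walks X b

  -- Two steps of `walks` apply `ρ` once to the inner `g` and twice, that is not at all, to what
  -- follows.
  G-even : ∀ l → G (l ℕ.+ l) ≋ g ⊗ pow U l
  G-even zero = symᴹ (⊗-identityʳ g)
  G-even (suc l) = transᴹ (MR.reflexive (cong (λ k → G (suc k)) (ℕ.+-suc l l))) (begin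
    g ⊗ (X ⊗ ρᴹ (g ⊗ (X ⊗ ρᴹ (G (l ℕ.+ l)))))
      ≈⟨ ⊗-congˡ (⊗-congˡ (transᴹ (ρ-⊗ g _) (⊗-cong ρ-g (transᴹ (ρ-⊗ X _) (⊗-cong X-ρ (λ i j → ρ-ρ _)))))) ⟩
    g ⊗ (X ⊗ (g′ ⊗ (X ⊗ G (l ℕ.+ l)))) ≈⟨ ⊗-congˡ (⊗-congˡ (⊗-congˡ (⊗-congˡ (G-even l)))) ⟩
    g ⊗ (X ⊗ (g′ ⊗ (X ⊗ (g ⊗ pow U l))))
      ≈⟨ solveᴹ 4 (λ g X g′ P → g ⊠ (X ⊠ (g′ ⊠ (X ⊠ (g ⊠ P)))) ⊜ g ⊠ (X ⊠ g′ ⊠ (X ⊠ g) ⊠ P)) refl g X g′ (pow U l) ⟩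
    g ⊗ (U ⊗ pow U l) ∎)
    where open import Relation.Binary.Reasoning.Setoid setoidᴹ

  G-step : ∀ k → G k ≋ 0ᴹ → G (suc k) ≋ 0ᴹ
  G-step k h = transᴹ (⊗-congˡ (transᴹ (⊗-congˡ (λ i j → trans (cong ρ (h i j)) ρ-0)) (⊗-zeroʳ X))) (⊗-zeroʳ g)

  G-vanish : ∀ k → (m ℕ.+ n) ℕ.+ (m ℕ.+ n) ℕ.≤ k → G k ≋ 0ᴹ
  G-vanish k h = go (ℕ.≤⇒≤′ h)
    where
    go : ∀ {k} → (m ℕ.+ n) ℕ.+ (m ℕ.+ n) ℕ.≤′ k → G k ≋ 0ᴹ
    go ℕ.≤′-refl = transᴹ (G-even (m ℕ.+ n)) (transᴹ (⊗-congˡ U-zero) (⊗-zeroʳ g))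
    go (ℕ.≤′-step {k} l) = G-step k (go l)

  G-zero-rec : G 0 ≋ δ ⊕ b ⊗ G 0
  G-zero-rec = g-rec

  -- Separates the words by their first letter, X or b; this is the form that matches the recursion
  -- for trails.
  G-suc-rec : ∀ k → G (suc k) ≋ X ⊗ ρᴹ (G k) ⊕ b ⊗ G (suc k)
  G-suc-rec k = transᴹ (⊗-congʳ g-rec) (solveᴹ 3 (λ b g Y → (𝟙 ⊞ b ⊠ g) ⊠ Y ⊜ Y ⊞ b ⊠ (g ⊠ Y)) refl b g (X ⊗ ρᴹ (G k)))

open ≡ using (refl; sym; trans; cong; cong₂; _≗_)

-- The algebra generated by the edges

module Base where
  open Raw ℚ._+_ ℚ._*_ ℚ.-_ 0ℚ 1ℚ using (_×_)

  natural-nonNeg : ∀ k → ℚ.NonNegative (k × 1ℚ)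
  natural-nonNeg zero = _
  natural-nonNeg (suc k) = ℚ.nonNeg+nonNeg⇒nonNeg 1ℚ (k × 1ℚ) {{natural-nonNeg k}}

  natural-nonZero : ∀ k → ℚ.NonZero (suc k × 1ℚ)
  natural-nonZero k = ℚ.pos⇒nonZero (suc k × 1ℚ) {{ℚ.pos+nonNeg⇒pos 1ℚ (k × 1ℚ) {{natural-nonNeg k}}}}

  reciprocal : ℕ → ℚ
  reciprocal k = ℚ.1/_ (suc k × 1ℚ) {{natural-nonZero k}}

  ×-* : ∀ k x → k × x ≡ (k × 1ℚ) ℚ.* x
  ×-* zero x = sym (ℚ.*-zeroˡ x)
  ×-* (suc k) x = trans (cong₂ ℚ._+_ (sym (ℚ.*-identityˡ x)) (×-* k x)) (sym (ℚ.*-distribʳ-+ x 1ℚ (k × 1ℚ)))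

  Filℚ : ℕ → ℚ → Set
  Filℚ zero x = ⊤
  Filℚ (suc j) x = x ≡ 0ℚ

  iter-zero : ∀ j → iter ℚ.-_ j 0ℚ ≡ 0ℚ
  iter-zero zero = refl
  iter-zero (suc j) = cong ℚ.-_ (iter-zero j)

  rationals : SuperRing
  rationals = record
    { Carrier = ℚ ; _+_ = ℚ._+_ ; _*_ = ℚ._*_ ; -_ = ℚ.-_ ; 0# = 0ℚ ; 1# = 1ℚ
    ; isRing = CommutativeRing.isRing ℚ.+-*-commutativeRing
    ; σ = λ x → x ; ρ = λ x → x
    ; σ-+ = λ _ _ → refl ; σ-* = λ _ _ → refl ; σ-1 = refl ; σ-σ = λ _ → refl
    ; ρ-+ = λ _ _ → refl ; ρ-* = λ _ _ → refl ; ρ-1 = refl ; ρ-ρ = λ _ → refl ; σ-ρ = λ _ → refl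
    ; even-comm = λ {x} y _ → ℚ.*-comm x y
    ; odd-comm = λ {x} y _ → ℚ.*-comm x y
    ; inv = reciprocal
    ; inv-cen = λ k y → ℚ.*-comm (reciprocal k) y
    ; inv-law = λ k x → trans (cong (reciprocal k ℚ.*_) (×-* (suc k) x)) (trans (sym (ℚ.*-assoc (reciprocal k) (suc k × 1ℚ) x))
        (trans (cong (ℚ._* x) (ℚ.*-inverseˡ (suc k × 1ℚ) {{natural-nonZero k}})) (ℚ.*-identityˡ x)))
    ; Fil = Filℚ
    ; fil-all = λ _ → tt
    ; fil-zero = λ { zero → tt ; (suc j) → refl }
    ; fil-+ = λ { zero _ _ → tt ; (suc j) h h′ → trans (cong₂ ℚ._+_ h h′) (ℚ.+-identityˡ 0ℚ) }
    ; fil-neg = λ { zero _ → tt ; (suc j) h → cong ℚ.-_ h }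
    ; fil-* = λ { zero zero _ _ → tt ; zero (suc j) {x} _ h → trans (cong (x ℚ.*_) h) (ℚ.*-zeroʳ x)
                ; (suc i) j {y = y} h _ → trans (cong (ℚ._* y) h) (ℚ.*-zeroˡ y) }
    ; fil-pred = λ { zero _ → tt ; (suc j) h → h }
    ; fil-σ = λ _ h → h ; fil-ρ = λ _ h → h
    ; fil-parity = λ { zero {x} _ → ℚ.+-inverseʳ x
                     ; (suc j) h → trans (cong (λ y → y ℚ.+ ℚ.- iter ℚ.-_ (suc j) y) h) (cong (λ y → 0ℚ ℚ.+ ℚ.- y) (iter-zero (suc j))) }
    }

open Base public using (rationals)

-- The generators are attached to the edges: even and of filtration degree one for the edges marked true.
Λ : ∀ k → (Fin k → Bool) → SuperRing
Λ zero tp = rationals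
Λ (suc k) tp = Extension.extension (Λ k (tp ∘ suc)) (not (tp zero)) (tp zero)

module Λ {k} (tp : Fin k → Bool) = SuperRing (Λ k tp)

gen : ∀ k (tp : Fin k → Bool) → Fin k → Λ.Carrier tp
gen (suc k) tp zero = Λ.0# (tp ∘ suc) , Λ.1# (tp ∘ suc)
gen (suc k) tp (suc j) = gen k (tp ∘ suc) j , Λ.0# (tp ∘ suc)

marked : ∀ k → (Fin k → Bool) → ℕ
marked zero tp = 0
marked (suc k) tp = (if tp zero then 1 else 0) ℕ.+ marked k (tp ∘ suc)

unmarked : ∀ k → (Fin k → Bool) → ℕ
unmarked zero tp = 0
unmarked (suc k) tp = (if tp zero then 0 else 1) ℕ.+ unmarked k (tp ∘ suc)

-- Only marked generators raise the order, each by one, and their squares are zero; so the order is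
-- bounded by their number.
nil-Λ : ∀ k tp j → marked k tp ℕ.< j → ∀ {x} → Λ.Fil tp j x → x ≡ Λ.0# tp
nil-Λ zero tp (suc j) l h = h
nil-Λ (suc k) tp j l {x , y} (h , h′) with tp zero
... | false = cong₂ _,_ (nil-Λ k (tp ∘ suc) j l h) (nil-Λ k (tp ∘ suc) j l h′)
nil-Λ (suc k) tp (suc j) (s≤s l) {x , y} (h , h′) | true =
  cong₂ _,_ (nil-Λ k (tp ∘ suc) (suc j) (ℕ.m≤n⇒m≤1+n l) h) (nil-Λ k (tp ∘ suc) j l h′)

gen-σ : ∀ k tp j → Λ.σ tp (gen k tp j) ≡ (if tp j then gen k tp j else Λ.-_ tp (gen k tp j))
gen-σ (suc k) tp zero with tp zero
... | true = cong₂ _,_ (Λ.σ-0 (tp ∘ suc)) (Λ.σ-1 (tp ∘ suc))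
... | false = cong₂ _,_ (trans (Λ.σ-0 (tp ∘ suc)) (sym (Λ.-0#≈0# (tp ∘ suc)))) (cong (Λ.-_ (tp ∘ suc)) (Λ.σ-1 (tp ∘ suc)))
gen-σ (suc k) tp (suc j) with tp (suc j) | gen-σ k (tp ∘ suc) j
... | true | h = cong₂ _,_ h (second (tp zero))
  where
  second : ∀ c → Extension.sg (Λ k (tp ∘ suc)) (not (tp zero)) (tp zero) (not c) (Λ.σ (tp ∘ suc) (Λ.0# (tp ∘ suc))) ≡ Λ.0# (tp ∘ suc)
  second true = Λ.σ-0 (tp ∘ suc)
  second false = trans (cong (Λ.-_ (tp ∘ suc)) (Λ.σ-0 (tp ∘ suc))) (Λ.-0#≈0# (tp ∘ suc))
... | false | h = cong₂ _,_ h (second (tp zero))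
  where
  second : ∀ c → Extension.sg (Λ k (tp ∘ suc)) (not (tp zero)) (tp zero) (not c) (Λ.σ (tp ∘ suc) (Λ.0# (tp ∘ suc))) ≡ Λ.-_ (tp ∘ suc) (Λ.0# (tp ∘ suc))
  second true = trans (Λ.σ-0 (tp ∘ suc)) (sym (Λ.-0#≈0# (tp ∘ suc)))
  second false = cong (Λ.-_ (tp ∘ suc)) (Λ.σ-0 (tp ∘ suc))

gen-ρ : ∀ k tp j → Λ.ρ tp (gen k tp j) ≡ (if tp j then Λ.-_ tp (gen k tp j) else gen k tp j)
gen-ρ (suc k) tp zero with tp zero
... | false = cong₂ _,_ (Λ.ρ-0 (tp ∘ suc)) (Λ.ρ-1 (tp ∘ suc))
... | true = cong₂ _,_ (trans (Λ.ρ-0 (tp ∘ suc)) (sym (Λ.-0#≈0# (tp ∘ suc)))) (cong (Λ.-_ (tp ∘ suc)) (Λ.ρ-1 (tp ∘ suc)))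
gen-ρ (suc k) tp (suc j) with tp (suc j) | gen-ρ k (tp ∘ suc) j
... | false | h = cong₂ _,_ h (second (tp zero))
  where
  second : ∀ c → Extension.sg (Λ k (tp ∘ suc)) (not (tp zero)) (tp zero) c (Λ.ρ (tp ∘ suc) (Λ.0# (tp ∘ suc))) ≡ Λ.0# (tp ∘ suc)
  second false = Λ.ρ-0 (tp ∘ suc)
  second true = trans (cong (Λ.-_ (tp ∘ suc)) (Λ.ρ-0 (tp ∘ suc))) (Λ.-0#≈0# (tp ∘ suc))
... | true | h = cong₂ _,_ h (second (tp zero))
  where
  second : ∀ c → Extension.sg (Λ k (tp ∘ suc)) (not (tp zero)) (tp zero) c (Λ.ρ (tp ∘ suc) (Λ.0# (tp ∘ suc))) ≡ Λ.-_ (tp ∘ suc) (Λ.0# (tp ∘ suc))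
  second false = trans (Λ.ρ-0 (tp ∘ suc)) (sym (Λ.-0#≈0# (tp ∘ suc)))
  second true = cong (Λ.-_ (tp ∘ suc)) (Λ.ρ-0 (tp ∘ suc))

gen-fil : ∀ k tp j → tp j ≡ true → Λ.Fil tp 1 (gen k tp j)
gen-fil (suc k) tp zero eq with tp zero
... | true = Λ.fil-zero (tp ∘ suc) 1 , Λ.fil-all (tp ∘ suc) _
gen-fil (suc k) tp (suc j) eq = gen-fil k (tp ∘ suc) j eq , Λ.fil-zero (tp ∘ suc) _

record Hom (S T : SuperRing) : Set where
  private
    module S = SuperRing S
    module T = SuperRing T
  field
    φ : S.Carrier → T.Carrier
    φ-+ : ∀ x y → φ (x S.+ y) ≡ φ x T.+ φ y
    φ-* : ∀ x y → φ (x S.* y) ≡ φ x T.* φ y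
    φ-neg : ∀ x → φ (S.- x) ≡ T.- φ x
    φ-0 : φ S.0# ≡ T.0#
    φ-1 : φ S.1# ≡ T.1#
    φ-σ : ∀ x → φ (S.σ x) ≡ T.σ (φ x)
    φ-ρ : ∀ x → φ (S.ρ x) ≡ T.ρ (φ x)

  φ-∑ : ∀ {n} (f : Fin n → S.Carrier) → φ (S.∑ f) ≡ T.∑ (λ i → φ (f i))
  φ-∑ {zero} f = trans (cong φ (fold-zero S._+_ S.0# f)) (trans φ-0 (sym (fold-zero T._+_ T.0# _)))
  φ-∑ {suc n} f = trans (cong φ (fold-suc S._+_ S.0# f)) (trans (φ-+ _ _)
    (trans (cong₂ T._+_ refl (φ-∑ (λ i → f (suc i)))) (sym (fold-suc T._+_ T.0# _))))

  φ-δ : ∀ {n} (i j : Fin n) → φ (S.δ i j) ≡ T.δ i j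
  φ-δ zero zero = φ-1
  φ-δ zero (suc _) = φ-0
  φ-δ (suc _) zero = φ-0
  φ-δ (suc i) (suc j) = φ-δ i j

  module _ (n : ℕ) where
    private
      module FS = Filtered S n
      module FT = Filtered T n

    φ-⊗ : ∀ {M N M′ N′} → (∀ i j → φ (M i j) ≡ M′ i j) → (∀ i j → φ (N i j) ≡ N′ i j) →
      ∀ i j → φ ((M FS.⊗ N) i j) ≡ (M′ FT.⊗ N′) i j
    φ-⊗ h h′ i j = trans (φ-∑ _) (Sums.∑-cong T.ring (λ x → trans (φ-* _ _) (cong₂ T._*_ (h i x) (h′ x j))))

    φ-geometric : ∀ {b b′} → (∀ i j → φ (b i j) ≡ b′ i j) → ∀ i j → φ (FS.geometric b i j) ≡ FT.geometric b′ i j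
    φ-geometric h i j = trans (φ-+ _ _) (cong₂ T._+_ (trans (φ-+ _ _) (cong₂ T._+_ (trans (φ-+ _ _) (cong₂ T._+_ (φ-δ i j) (h i j))) (φ-⊗ h h i j)))
      (φ-⊗ h (φ-⊗ h h) i j))

    φ-walks : ∀ {X b X′ b′} → (∀ i j → φ (X i j) ≡ X′ i j) → (∀ i j → φ (b i j) ≡ b′ i j) →
      ∀ k i j → φ (FS.walks X b k i j) ≡ FT.walks X′ b′ k i j
    φ-walks hX hb zero = φ-geometric hb
    φ-walks hX hb (suc k) = φ-⊗ (φ-geometric hb) (φ-⊗ hX (λ i j → trans (φ-ρ _) (cong T.ρ (φ-walks hX hb k i j))))

extend : ∀ {S T} → Hom S T → ∀ odd shift → Hom (Extension.extension S odd shift) (Extension.extension T odd shift)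
extend {S} {T} h odd shift = record
  { φ = λ (x , y) → φ x , φ y
  ; φ-+ = λ (x , y) (x′ , y′) → cong₂ _,_ (φ-+ x x′) (φ-+ y y′)
  ; φ-* = λ (x , y) (x′ , y′) → cong₂ _,_ (φ-* x x′) (trans (φ-+ _ _) (cong₂ T._+_ (trans (φ-* _ _) (cong (T._* φ y′) (tw-φ odd x))) (φ-* y x′)))
  ; φ-neg = λ (x , y) → cong₂ _,_ (φ-neg x) (φ-neg y)
  ; φ-0 = cong₂ _,_ φ-0 φ-0
  ; φ-1 = cong₂ _,_ φ-1 φ-0
  ; φ-σ = λ (x , y) → cong₂ _,_ (φ-σ x) (trans (sg-φ odd _) (cong (ET.sg odd) (φ-σ y)))
  ; φ-ρ = λ (x , y) → cong₂ _,_ (φ-ρ x) (trans (sg-φ shift _) (cong (ET.sg shift) (φ-ρ y)))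
  }
  where
  open Hom h
  module T = SuperRing T
  module ES = Extension S odd shift
  module ET = Extension T odd shift
  tw-φ : ∀ t x → φ (ES.tw t x) ≡ ET.tw t (φ x)
  tw-φ true x = φ-σ x
  tw-φ false x = refl
  sg-φ : ∀ s x → φ (ES.sg s x) ≡ ET.sg s (φ x)
  sg-φ true x = φ-neg x
  sg-φ false x = refl

restrict₀ : ∀ S odd shift → Hom (Extension.extension S odd shift) S
restrict₀ S odd shift = record
  { φ = proj₁ ; φ-+ = λ _ _ → refl ; φ-* = λ _ _ → refl ; φ-neg = λ _ → refl ; φ-0 = refl ; φ-1 = refl
  ; φ-σ = λ _ → refl ; φ-ρ = λ _ → refl }

-- Sets generator `j` to zero. Once edge `j` has been used, the generator cannot occur again in the
-- top monomial, so the rest of the trail may be read in this quotient.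
forget : ∀ k (tp : Fin (suc k) → Bool) j → Hom (Λ (suc k) tp) (Λ k (tp ∘ punchIn j))
forget k tp zero = restrict₀ (Λ k (tp ∘ suc)) (not (tp zero)) (tp zero)
forget (suc k) tp (suc j) = extend {Λ (suc k) (tp ∘ suc)} {Λ k (tp ∘ suc ∘ punchIn j)} (forget k (tp ∘ suc) j) (not (tp zero)) (tp zero)

π : ∀ {k} (tp : Fin (suc k) → Bool) j → Λ.Carrier tp → Λ.Carrier (tp ∘ punchIn j)
π tp j = Hom.φ (forget _ tp j)

π-gen-same : ∀ k tp j → π tp j (gen (suc k) tp j) ≡ Λ.0# (tp ∘ punchIn j)
π-gen-same k tp zero = refl
π-gen-same (suc k) tp (suc j) = cong₂ _,_ (π-gen-same k (tp ∘ suc) j) (Hom.φ-0 (forget k (tp ∘ suc) j))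

π-gen : ∀ k tp j i → π tp j (gen (suc k) tp (punchIn j i)) ≡ gen k (tp ∘ punchIn j) i
π-gen k tp zero i = refl
π-gen (suc k) tp (suc j) zero = cong₂ _,_ (Hom.φ-0 (forget k (tp ∘ suc) j)) (Hom.φ-1 (forget k (tp ∘ suc) j))
π-gen (suc k) tp (suc j) (suc i) = cong₂ _,_ (π-gen k (tp ∘ suc) j i) (Hom.φ-0 (forget k (tp ∘ suc) j))

-- The coefficient of the product of all generators, with the sign by which it must be corrected for
-- the marked generators to anticommute with the others.
top : ∀ k (tp : Fin k → Bool) → Λ.Carrier tp → ℚ
top zero tp x = x
top (suc k) tp (x , y) = top k (tp ∘ suc) (if tp zero then y else Λ.ρ (tp ∘ suc) y)

top-+ : ∀ k tp x y → top k tp (Λ._+_ tp x y) ≡ top k tp x ℚ.+ top k tp y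
top-+ zero tp x y = refl
top-+ (suc k) tp (x , y) (x′ , y′) with tp zero
... | true = top-+ k (tp ∘ suc) y y′
... | false = trans (cong (top k (tp ∘ suc)) (Λ.ρ-+ (tp ∘ suc) y y′)) (top-+ k (tp ∘ suc) (Λ.ρ (tp ∘ suc) y) (Λ.ρ (tp ∘ suc) y′))

top-0 : ∀ k tp → top k tp (Λ.0# tp) ≡ 0ℚ
top-0 zero tp = refl
top-0 (suc k) tp with tp zero
... | true = top-0 k (tp ∘ suc)
... | false = trans (cong (top k (tp ∘ suc)) (Λ.ρ-0 (tp ∘ suc))) (top-0 k (tp ∘ suc))

top-neg : ∀ k tp x → top k tp (Λ.-_ tp x) ≡ ℚ.- top k tp x
top-neg zero tp x = refl
top-neg (suc k) tp (x , y) with tp zero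
... | true = top-neg k (tp ∘ suc) y
... | false = trans (cong (top k (tp ∘ suc)) (Λ.ρ-neg (tp ∘ suc) y)) (top-neg k (tp ∘ suc) (Λ.ρ (tp ∘ suc) y))

unmarkedBefore : ∀ {k} → (Fin k → Bool) → Fin k → ℕ
unmarkedBefore tp zero = 0
unmarkedBefore tp (suc j) = (if tp zero then 0 else 1) ℕ.+ unmarkedBefore (tp ∘ suc) j

-- A marked generator commutes with the whole algebra; its signs come from the corrections by `ρ`
-- that `top` makes at the unmarked generators before it.
top-marked : ∀ k tp j → tp j ≡ true → ∀ x →
  top (suc k) tp (Λ._*_ tp (gen (suc k) tp j) x) ≡ iter ℚ.-_ (unmarkedBefore tp j) (top k (tp ∘ punchIn j) (π tp j x))
top-marked k tp zero eq (x , y) with tp zero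
... | true = cong (top k (tp ∘ suc)) (trans (cong₂ S._+_ (S.zeroˡ y) (S.*-identityˡ x)) (S.+-identityˡ x))
  where module S = Λ (tp ∘ suc)
top-marked (suc k) tp (suc j) eq (x , y) with tp zero
... | true = trans (cong (top (suc k) (tp ∘ suc)) (trans (cong (gen (suc k) (tp ∘ suc) j S.* y S.+_) (S.zeroˡ x)) (S.+-identityʳ _))) (top-marked k (tp ∘ suc) j eq y)
  where module S = Λ (tp ∘ suc)
... | false = begin
    top (suc k) tp′ (S.ρ (S.σ g S.* y S.+ S.0# S.* x)) ≡⟨ cong (top (suc k) tp′) move ⟩
    top (suc k) tp′ (S.- (g S.* S.ρ y)) ≡⟨ top-neg (suc k) tp′ (g S.* S.ρ y) ⟩
    ℚ.- top (suc k) tp′ (g S.* S.ρ y) ≡⟨ cong ℚ.-_ (top-marked k tp′ j eq (S.ρ y)) ⟩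
    ℚ.- iter ℚ.-_ (unmarkedBefore tp′ j) (top k (tp′ ∘ punchIn j) (π tp′ j (S.ρ y)))
      ≡⟨ cong (λ z → ℚ.- iter ℚ.-_ (unmarkedBefore tp′ j) (top k (tp′ ∘ punchIn j) z)) (Hom.φ-ρ (forget k tp′ j) y) ⟩
    ℚ.- iter ℚ.-_ (unmarkedBefore tp′ j) (top k (tp′ ∘ punchIn j) (Λ.ρ (tp′ ∘ punchIn j) (π tp′ j y))) ∎
  where
  open ≡.≡-Reasoning
  tp′ = tp ∘ suc
  module S = Λ tp′
  g = gen (suc k) tp′ j
  move : S.ρ (S.σ g S.* y S.+ S.0# S.* x) ≡ S.- (g S.* S.ρ y)
  move = trans (cong S.ρ (trans (cong₂ S._+_ (cong (S._* y) (trans (gen-σ (suc k) tp′ j) (cong (λ c → if c then g else S.- g) eq))) (S.zeroˡ x)) (S.+-identityʳ _)))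
    (trans (S.ρ-* g y) (trans (cong (S._* S.ρ y) (trans (gen-ρ (suc k) tp′ j) (cong (λ c → if c then S.- g else g) eq))) (sym (S.-‿distribˡ-* g (S.ρ y)))))

-- Every generator before `j` contributes a sign: the unmarked ones by anticommutation, the marked
-- ones through the `ρ` on the second factor, which is the `ρ` that `walks` inserts after each X.
top-unmarked : ∀ k tp j → tp j ≡ false → ∀ x →
  top (suc k) tp (Λ._*_ tp (gen (suc k) tp j) (Λ.ρ tp x)) ≡ iter ℚ.-_ (toℕ j) (top k (tp ∘ punchIn j) (π tp j x))
top-unmarked k tp zero eq (x , y) with tp zero
... | false = cong (top k (tp ∘ suc)) (trans (cong S.ρ (trans (cong₂ S._+_ (trans (cong (S._* S.ρ y) S.σ-0) (S.zeroˡ _)) (S.*-identityˡ _)) (S.+-identityˡ _))) (S.ρ-ρ x))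
  where module S = Λ (tp ∘ suc)
top-unmarked (suc k) tp (suc j) eq (x , y) with tp zero
... | true = begin
    top (suc k) tp′ (g S.* (S.- S.ρ y) S.+ S.0# S.* S.ρ x)
      ≡⟨ cong (top (suc k) tp′) (trans (cong₂ S._+_ (sym (S.-‿distribʳ-* g (S.ρ y))) (S.zeroˡ _)) (S.+-identityʳ _)) ⟩
    top (suc k) tp′ (S.- (g S.* S.ρ y)) ≡⟨ top-neg (suc k) tp′ (g S.* S.ρ y) ⟩
    ℚ.- top (suc k) tp′ (g S.* S.ρ y) ≡⟨ cong ℚ.-_ (top-unmarked k tp′ j eq y) ⟩
    ℚ.- iter ℚ.-_ (toℕ j) (top k (tp′ ∘ punchIn j) (π tp′ j y)) ∎
  where
  open ≡.≡-Reasoning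
  tp′ = tp ∘ suc
  module S = Λ tp′
  g = gen (suc k) tp′ j
... | false = begin
    top (suc k) tp′ (S.ρ (S.σ g S.* S.ρ y S.+ S.0# S.* S.ρ x)) ≡⟨ cong (top (suc k) tp′) move ⟩
    top (suc k) tp′ (S.- (g S.* S.ρ (S.ρ y))) ≡⟨ top-neg (suc k) tp′ (g S.* S.ρ (S.ρ y)) ⟩
    ℚ.- top (suc k) tp′ (g S.* S.ρ (S.ρ y)) ≡⟨ cong ℚ.-_ (top-unmarked k tp′ j eq (S.ρ y)) ⟩
    ℚ.- iter ℚ.-_ (toℕ j) (top k (tp′ ∘ punchIn j) (π tp′ j (S.ρ y)))
      ≡⟨ cong (λ z → ℚ.- iter ℚ.-_ (toℕ j) (top k (tp′ ∘ punchIn j) z)) (Hom.φ-ρ (forget k tp′ j) y) ⟩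
    ℚ.- iter ℚ.-_ (toℕ j) (top k (tp′ ∘ punchIn j) (Λ.ρ (tp′ ∘ punchIn j) (π tp′ j y))) ∎
  where
  open ≡.≡-Reasoning
  tp′ = tp ∘ suc
  module S = Λ tp′
  g = gen (suc k) tp′ j
  move : S.ρ (S.σ g S.* S.ρ y S.+ S.0# S.* S.ρ x) ≡ S.- (g S.* S.ρ (S.ρ y))
  move = trans (cong S.ρ (trans (cong₂ S._+_ (trans (cong (S._* S.ρ y) (trans (gen-σ (suc k) tp′ j) (cong (λ c → if c then g else S.- g) eq)))
      (sym (S.-‿distribˡ-* g (S.ρ y)))) (S.zeroˡ _)) (S.+-identityʳ _)))
    (trans (S.ρ-neg _) (cong S.-_ (trans (S.ρ-* g (S.ρ y)) (cong (S._* S.ρ (S.ρ y)) (trans (gen-ρ (suc k) tp′ j) (cong (λ c → if c then S.- g else g) eq))))))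

-- The sign of moving edge `j` to the front: a marked edge anticommutes with unmarked ones only, an
-- unmarked edge with all.
exponent : ∀ {k} → (Fin k → Bool) → Fin k → ℕ
exponent tp j = if tp j then unmarkedBefore tp j else toℕ j

-- Trails as top coefficients of walks

-- S(G,B) for the roots v and t, by recursion on the first edge of a trail; tp marks the edges of B.
trails : {A : Set} → (A → A → A) → (A → A) → A → A → ∀ {n} k → (Fin k → Bool) → (src tgt : Fin k → Fin n) → Fin n → Fin n → A
trails _+_ -_ 0# 1# zero tp src tgt t v = if does (v Fin.≟ t) then 1# else 0#
trails _+_ -_ 0# 1# (suc k) tp src tgt t v = fold _+_ 0# (λ j → if does (src j Fin.≟ v)
  then iter -_ (exponent tp j) (trails _+_ -_ 0# 1# k (tp ∘ punchIn j) (src ∘ punchIn j) (tgt ∘ punchIn j) t (tgt j))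
  else 0#)

module _ (S : SuperRing) where
  open SuperRing S

  δ-if : ∀ {m} (i j : Fin m) → δ i j ≡ (if does (i Fin.≟ j) then 1# else 0#)
  δ-if zero zero = refl
  δ-if zero (suc j) = refl
  δ-if (suc i) zero = refl
  δ-if (suc i) (suc j) = δ-if i j

  δ-* : ∀ {m} (i j : Fin m) x → δ i j * x ≡ (if does (i Fin.≟ j) then x else 0#)
  δ-* i j x = trans (cong (_* x) (δ-if i j)) (go (does (i Fin.≟ j)))
    where
    go : ∀ c → (if c then 1# else 0#) * x ≡ (if c then x else 0#)
    go true = *-identityˡ x
    go false = zeroˡ x

  ∑-remove : ∀ {k} (j : Fin (suc k)) (f : Fin (suc k) → Carrier) → ∑ f ≡ f j + ∑ (f ∘ punchIn j)
  ∑-remove j f = trans (Sums.∑≈sum ring f) (trans (Σ.sum-remove {i = j} f) (cong (f j +_) (sym (Sums.∑≈sum ring _))))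
    where import Algebra.Properties.Semiring.Sum (Ring.semiring ring) as Σ

unmarked-remove : ∀ k tp j → unmarked (suc k) tp ≡ (if tp j then 0 else 1) ℕ.+ unmarked k (tp ∘ punchIn j)
unmarked-remove k tp zero = refl
unmarked-remove (suc k) tp (suc j) = trans (cong (a ℕ.+_) (unmarked-remove k (tp ∘ suc) j))
  (trans (sym (ℕ.+-assoc a e r)) (trans (cong (ℕ._+ r) (ℕ.+-comm a e)) (ℕ.+-assoc e a r)))
  where
  a = if tp zero then 0 else 1
  e = if tp (suc j) then 0 else 1
  r = unmarked k (tp ∘ suc ∘ punchIn j)

marked-remove : ∀ k tp j → marked k (tp ∘ punchIn j) ℕ.≤ marked (suc k) tp
marked-remove k tp zero = ℕ.m≤n+m _ (if tp zero then 1 else 0)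
marked-remove (suc k) tp (suc j) = ℕ.+-monoʳ-≤ (if tp zero then 1 else 0) (marked-remove k (tp ∘ suc) j)

module Adjacency (n : ℕ) where

  oddPart evenPart : ∀ k (tp : Fin k → Bool) → Fin k → Λ.Carrier tp
  oddPart k tp j = if tp j then Λ.0# tp else gen k tp j
  evenPart k tp j = if tp j then gen k tp j else Λ.0# tp

  module _ {k} (tp : Fin k → Bool) (src tgt : Fin k → Fin n) where
    open Filtered (Λ k tp) n

    adjacency : (Fin k → Carrier) → Mat
    adjacency c u w = ∑ (λ j → δ (src j) u * (δ (tgt j) w * c j))

    adjacency-⊗ : ∀ c M v t → (adjacency c ⊗ M) v t ≡ ∑ (λ j → δ (src j) v * (c j * M (tgt j) t))
    adjacency-⊗ c M v t = begin
      ∑ (λ w → ∑ (λ j → δ (src j) v * (δ (tgt j) w * c j)) * M w t) ≡⟨ ∑-cong (λ w → *-distribʳ-∑ (M w t) _) ⟩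
      ∑ (λ w → ∑ (λ j → δ (src j) v * (δ (tgt j) w * c j) * M w t)) ≡⟨ ∑-comm _ ⟩
      ∑ (λ j → ∑ (λ w → δ (src j) v * (δ (tgt j) w * c j) * M w t))
        ≡⟨ ∑-cong (λ j → trans (∑-cong (λ w → trans (*-assoc _ _ _) (cong (δ (src j) v *_) (*-assoc _ _ _)))) (sym (*-distribˡ-∑ _ _))) ⟩
      ∑ (λ j → δ (src j) v * ∑ (λ w → δ (tgt j) w * (c j * M w t))) ≡⟨ ∑-cong (λ j → cong (δ (src j) v *_) (δ-∑ˡ (tgt j) _)) ⟩
      ∑ (λ j → δ (src j) v * (c j * M (tgt j) t)) ∎
      where
      open ≡.≡-Reasoning
      open Sums ring using (∑-cong; *-distribʳ-∑; *-distribˡ-∑; ∑-comm)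

    Xᵍ bᵍ : Mat
    Xᵍ = adjacency (oddPart k tp)
    bᵍ = adjacency (evenPart k tp)

    private
      fix-δ : (φ : Carrier → Carrier) → φ 0# ≡ 0# → φ 1# ≡ 1# → ∀ {m} (i j : Fin m) → φ (δ i j) ≡ δ i j
      fix-δ φ φ0 φ1 zero zero = φ1
      fix-δ φ φ0 φ1 zero (suc _) = φ0
      fix-δ φ φ0 φ1 (suc _) zero = φ0
      fix-δ φ φ0 φ1 (suc i) (suc j) = fix-δ φ φ0 φ1 i j

      map-entry : (φ : Carrier → Carrier) → (∀ {m} (f : Fin m → Carrier) → φ (∑ f) ≡ ∑ (λ i → φ (f i))) →
        (∀ x y → φ (x * y) ≡ φ x * φ y) → φ 0# ≡ 0# → φ 1# ≡ 1# → ∀ c u w → φ (adjacency c u w) ≡ adjacency (φ ∘ c) u w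
      map-entry φ φ∑ φ* φ0 φ1 c u w = trans (φ∑ _) (Sums.∑-cong ring (λ j → trans (φ* _ _)
        (cong₂ _*_ (fix-δ φ φ0 φ1 (src j) u) (trans (φ* _ _) (cong (_* φ (c j)) (fix-δ φ φ0 φ1 (tgt j) w))))))

      neg-entry : ∀ c c′ → (∀ j → c′ j ≡ - c j) → ∀ u w → adjacency c′ u w ≡ - adjacency c u w
      neg-entry c c′ h u w = trans (Sums.∑-cong ring (λ j → trans (cong (λ y → δ (src j) u * (δ (tgt j) w * y)) (h j))
        (NonCommSolver.solve ring 3 (λ x y z → x ⊠ (y ⊠ ⊟ z) ⊜ ⊟ (x ⊠ (y ⊠ z))) refl _ _ _))) (Sums.∑-neg ring _)

      same-entry : ∀ c c′ → (∀ j → c′ j ≡ c j) → ∀ u w → adjacency c′ u w ≡ adjacency c u w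
      same-entry c c′ h u w = Sums.∑-cong ring (λ j → cong (λ y → δ (src j) u * (δ (tgt j) w * y)) (h j))

      oddPart-σ : ∀ j → σ (oddPart k tp j) ≡ - oddPart k tp j
      oddPart-σ j with tp j | gen-σ k tp j
      ... | true | _ = trans σ-0 (sym -0#≈0#)
      ... | false | h = h

      oddPart-ρ : ∀ j → ρ (oddPart k tp j) ≡ oddPart k tp j
      oddPart-ρ j with tp j | gen-ρ k tp j
      ... | true | _ = ρ-0
      ... | false | h = h

      evenPart-σ : ∀ j → σ (evenPart k tp j) ≡ evenPart k tp j
      evenPart-σ j with tp j | gen-σ k tp j
      ... | true | h = h
      ... | false | _ = σ-0

      evenPart-ρ : ∀ j → ρ (evenPart k tp j) ≡ - evenPart k tp j
      evenPart-ρ j with tp j | gen-ρ k tp j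
      ... | true | h = h
      ... | false | _ = trans ρ-0 (sym -0#≈0#)

      evenPart-fil : ∀ j → Fil 1 (evenPart k tp j)
      evenPart-fil j with tp j | gen-fil k tp j
      ... | true | h = h refl
      ... | false | _ = fil-zero 1

    graded : Graded Xᵍ bᵍ
    graded = record
      { X-odd = λ u w → trans (map-entry σ σ-∑ σ-* σ-0 σ-1 (oddPart k tp) u w) (neg-entry (oddPart k tp) _ oddPart-σ u w)
      ; X-ρ = λ u w → trans (map-entry ρ ρ-∑ ρ-* ρ-0 ρ-1 (oddPart k tp) u w) (same-entry (oddPart k tp) _ oddPart-ρ u w)
      ; b-even = λ u w → trans (map-entry σ σ-∑ σ-* σ-0 σ-1 (evenPart k tp) u w) (same-entry (evenPart k tp) _ evenPart-σ u w)
      ; b-ρ = λ u w → trans (map-entry ρ ρ-∑ ρ-* ρ-0 ρ-1 (evenPart k tp) u w) (neg-entry (evenPart k tp) _ evenPart-ρ u w)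
      ; b-fil = λ u w → fil-∑ 1 (λ j → fil-*ˡ 1 _ (fil-*ˡ 1 _ (evenPart-fil j))) }

  module _ {k} (tp : Fin (suc k) → Bool) (src tgt : Fin (suc k) → Fin n) (j : Fin (suc k)) where
    private
      module S = Λ tp
      tp′ = tp ∘ punchIn j
      module T = Λ tp′
      open Hom (forget k tp j)

    π-adjacency : ∀ c c′ → φ (c j) ≡ T.0# → (∀ i → φ (c (punchIn j i)) ≡ c′ i) →
      ∀ u w → φ (adjacency tp src tgt c u w) ≡ adjacency tp′ (src ∘ punchIn j) (tgt ∘ punchIn j) c′ u w
    π-adjacency c c′ h₀ h u w = begin
      φ (adjacency tp src tgt c u w) ≡⟨ φ-∑ _ ⟩
      T.∑ (λ i → φ (S.δ (src i) u S.* (S.δ (tgt i) w S.* c i)))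
        ≡⟨ Sums.∑-cong T.ring (λ i → trans (φ-* _ _) (cong₂ T._*_ (φ-δ (src i) u) (trans (φ-* _ _) (cong (T._* φ (c i)) (φ-δ (tgt i) w))))) ⟩
      T.∑ (λ i → f i (φ (c i))) ≡⟨ ∑-remove (Λ k tp′) j (λ i → f i (φ (c i))) ⟩
      f j (φ (c j)) T.+ T.∑ (λ i → f (punchIn j i) (φ (c (punchIn j i))))
        ≡⟨ cong₂ T._+_ (trans (cong (f j) h₀) (trans (cong (T.δ (src j) u T.*_) (T.zeroʳ _)) (T.zeroʳ _))) (Sums.∑-cong T.ring (λ i → cong (f (punchIn j i)) (h i))) ⟩
      T.0# T.+ T.∑ (λ i → f (punchIn j i) (c′ i)) ≡⟨ T.+-identityˡ _ ⟩
      T.∑ (λ i → f (punchIn j i) (c′ i)) ∎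
      where
      open ≡.≡-Reasoning
      f : Fin (suc k) → T.Carrier → T.Carrier
      f i y = T.δ (src i) u T.* (T.δ (tgt i) w T.* y)

    private
      if-φ : ∀ c {x y x′ y′} → φ x ≡ x′ → φ y ≡ y′ → φ (if c then x else y) ≡ (if c then x′ else y′)
      if-φ true h _ = h
      if-φ false _ h = h

      if-0 : ∀ c {x y} → φ x ≡ T.0# → φ y ≡ T.0# → φ (if c then x else y) ≡ T.0#
      if-0 true h _ = h
      if-0 false _ h = h

    -- The quotient by generator `j` is the algebra of the digraph with edge `j` deleted, so
    -- induction on the edges can continue there.
    π-walks : ∀ c v t → φ (Filtered.walks (Λ (suc k) tp) n (Xᵍ tp src tgt) (bᵍ tp src tgt) c v t)
      ≡ Filtered.walks (Λ k tp′) n (Xᵍ tp′ (src ∘ punchIn j) (tgt ∘ punchIn j)) (bᵍ tp′ (src ∘ punchIn j) (tgt ∘ punchIn j)) c v t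
    π-walks = φ-walks n
      (π-adjacency (oddPart (suc k) tp) (oddPart k tp′) (if-0 (tp j) φ-0 (π-gen-same k tp j)) (λ i → if-φ (tp (punchIn j i)) φ-0 (π-gen k tp j i)))
      (π-adjacency (evenPart (suc k) tp) (evenPart k tp′) (if-0 (tp j) (π-gen-same k tp j) φ-0) (λ i → if-φ (tp (punchIn j i)) (π-gen k tp j i) φ-0))

top-∑ : ∀ k tp {m} (f : Fin m → Λ.Carrier tp) → top k tp (Λ.∑ tp f) ≡ fold ℚ._+_ 0ℚ (λ i → top k tp (f i))
top-∑ k tp {zero} f = trans (cong (top k tp) (fold-zero _ _ f)) (trans (top-0 k tp) (sym (fold-zero _ _ _)))
top-∑ k tp {suc m} f = trans (cong (top k tp) (fold-suc _ _ f)) (trans (top-+ k tp _ _)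
  (trans (cong (top k tp (f zero) ℚ.+_) (top-∑ k tp (f ∘ suc))) (sym (fold-suc _ _ _))))

top-if : ∀ k tp c x → top k tp (if c then x else Λ.0# tp) ≡ (if c then top k tp x else 0ℚ)
top-if k tp true x = refl
top-if k tp false x = top-0 k tp

module Link (m : ℕ) where
  private
    n : ℕ
    n = 2 ℕ.+ m
  open Adjacency n

  walksᵍ : ∀ {k} (tp : Fin k → Bool) (src tgt : Fin k → Fin n) → ℕ → Filtered.Mat (Λ k tp) n
  walksᵍ {k} tp src tgt = Filtered.walks (Λ k tp) n (Xᵍ tp src tgt) (bᵍ tp src tgt)

  module V {k} (tp : Fin k → Bool) (src tgt : Fin k → Fin n) (few : marked k tp ℕ.≤ 3) =
    Vanishing (Λ k tp) (nil-Λ k tp 4 (s≤s few)) m (graded tp src tgt)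

  top-adjacency : ∀ {k} (tp : Fin k → Bool) src tgt c M v t → top k tp (Filtered._⊗_ (Λ k tp) n (adjacency tp src tgt c) M v t)
    ≡ fold ℚ._+_ 0ℚ (λ j → if does (src j Fin.≟ v) then top k tp (Λ._*_ tp (c j) (M (tgt j) t)) else 0ℚ)
  top-adjacency {k} tp src tgt c M v t = trans (cong (top k tp) (adjacency-⊗ tp src tgt c M v t)) (trans (top-∑ k tp _)
    (Sums.∑-cong (SuperRing.ring rationals) (λ j → trans (cong (top k tp) (δ-* (Λ k tp) (src j) v _)) (top-if k tp (does (src j Fin.≟ v)) _))))

  Tℚ : ∀ k → (Fin k → Bool) → (src tgt : Fin k → Fin n) → Fin n → Fin n → ℚ
  Tℚ = trails ℚ._+_ ℚ.-_ 0ℚ 1ℚ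

  -- The top monomial contains every edge once, hence exactly `unmarked k tp` letters X, which fixes
  -- the length of the walks. The recursion on the first letter extracts the first edge with the
  -- sign `exponent`.
  link : ∀ k tp src tgt → marked k tp ℕ.≤ 3 → ∀ t v → top k tp (walksᵍ tp src tgt (unmarked k tp) v t) ≡ Tℚ k tp src tgt t v
  link zero tp src tgt few t v = trans (V.G-zero-rec tp src tgt few v t) (trans (cong₂ ℚ._+_ (δ-if rationals v t)
    (trans (adjacency-⊗ tp src tgt _ (walksᵍ tp src tgt 0) v t) (fold-zero _ _ _))) (ℚ.+-identityʳ _))
  link (suc k) tp src tgt few t v = trans (split (unmarked (suc k) tp) refl) (trans (sym (Sums.∑-distrib-+ ringℚ odd-term even-term)) (Sums.∑-cong ringℚ merge))
    where
    ringℚ = SuperRing.ring rationals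
    module S = Λ tp
    module F = Filtered (Λ (suc k) tp) n
    c = unmarked (suc k) tp

    step : Fin (suc k) → ℚ
    step j = iter ℚ.-_ (exponent tp j) (Tℚ k (tp ∘ punchIn j) (src ∘ punchIn j) (tgt ∘ punchIn j) t (tgt j))

    even-term odd-term : Fin (suc k) → ℚ
    even-term j = if does (src j Fin.≟ v) then (if tp j then step j else 0ℚ) else 0ℚ
    odd-term j = if does (src j Fin.≟ v) then (if tp j then 0ℚ else step j) else 0ℚ

    merge : ∀ j → odd-term j ℚ.+ even-term j ≡ (if does (src j Fin.≟ v) then step j else 0ℚ)
    merge j with does (src j Fin.≟ v) | tp j
    ... | true | true = ℚ.+-identityˡ _
    ... | true | false = ℚ.+-identityʳ _
    ... | false | _ = refl

    few′ : ∀ j → marked k (tp ∘ punchIn j) ℕ.≤ 3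
    few′ j = ℕ.≤-trans (marked-remove k tp j) few

    if-cong : ∀ b {x y : ℚ} → x ≡ y → (if b then x else 0ℚ) ≡ (if b then y else 0ℚ)
    if-cong true h = h
    if-cong false h = refl

    even-case : ∀ j b → tp j ≡ b → top (suc k) tp ((if b then gen (suc k) tp j else S.0#) S.* walksᵍ tp src tgt c (tgt j) t) ≡ (if b then step j else 0ℚ)
    even-case j false eq = trans (cong (top (suc k) tp) (S.zeroˡ _)) (top-0 (suc k) tp)
    even-case j true eq = trans (top-marked k tp j eq _) (trans (cong (λ b → iter ℚ.-_ (if b then unmarkedBefore tp j else toℕ j) z) (sym eq))
      (cong (iter ℚ.-_ (exponent tp j)) (trans (cong (top k (tp ∘ punchIn j)) (trans (π-walks tp src tgt j c (tgt j) t) (cong (λ e → walksᵍ (tp ∘ punchIn j) (src ∘ punchIn j) (tgt ∘ punchIn j) e (tgt j) t) count)))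
        (link k (tp ∘ punchIn j) (src ∘ punchIn j) (tgt ∘ punchIn j) (few′ j) t (tgt j)))))
      where
      z = top k (tp ∘ punchIn j) (π tp j (walksᵍ tp src tgt c (tgt j) t))
      count : c ≡ unmarked k (tp ∘ punchIn j)
      count = trans (unmarked-remove k tp j) (cong (λ b → (if b then 0 else 1) ℕ.+ unmarked k (tp ∘ punchIn j)) eq)

    odd-case : ∀ c′ → c ≡ suc c′ → ∀ j b → tp j ≡ b →
      top (suc k) tp ((if b then S.0# else gen (suc k) tp j) S.* S.ρ (walksᵍ tp src tgt c′ (tgt j) t)) ≡ (if b then 0ℚ else step j)
    odd-case c′ ec j true eq = trans (cong (top (suc k) tp) (S.zeroˡ _)) (top-0 (suc k) tp)
    odd-case c′ ec j false eq = trans (top-unmarked k tp j eq _) (trans (cong (λ b → iter ℚ.-_ (if b then unmarkedBefore tp j else toℕ j) z) (sym eq))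
      (cong (iter ℚ.-_ (exponent tp j)) (trans (cong (top k (tp ∘ punchIn j)) (trans (π-walks tp src tgt j c′ (tgt j) t) (cong (λ e → walksᵍ (tp ∘ punchIn j) (src ∘ punchIn j) (tgt ∘ punchIn j) e (tgt j) t) count)))
        (link k (tp ∘ punchIn j) (src ∘ punchIn j) (tgt ∘ punchIn j) (few′ j) t (tgt j)))))
      where
      z = top k (tp ∘ punchIn j) (π tp j (walksᵍ tp src tgt c′ (tgt j) t))
      count : c′ ≡ unmarked k (tp ∘ punchIn j)
      count = ℕ.suc-injective (trans (sym ec) (trans (unmarked-remove k tp j) (cong (λ b → (if b then 0 else 1) ℕ.+ unmarked k (tp ∘ punchIn j)) eq)))

    even-sum : top (suc k) tp ((bᵍ tp src tgt F.⊗ walksᵍ tp src tgt c) v t) ≡ fold ℚ._+_ 0ℚ even-term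
    even-sum = trans (top-adjacency tp src tgt (evenPart (suc k) tp) (walksᵍ tp src tgt c) v t) (Sums.∑-cong ringℚ (λ j → if-cong (does (src j Fin.≟ v)) (even-case j (tp j) refl)))

    top-δ : ∀ (i j : Fin n) → top (suc k) tp (S.δ i j) ≡ 0ℚ
    top-δ i j = trans (cong (top (suc k) tp) (δ-if (Λ (suc k) tp) i j)) (trans (top-if (suc k) tp (does (i Fin.≟ j)) _) (go (does (i Fin.≟ j))))
      where
      top-1 : top (suc k) tp S.1# ≡ 0ℚ
      top-1 with tp zero
      ... | true = top-0 k (tp ∘ suc)
      ... | false = trans (cong (top k (tp ∘ suc)) (Λ.ρ-0 (tp ∘ suc))) (top-0 k (tp ∘ suc))
      go : ∀ b → (if b then top (suc k) tp S.1# else 0ℚ) ≡ 0ℚ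
      go true = top-1
      go false = refl

    split : ∀ e → c ≡ e → top (suc k) tp (walksᵍ tp src tgt c v t) ≡ fold ℚ._+_ 0ℚ odd-term ℚ.+ fold ℚ._+_ 0ℚ even-term
    -- Without unmarked edges the walk has no letter X. The identity matrix does not contribute,
    -- because at least one generator is left for the top monomial.
    split zero ec = trans (cong (top (suc k) tp) (≡.subst (λ e → walksᵍ tp src tgt e v t ≡ S.δ v t S.+ (bᵍ tp src tgt F.⊗ walksᵍ tp src tgt e) v t) (sym ec) (V.G-zero-rec tp src tgt few v t)))
      (trans (top-+ (suc k) tp (S.δ v t) ((bᵍ tp src tgt F.⊗ walksᵍ tp src tgt c) v t)) (cong₂ ℚ._+_ (trans (top-δ v t) (sym (Sums.∑-zero ringℚ none))) even-sum))
      where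
      none : ∀ j → odd-term j ≡ 0ℚ
      none j with tp j | unmarked-remove k tp j
      ... | false | eq = ⊥-elim (ℕ.0≢1+n (trans (sym ec) eq))
      ... | true | _ with does (src j Fin.≟ v)
      ...   | true = refl
      ...   | false = refl
    split (suc c′) ec = trans (cong (top (suc k) tp) (≡.subst (λ e → walksᵍ tp src tgt e v t ≡ (Xᵍ tp src tgt F.⊗ F.ρᴹ (walksᵍ tp src tgt c′)) v t S.+ (bᵍ tp src tgt F.⊗ walksᵍ tp src tgt e) v t) (sym ec) (V.G-suc-rec tp src tgt few c′ v t)))
      (trans (top-+ (suc k) tp ((Xᵍ tp src tgt F.⊗ F.ρᴹ (walksᵍ tp src tgt c′)) v t) ((bᵍ tp src tgt F.⊗ walksᵍ tp src tgt c) v t)) (cong₂ ℚ._+_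
        (trans (top-adjacency tp src tgt (oddPart (suc k) tp) (F.ρᴹ (walksᵍ tp src tgt c′)) v t) (Sums.∑-cong ringℚ (λ j → if-cong (does (src j Fin.≟ v)) (odd-case c′ ec j (tp j) refl)))) even-sum))

  trails-vanish : ∀ k tp src tgt → marked k tp ℕ.≤ 3 → (m ℕ.+ n) ℕ.+ (m ℕ.+ n) ℕ.≤ unmarked k tp → ∀ t v → Tℚ k tp src tgt t v ≡ 0ℚ
  trails-vanish k tp src tgt few many t v = trans (sym (link k tp src tgt few t v))
    (trans (cong (top k tp) (V.G-vanish tp src tgt few (unmarked k tp) many v t)) (top-0 k tp))

-- Counting inversions

marked-cong : ∀ k {p q : Fin k → Bool} → p ≗ q → marked k p ≡ marked k q
marked-cong zero h = refl
marked-cong (suc k) h = cong₂ ℕ._+_ (cong (λ b → if b then 1 else 0) (h zero)) (marked-cong k (h ∘ suc))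

marked-false : ∀ k {p : Fin k → Bool} → (∀ i → p i ≡ false) → marked k p ≡ 0
marked-false zero h = refl
marked-false (suc k) {p} h rewrite h zero = marked-false k (h ∘ suc)

marked-permute : ∀ k (p : Fin k → Bool) (π : Permutation′ k) → marked k (p ∘ (π ⟨$⟩ʳ_)) ≡ marked k p
marked-permute k p π = trans (marked-sum k _) (sym (trans (marked-sum k p) (Σ.sum-permute (λ i → if p i then 1 else 0) π)))
  where
  import Algebra.Properties.CommutativeMonoid.Sum ℕ.+-0-commutativeMonoid as Σ
  marked-sum : ∀ k (p : Fin k → Bool) → marked k p ≡ Σ.sum (λ i → if p i then 1 else 0)
  marked-sum zero p = refl
  marked-sum (suc k) p = cong₂ ℕ._+_ refl (marked-sum k (p ∘ suc))

marked-punchIn : ∀ k (p : Fin (suc k) → Bool) j → marked (suc k) p ≡ (if p j then 1 else 0) ℕ.+ marked k (p ∘ punchIn j)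
marked-punchIn k p zero = refl
marked-punchIn (suc k) p (suc j) = trans (cong (a ℕ.+_) (marked-punchIn k (p ∘ suc) j))
  (trans (sym (ℕ.+-assoc a e r)) (trans (cong (ℕ._+ r) (ℕ.+-comm a e)) (ℕ.+-assoc e a r)))
  where
  a = if p zero then 1 else 0
  e = if p (suc j) then 1 else 0
  r = marked k (p ∘ suc ∘ punchIn j)

marked-mono : ∀ k {p q : Fin k → Bool} → (∀ i → p i ≡ true → q i ≡ true) → marked k p ℕ.≤ marked k q
marked-mono zero h = z≤n
marked-mono (suc k) {p} {q} h with p zero | q zero | h zero
... | true | true | _ = s≤s (marked-mono k (h ∘ suc))
... | true | false | h₀ with () ← h₀ refl
... | false | true | _ = ℕ.m≤n⇒m≤1+n (marked-mono k (h ∘ suc))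
... | false | false | _ = marked-mono k (h ∘ suc)

marked-strict : ∀ k {p q : Fin k → Bool} → (∀ i → p i ≡ true → q i ≡ true) → ∀ j → p j ≡ false → q j ≡ true → marked k p ℕ.< marked k q
marked-strict (suc k) {p} {q} h zero pj qj rewrite pj | qj = s≤s (marked-mono k (h ∘ suc))
marked-strict (suc k) {p} {q} h (suc j) pj qj with p zero | q zero | h zero
... | true | true | _ = s≤s (marked-strict k (h ∘ suc) j pj qj)
... | true | false | h₀ with () ← h₀ refl
... | false | true | _ = ℕ.m≤n⇒m≤1+n (marked-strict k (h ∘ suc) j pj qj)
... | false | false | _ = marked-strict k (h ∘ suc) j pj qj

-- Counts the inversions among the positions in `mem` without forming the subword, so that it
-- recurses along all positions.
inv : ∀ k → (Fin k → Bool) → (Fin k → ℕ) → ℕ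
inv zero mem w = 0
inv (suc k) mem w = (if mem zero then marked k (λ i → mem (suc i) ∧ (w (suc i) <ᵇ w zero)) else 0) ℕ.+ inv k (mem ∘ suc) (w ∘ suc)

inv-cong : ∀ k (mem : Fin k → Bool) {w w′ : Fin k → ℕ} → (∀ i j → (w i <ᵇ w j) ≡ (w′ i <ᵇ w′ j)) → inv k mem w ≡ inv k mem w′
inv-cong zero mem h = refl
inv-cong (suc k) mem h = cong₂ ℕ._+_ (cong (λ x → if mem zero then x else 0) (marked-cong k (λ i → cong (mem (suc i) ∧_) (h (suc i) zero))))
  (inv-cong k (mem ∘ suc) (λ i j → h (suc i) (suc j)))

sumℕ : ∀ k → (Fin k → ℕ) → ℕ
sumℕ zero f = 0
sumℕ (suc k) f = f zero ℕ.+ sumℕ k (f ∘ suc)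

module _ {A : Set} {P : A → Set} (P? : Decidable P) where

  length-filter-tabulate : ∀ k (g : Fin k → A) → length (filter P? (tabulate g)) ≡ marked k (does ∘ P? ∘ g)
  length-filter-tabulate zero g = refl
  length-filter-tabulate (suc k) g with does (P? (g zero))
  ... | true = cong suc (length-filter-tabulate k (g ∘ suc))
  ... | false = length-filter-tabulate k (g ∘ suc)

  marked-lookup : ∀ k (g : Fin k → A) (q : A → Bool) →
    marked (length (filter P? (tabulate g))) (q ∘ lookup (filter P? (tabulate g))) ≡ marked k (λ i → does (P? (g i)) ∧ q (g i))
  marked-lookup zero g q = refl
  marked-lookup (suc k) g q with does (P? (g zero))
  ... | true = cong₂ ℕ._+_ refl (marked-lookup k (g ∘ suc) q)
  ... | false = marked-lookup k (g ∘ suc) q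

  inv-lookup : ∀ k (g : Fin k → A) (f : A → ℕ) →
    inv (length (filter P? (tabulate g))) (λ _ → true) (f ∘ lookup (filter P? (tabulate g))) ≡ inv k (does ∘ P? ∘ g) (f ∘ g)
  inv-lookup zero g f = refl
  inv-lookup (suc k) g f with does (P? (g zero))
  ... | true = cong₂ ℕ._+_ (marked-lookup k (g ∘ suc) (λ x → f x <ᵇ f (g zero))) (inv-lookup k (g ∘ suc) f)
  ... | false = inv-lookup k (g ∘ suc) f

length-filter-product : ∀ {A B : Set} {P : A ⨯ B → Set} (P? : Decidable P) k l (f : Fin k → A) (g : Fin l → B) →
  length (filter P? (cartesianProduct (tabulate f) (tabulate g))) ≡ sumℕ k (λ i → marked l (λ j → does (P? (f i , g j))))
length-filter-product P? zero l f g = refl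
length-filter-product P? (suc k) l f g = begin
  length (filter P? (map (f zero ,_) (tabulate g) ++ rest))
    ≡⟨ cong length (List.filter-++ P? (map (f zero ,_) (tabulate g)) rest) ⟩
  length (filter P? (map (f zero ,_) (tabulate g)) ++ filter P? rest)
    ≡⟨ List.length-++ (filter P? (map (f zero ,_) (tabulate g))) ⟩
  length (filter P? (map (f zero ,_) (tabulate g))) ℕ.+ length (filter P? rest)
    ≡⟨ cong₂ ℕ._+_ (trans (cong (λ xs → length (filter P? xs)) (List.map-tabulate g (f zero ,_))) (length-filter-tabulate P? l _))
         (length-filter-product P? k l (f ∘ suc) g) ⟩
  sumℕ (suc k) (λ i → marked l (λ j → does (P? (f i , g j)))) ∎
  where
  open ≡.≡-Reasoning
  rest = cartesianProduct (tabulate (f ∘ suc)) (tabulate g)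

inversions≡inv : ∀ {k} (w : Fin k → ℕ) → inversions w ≡ inv k (λ _ → true) w
inversions≡inv {k} w = trans (length-filter-product _ k k id id) (go k w)
  where
  go : ∀ k (w : Fin k → ℕ) → sumℕ k (λ i → marked k (λ j → does (i Fin.<? j) ∧ (w j <ᵇ w i))) ≡ inv k (λ _ → true) w
  go zero w = refl
  go (suc k) w = cong (marked k (λ j → w (suc j) <ᵇ w zero) ℕ.+_) (go k (w ∘ suc))

<ᵇ-true : ∀ {m n} → m ℕ.< n → (m <ᵇ n) ≡ true
<ᵇ-true {m} {n} l with m <ᵇ n | ℕ.<⇒<ᵇ l
... | true | _ = refl

<ᵇ-false : ∀ {m n} → n ℕ.≤ m → (m <ᵇ n) ≡ false
<ᵇ-false {m} {n} l with m <ᵇ n | ℕ.<ᵇ⇒< m n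
... | true | h = ⊥-elim (ℕ.<-irrefl refl (ℕ.≤-trans (h _) l))
... | false | _ = refl

≤ᵇ-true : ∀ {m n} → m ℕ.≤ n → (m ≤ᵇ n) ≡ true
≤ᵇ-true {m} {n} l with m ≤ᵇ n | ℕ.≤⇒≤ᵇ l
... | true | _ = refl

≤ᵇ⇒≤ : ∀ {m n} → (m ≤ᵇ n) ≡ true → m ℕ.≤ n
≤ᵇ⇒≤ {m} {n} h = ℕ.≤ᵇ⇒≤ m n (≡.subst 𝔹.T (sym h) _)

≤ᵇ-false : ∀ {m n} → n ℕ.< m → (m ≤ᵇ n) ≡ false
≤ᵇ-false {m} {n} l with m ≤ᵇ n in eq
... | true = ⊥-elim (ℕ.<⇒≱ l (≤ᵇ⇒≤ eq))
... | false = refl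

-- A position is counted in its own rank but not in the rank of any smaller value, so ranks are
-- ordered as the values are.
rank-order : ∀ k (f : Fin k → ℕ) g h → (marked k (λ i → f i ≤ᵇ f g) <ᵇ marked k (λ i → f i ≤ᵇ f h)) ≡ (f g <ᵇ f h)
rank-order k f g h with f g ℕ.<? f h
... | yes l = trans (<ᵇ-true (marked-strict k (λ i e → ≤ᵇ-true {f i} {f h} (ℕ.≤-trans (≤ᵇ⇒≤ {f i} {f g} e) (ℕ.<⇒≤ l))) h (≤ᵇ-false {f h} {f g} l) (≤ᵇ-true {f h} {f h} ℕ.≤-refl))) (sym (<ᵇ-true l))
... | no ¬l = trans (<ᵇ-false (marked-mono k (λ i e → ≤ᵇ-true {f i} {f g} (ℕ.≤-trans (≤ᵇ⇒≤ {f i} {f h} e) (ℕ.≮⇒≥ ¬l))))) (sym (<ᵇ-false (ℕ.≮⇒≥ ¬l)))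

∈?-tabulate : ∀ {k} (f : Fin k → Bool) i → does (i ∈? Vec.tabulate f) ≡ f i
∈?-tabulate {suc k} f zero with f zero
... | true = refl
... | false = refl
∈?-tabulate {suc k} f (suc i) = ∈?-tabulate (f ∘ suc) i

inv-mem : ∀ k {mem mem′ : Fin k → Bool} (w : Fin k → ℕ) → mem ≗ mem′ → inv k mem w ≡ inv k mem′ w
inv-mem zero w h = refl
inv-mem (suc k) w h = cong₂ ℕ._+_ (cong₂ (λ b x → if b then x else 0) (h zero) (marked-cong k (λ i → cong (_∧ (w (suc i) <ᵇ w zero)) (h (suc i)))))
  (inv-mem k (w ∘ suc) (h ∘ suc))

inversions-restrict : ∀ {k} (τ : Permutation′ k) (mem : Fin k → Bool) →
  inversions (restrict τ (Vec.tabulate mem)) ≡ inv k mem (toℕ ∘ (τ ⟨$⟩ʳ_))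
inversions-restrict {k} τ mem = begin
  inversions (restrict τ M′) ≡⟨ inversions≡inv (restrict τ M′) ⟩
  inv ℓ (λ _ → true) (restrict τ M′)
    ≡⟨ inv-cong ℓ (λ _ → true) (λ g h → trans (cong₂ _<ᵇ_ (length-filter-tabulate (λ i → (τ ⟨$⟩ʳ j i) Fin.≤? (τ ⟨$⟩ʳ j g)) ℓ id) (length-filter-tabulate (λ i → (τ ⟨$⟩ʳ j i) Fin.≤? (τ ⟨$⟩ʳ j h)) ℓ id))
      (rank-order ℓ (toℕ ∘ (τ ⟨$⟩ʳ_) ∘ j) g h)) ⟩
  inv ℓ (λ _ → true) (toℕ ∘ (τ ⟨$⟩ʳ_) ∘ j) ≡⟨ inv-lookup (_∈? M′) k id (toℕ ∘ (τ ⟨$⟩ʳ_)) ⟩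
  inv k (λ i → does (i ∈? M′)) (toℕ ∘ (τ ⟨$⟩ʳ_)) ≡⟨ inv-mem k _ (∈?-tabulate mem) ⟩
  inv k mem (toℕ ∘ (τ ⟨$⟩ʳ_)) ∎
  where
  open ≡.≡-Reasoning
  M′ = Vec.tabulate mem
  ℓ = length (elements M′)
  j = lookup (elements M′)

markedBefore : ∀ {k} → (Fin k → Bool) → Fin k → ℕ
markedBefore mem zero = 0
markedBefore mem (suc j) = (if mem zero then 1 else 0) ℕ.+ markedBefore (mem ∘ suc) j

-- The least value, at position `j`, is inverted exactly with the earlier positions in `mem`;
-- removing it shifts all other values by one.
inv-insert : ∀ k (mem : Fin (suc k) → Bool) j {w w′} → w j ≡ 0 → (∀ i → w (punchIn j i) ≡ suc (w′ i)) →
  inv (suc k) mem w ≡ (if mem j then markedBefore mem j else 0) ℕ.+ inv k (mem ∘ punchIn j) w′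
inv-insert k mem zero {w} {w′} h₀ h = cong₂ ℕ._+_ none (inv-cong k (mem ∘ suc) (λ i i′ → cong₂ _<ᵇ_ (h i) (h i′)))
  where
  none : (if mem zero then marked k (λ i → mem (suc i) ∧ (w (suc i) <ᵇ w zero)) else 0) ≡ (if mem zero then 0 else 0)
  none = cong (λ x → if mem zero then x else 0) (marked-false k (λ i → trans (cong (λ y → mem (suc i) ∧ (w (suc i) <ᵇ y)) h₀) (Bool.∧-zeroʳ (mem (suc i)))))
inv-insert (suc k) mem (suc j) {w} {w′} h₀ h = trans (cong₂ ℕ._+_ (cong (λ x → if mem zero then x else 0) head) (inv-insert k (mem ∘ suc) j {w ∘ suc} {w′ ∘ suc} h₀ (h ∘ suc)))
  (arith (mem zero) (mem (suc j)) _ _ _)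
  where
  p : Fin (suc k) → Bool
  p i = mem (suc i) ∧ (w (suc i) <ᵇ w zero)
  head : marked (suc k) p ≡ (if mem (suc j) then 1 else 0) ℕ.+ marked k (λ i → mem (suc (punchIn j i)) ∧ (w′ (suc i) <ᵇ w′ zero))
  head = trans (marked-punchIn k p j) (cong₂ ℕ._+_
    (cong (λ b → if b then 1 else 0) (trans (cong (mem (suc j) ∧_) (cong₂ _<ᵇ_ h₀ (h zero))) (Bool.∧-identityʳ (mem (suc j)))))
    (marked-cong k (λ i → cong (mem (suc (punchIn j i)) ∧_) (cong₂ _<ᵇ_ (h (suc i)) (h zero)))))
  arith : ∀ b c x y z → (if b then (if c then 1 else 0) ℕ.+ x else 0) ℕ.+ ((if c then y else 0) ℕ.+ z) ≡
    (if c then (if b then 1 else 0) ℕ.+ y else 0) ℕ.+ ((if b then x else 0) ℕ.+ z)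
  arith true true x y z = cong suc (trans (sym (ℕ.+-assoc x y z)) (trans (cong (ℕ._+ z) (ℕ.+-comm x y)) (ℕ.+-assoc y x z)))
  arith true false x y z = refl
  arith false true x y z = refl
  arith false false x y z = refl

punchIn-order : ∀ {k} (j : Fin (suc k)) a b → (toℕ (punchIn j a) <ᵇ toℕ (punchIn j b)) ≡ (toℕ a <ᵇ toℕ b)
punchIn-order zero a b = refl
punchIn-order (suc j) zero zero = refl
punchIn-order (suc j) zero (suc b) = refl
punchIn-order (suc j) (suc a) zero = refl
punchIn-order (suc j) (suc a) (suc b) = punchIn-order j a b

marked-below : ∀ {k} (j : Fin (suc k)) → marked k (λ i → toℕ (punchIn j i) <ᵇ toℕ j) ≡ toℕ j
marked-below {k} zero = marked-false k (λ _ → refl)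
marked-below {suc k} (suc j) = cong suc (marked-below j)

module _ {k} (j : Fin (suc k)) (π : Permutation′ k) where
  private σ = insert zero j π

  insert-suc : ∀ i → σ ⟨$⟩ʳ suc i ≡ punchIn j (π ⟨$⟩ʳ i)
  insert-suc = Perm.insert-punchIn zero j π

  -- The first value `j` is inverted with each of the smaller values, all of which come later.
  inv-insert-word : inv (suc k) (λ _ → true) (toℕ ∘ (σ ⟨$⟩ʳ_)) ≡ toℕ j ℕ.+ inv k (λ _ → true) (toℕ ∘ (π ⟨$⟩ʳ_))
  inv-insert-word = cong₂ ℕ._+_
    (trans (marked-cong k (λ i → cong (λ x → toℕ x <ᵇ toℕ j) (insert-suc i))) (trans (marked-permute k (λ i → toℕ (punchIn j i) <ᵇ toℕ j) π) (marked-below j)))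
    (inv-cong k (λ _ → true) (λ i i′ → trans (cong₂ (λ x y → toℕ x <ᵇ toℕ y) (insert-suc i) (insert-suc i′)) (punchIn-order j (π ⟨$⟩ʳ i) (π ⟨$⟩ʳ i′))))

  inv-insert-flip : ∀ (mem : Fin (suc k) → Bool) → inv (suc k) mem (toℕ ∘ (flip σ ⟨$⟩ʳ_)) ≡
    (if mem j then markedBefore mem j else 0) ℕ.+ inv k (mem ∘ punchIn j) (toℕ ∘ (flip π ⟨$⟩ʳ_))
  inv-insert-flip mem = inv-insert k mem j {toℕ ∘ (flip σ ⟨$⟩ʳ_)} {toℕ ∘ (flip π ⟨$⟩ʳ_)} (cong toℕ (Perm.inverseˡ σ {zero})) (λ i → cong toℕ (trans
    (cong (σ ⟨$⟩ˡ_) (sym (trans (insert-suc (π ⟨$⟩ˡ i)) (cong (punchIn j) (Perm.inverseʳ π))))) (Perm.inverseˡ σ {suc (π ⟨$⟩ˡ i)})))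

-- The signed sum over permutations as a recursion on the first edge

sign : ℕ → ℤ
sign e = -1ℤ ℤ.^ e

sign-* : ∀ e x → sign e ℤ.* x ≡ iter ℤ.-_ e x
sign-* zero x = ℤ.*-identityˡ x
sign-* (suc e) x = trans (ℤ.*-assoc -1ℤ (sign e) x) (trans (ℤ.-1*i≡-i _) (cong ℤ.-_ (sign-* e x)))

iter-+ : ∀ a b x → iter ℤ.-_ (a ℕ.+ b) x ≡ iter ℤ.-_ a (iter ℤ.-_ b x)
iter-+ zero b x = refl
iter-+ (suc a) b x = cong ℤ.-_ (iter-+ a b x)

iter-double : ∀ a x → iter ℤ.-_ (a ℕ.+ a) x ≡ x
iter-double zero x = refl
iter-double (suc a) x = trans (cong ℤ.-_ (trans (cong (λ e → iter ℤ.-_ e x) (ℕ.+-suc a a)) refl)) (trans (ℤ.neg-involutive _) (iter-double a x))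

position : ∀ {k} (tp : Fin k → Bool) j → toℕ j ≡ unmarkedBefore tp j ℕ.+ markedBefore tp j
position tp zero = refl
position tp (suc j) with tp zero
... | true = trans (cong suc (position (tp ∘ suc) j)) (sym (ℕ.+-suc _ _))
... | false = cong suc (position (tp ∘ suc) j)

weight : ∀ {k} → (Fin k → Bool) → Permutation′ k → ℤ
weight {k} tp σ = sign (inv k (λ _ → true) (toℕ ∘ (σ ⟨$⟩ʳ_))) ℤ.* sign (inv k tp (toℕ ∘ (flip σ ⟨$⟩ʳ_)))

-- Choosing edge `j` first costs j inversions and, if it is marked, one more for each earlier marked
-- edge. As j already counts these, they occur twice and cancel, leaving the earlier unmarked edges.
weight-insert : ∀ {k} tp (j : Fin (suc k)) π → weight tp (insert zero j π) ≡ iter ℤ.-_ (exponent tp j) (weight (tp ∘ punchIn j) π)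
weight-insert {k} tp j π = begin
  weight tp (insert zero j π) ≡⟨ cong₂ (λ a b → sign a ℤ.* sign b) (inv-insert-word j π) (inv-insert-flip j π tp) ⟩
  sign (toℕ j ℕ.+ I) ℤ.* sign (c ℕ.+ I′) ≡⟨ sign-* (toℕ j ℕ.+ I) _ ⟩
  iter ℤ.-_ (toℕ j ℕ.+ I) (sign (c ℕ.+ I′)) ≡⟨ cong (iter ℤ.-_ (toℕ j ℕ.+ I)) (as-iter (c ℕ.+ I′)) ⟩
  iter ℤ.-_ (toℕ j ℕ.+ I) (iter ℤ.-_ (c ℕ.+ I′) 1ℤ) ≡⟨ iter-+ (toℕ j ℕ.+ I) (c ℕ.+ I′) 1ℤ ⟨
  iter ℤ.-_ ((toℕ j ℕ.+ I) ℕ.+ (c ℕ.+ I′)) 1ℤ ≡⟨ cong (λ e → iter ℤ.-_ e 1ℤ) (shuffle (toℕ j) I c I′) ⟩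
  iter ℤ.-_ ((toℕ j ℕ.+ c) ℕ.+ (I ℕ.+ I′)) 1ℤ ≡⟨ iter-+ (toℕ j ℕ.+ c) (I ℕ.+ I′) 1ℤ ⟩
  iter ℤ.-_ (toℕ j ℕ.+ c) (iter ℤ.-_ (I ℕ.+ I′) 1ℤ) ≡⟨ parity (tp j) (iter ℤ.-_ (I ℕ.+ I′) 1ℤ) ⟩
  iter ℤ.-_ (exponent tp j) (iter ℤ.-_ (I ℕ.+ I′) 1ℤ)
    ≡⟨ cong (iter ℤ.-_ (exponent tp j)) (trans (iter-+ I I′ 1ℤ) (trans (cong (iter ℤ.-_ I) (sym (as-iter I′))) (sym (sign-* I (sign I′))))) ⟩
  iter ℤ.-_ (exponent tp j) (sign I ℤ.* sign I′) ∎
  where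
  open ≡.≡-Reasoning
  I = inv k (λ _ → true) (toℕ ∘ (π ⟨$⟩ʳ_))
  I′ = inv k (tp ∘ punchIn j) (toℕ ∘ (flip π ⟨$⟩ʳ_))
  c = if tp j then markedBefore tp j else 0
  as-iter : ∀ e → sign e ≡ iter ℤ.-_ e 1ℤ
  as-iter e = trans (sym (ℤ.*-identityʳ (sign e))) (sign-* e 1ℤ)
  shuffle : ∀ a b c d → (a ℕ.+ b) ℕ.+ (c ℕ.+ d) ≡ (a ℕ.+ c) ℕ.+ (b ℕ.+ d)
  shuffle a b c d = trans (ℕ.+-assoc a b (c ℕ.+ d)) (trans (cong (a ℕ.+_) (trans (sym (ℕ.+-assoc b c d)) (trans (cong (ℕ._+ d) (ℕ.+-comm b c)) (ℕ.+-assoc c b d)))) (sym (ℕ.+-assoc a c (b ℕ.+ d))))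
  parity : ∀ b x → iter ℤ.-_ (toℕ j ℕ.+ (if b then markedBefore tp j else 0)) x ≡ iter ℤ.-_ (if b then unmarkedBefore tp j else toℕ j) x
  parity false x = cong (λ e → iter ℤ.-_ e x) (ℕ.+-identityʳ (toℕ j))
  parity true x = trans (cong (λ e → iter ℤ.-_ e x) (trans (cong (ℕ._+ markedBefore tp j) (position tp j)) (ℕ.+-assoc (unmarkedBefore tp j) _ _)))
    (trans (iter-+ (unmarkedBefore tp j) _ x) (cong (iter ℤ.-_ (unmarkedBefore tp j)) (iter-double (markedBefore tp j) x)))

total : {A : Set} → (A → ℤ) → List A → ℤ
total f xs = foldr ℤ._+_ 0ℤ (map f xs)

total-cong : ∀ {A : Set} {f g : A → ℤ} → f ≗ g → ∀ xs → total f xs ≡ total g xs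
total-cong h [] = refl
total-cong h (x ∷ xs) = cong₂ ℤ._+_ (h x) (total-cong h xs)

total-filter : ∀ {A : Set} {P : A → Set} (P? : Decidable P) (f : A → ℤ) xs → total f (filter P? xs) ≡ total (λ x → if does (P? x) then f x else 0ℤ) xs
total-filter P? f [] = refl
total-filter P? f (x ∷ xs) with does (P? x)
... | true = cong (λ z → f x ℤ.+ z) (total-filter P? f xs)
... | false = trans (total-filter P? f xs) (sym (ℤ.+-identityˡ _))

total-++ : ∀ {A : Set} (f : A → ℤ) xs ys → total f (xs ++ ys) ≡ total f xs ℤ.+ total f ys
total-++ f [] ys = sym (ℤ.+-identityˡ _)
total-++ f (x ∷ xs) ys = trans (cong (λ z → f x ℤ.+ z) (total-++ f xs ys)) (sym (ℤ.+-assoc (f x) _ _))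

total-map : ∀ {A B : Set} (f : B → ℤ) (h : A → B) xs → total f (map h xs) ≡ total (f ∘ h) xs
total-map f h [] = refl
total-map f h (x ∷ xs) = cong (λ z → f (h x) ℤ.+ z) (total-map f h xs)

total-product : ∀ {A B C : Set} (f : C → ℤ) (h : A → B → C) xs ys → total f (cartesianProductWith h xs ys) ≡ total (λ x → total (λ y → f (h x y)) ys) xs
total-product f h [] ys = refl
total-product f h (x ∷ xs) ys = trans (total-++ f (map (h x) ys) _) (cong₂ ℤ._+_ (total-map f (h x) ys) (total-product f h xs ys))

total-tabulate : ∀ {A : Set} k (f : A → ℤ) (g : Fin k → A) → total f (tabulate g) ≡ fold ℤ._+_ 0ℤ (f ∘ g)
total-tabulate zero f g = sym (fold-zero _ _ _)
total-tabulate (suc k) f g = trans (cong (λ z → f (g zero) ℤ.+ z) (total-tabulate k f (g ∘ suc))) (sym (fold-suc _ _ _))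

total-0 : ∀ {A : Set} (xs : List A) → total (λ _ → 0ℤ) xs ≡ 0ℤ
total-0 [] = refl
total-0 (x ∷ xs) = trans (ℤ.+-identityˡ _) (total-0 xs)

total-iter : ∀ {A : Set} e (f : A → ℤ) xs → total (λ x → iter ℤ.-_ e (f x)) xs ≡ iter ℤ.-_ e (total f xs)
total-iter zero f xs = refl
total-iter (suc e) f xs = trans (neg xs) (cong ℤ.-_ (total-iter e f xs))
  where
  neg : ∀ xs → total (λ x → ℤ.- iter ℤ.-_ e (f x)) xs ≡ ℤ.- total (λ x → iter ℤ.-_ e (f x)) xs
  neg [] = refl
  neg (x ∷ xs) = trans (cong (λ z → ℤ.- iter ℤ.-_ e (f x) ℤ.+ z) (neg xs)) (sym (ℤ.neg-distrib-+ (iter ℤ.-_ e (f x)) _))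

fold-cong : ∀ {k} {f g : Fin k → ℤ} → f ≗ g → fold ℤ._+_ 0ℤ f ≡ fold ℤ._+_ 0ℤ g
fold-cong {zero} h = trans (fold-zero _ _ _) (sym (fold-zero _ _ _))
fold-cong {suc k} h = trans (fold-suc _ _ _) (trans (cong₂ ℤ._+_ (h zero) (fold-cong (h ∘ suc))) (sym (fold-suc _ _ _)))

module _ {n : ℕ} where

  walk? : ∀ {k} (src tgt : Fin k → Fin n) (t : Fin n) l → (Fin l → Fin k) → Fin n → Bool
  walk? src tgt t zero e v = does (v Fin.≟ t)
  walk? src tgt t (suc l) e v = does (src (e zero) Fin.≟ v) ∧ walk? src tgt t l (e ∘ suc) (tgt (e zero))

  walk?-cong : ∀ {k k′} {src tgt : Fin k → Fin n} {src′ tgt′ : Fin k′ → Fin n} t l {e : Fin l → Fin k} {e′ : Fin l → Fin k′} →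
    src ∘ e ≗ src′ ∘ e′ → tgt ∘ e ≗ tgt′ ∘ e′ → ∀ v → walk? src tgt t l e v ≡ walk? src′ tgt′ t l e′ v
  walk?-cong t zero hs ht v = refl
  walk?-cong {src′ = src′} {tgt′} t (suc l) {e′ = e′} hs ht v = cong₂ _∧_ (cong (λ x → does (x Fin.≟ v)) (hs zero))
    (trans (walk?-cong t l (hs ∘ suc) (ht ∘ suc) _) (cong (walk? src′ tgt′ t l (e′ ∘ suc)) (ht zero)))

  -- `permutations` ranges over the first value and a permutation of the rest, that is, over the
  -- first edge and the trails through the other edges renumbered by `punchIn j`.
  total-trails : ∀ k tp (src tgt : Fin k → Fin n) t v →
    total (λ σ → if walk? src tgt t k (σ ⟨$⟩ʳ_) v then weight tp σ else 0ℤ) (permutations k) ≡ trails ℤ._+_ ℤ.-_ 0ℤ 1ℤ k tp src tgt t v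
  total-trails zero tp src tgt t v = ℤ.+-identityʳ _
  total-trails (suc k) tp src tgt t v = begin
    total f (cartesianProductWith (insert zero) (allFin (suc k)) (permutations k))
      ≡⟨ total-product f (insert zero) (allFin (suc k)) (permutations k) ⟩
    total (λ j → total (λ π → f (insert zero j π)) (permutations k)) (allFin (suc k)) ≡⟨ total-tabulate (suc k) _ id ⟩
    fold ℤ._+_ 0ℤ (λ j → total (λ π → f (insert zero j π)) (permutations k)) ≡⟨ fold-cong step ⟩
    trails ℤ._+_ ℤ.-_ 0ℤ 1ℤ (suc k) tp src tgt t v ∎
    where
    open ≡.≡-Reasoning
    f : Permutation′ (suc k) → ℤ
    f σ = if walk? src tgt t (suc k) (σ ⟨$⟩ʳ_) v then weight tp σ else 0ℤ
    tail : ∀ j π → walk? src tgt t k (λ i → insert zero j π ⟨$⟩ʳ suc i) (tgt j) ≡ walk? (src ∘ punchIn j) (tgt ∘ punchIn j) t k (π ⟨$⟩ʳ_) (tgt j)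
    tail j π = walk?-cong t k (λ i → cong src (insert-suc j π i)) (λ i → cong tgt (insert-suc j π i)) (tgt j)
    case : ∀ j c π → (if c ∧ walk? src tgt t k (λ i → insert zero j π ⟨$⟩ʳ suc i) (tgt j) then weight tp (insert zero j π) else 0ℤ) ≡
      (if c then iter ℤ.-_ (exponent tp j) (if walk? (src ∘ punchIn j) (tgt ∘ punchIn j) t k (π ⟨$⟩ʳ_) (tgt j) then weight (tp ∘ punchIn j) π else 0ℤ) else 0ℤ)
    case j false π = refl
    case j true π rewrite tail j π with walk? (src ∘ punchIn j) (tgt ∘ punchIn j) t k (π ⟨$⟩ʳ_) (tgt j)
    ... | true = weight-insert tp j π
    ... | false = sym (zeros (exponent tp j))
      where
      zeros : ∀ e → iter ℤ.-_ e 0ℤ ≡ 0ℤ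
      zeros zero = refl
      zeros (suc e) = cong ℤ.-_ (zeros e)
    step : ∀ j → total (λ π → f (insert zero j π)) (permutations k) ≡ (if does (src j Fin.≟ v)
      then iter ℤ.-_ (exponent tp j) (trails ℤ._+_ ℤ.-_ 0ℤ 1ℤ k (tp ∘ punchIn j) (src ∘ punchIn j) (tgt ∘ punchIn j) t (tgt j)) else 0ℤ)
    step j = trans (total-cong (case j (does (src j Fin.≟ v))) (permutations k)) (split (does (src j Fin.≟ v)))
      where
      g : Permutation′ k → ℤ
      g π = if walk? (src ∘ punchIn j) (tgt ∘ punchIn j) t k (π ⟨$⟩ʳ_) (tgt j) then weight (tp ∘ punchIn j) π else 0ℤ
      split : ∀ c → total (λ π → if c then iter ℤ.-_ (exponent tp j) (g π) else 0ℤ) (permutations k) ≡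
        (if c then iter ℤ.-_ (exponent tp j) (trails ℤ._+_ ℤ.-_ 0ℤ 1ℤ k (tp ∘ punchIn j) (src ∘ punchIn j) (tgt ∘ punchIn j) t (tgt j)) else 0ℤ)
      split true = trans (total-iter (exponent tp j) g (permutations k))
        (cong (iter ℤ.-_ (exponent tp j)) (total-trails k (tp ∘ punchIn j) (src ∘ punchIn j) (tgt ∘ punchIn j) t (tgt j)))
      split false = total-0 (permutations k)

-- Passage to the rationals and the edge count

open import Data.Nat.Base using (_≤_; _*_; _∸_)

fromℤ-+ : ∀ x y → fromℤ (x ℤ.+ y) ≡ fromℤ x ℚ.+ fromℤ y
fromℤ-+ x y = ℚ.toℚᵘ-injective (ℚᵘ.≃-trans
  (ℚᵘ.*≡* (cong (ℤ._* ℤ.+ 1) (sym (cong₂ ℤ._+_ (ℤ.*-identityʳ x) (ℤ.*-identityʳ y)))))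
  (ℚᵘ.≃-sym (ℚ.toℚᵘ-homo-+ (fromℤ x) (fromℤ y))))

fromℤ-neg : ∀ x → fromℤ (ℤ.- x) ≡ ℚ.- fromℤ x
fromℤ-neg x = ℚ.toℚᵘ-injective (ℚᵘ.≃-sym (ℚ.toℚᵘ-homo‿- (fromℤ x)))

fromℤ-fold : ∀ {k} (f : Fin k → ℤ) → fromℤ (fold ℤ._+_ 0ℤ f) ≡ fold ℚ._+_ 0ℚ (fromℤ ∘ f)
fromℤ-fold {zero} f = trans (cong fromℤ (fold-zero _ _ f)) (sym (fold-zero _ _ _))
fromℤ-fold {suc k} f = trans (cong fromℤ (fold-suc _ _ f)) (trans (fromℤ-+ (f zero) _)
  (trans (cong (fromℤ (f zero) ℚ.+_) (fromℤ-fold (f ∘ suc))) (sym (fold-suc _ _ _))))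

fold-congℚ : ∀ {k} {f g : Fin k → ℚ} → (∀ i → f i ≡ g i) → fold ℚ._+_ 0ℚ f ≡ fold ℚ._+_ 0ℚ g
fold-congℚ {zero} h = trans (fold-zero _ _ _) (sym (fold-zero _ _ _))
fold-congℚ {suc k} h = trans (fold-suc _ _ _) (trans (cong₂ ℚ._+_ (h zero) (fold-congℚ (h ∘ suc))) (sym (fold-suc _ _ _)))

-- `S` is an integer, while the algebra has rational coefficients; the same recursion computes both
-- sums.
fromℤ-trails : ∀ {n} k tp (src tgt : Fin k → Fin n) t v →
  fromℤ (trails ℤ._+_ ℤ.-_ 0ℤ 1ℤ k tp src tgt t v) ≡ trails ℚ._+_ ℚ.-_ 0ℚ 1ℚ k tp src tgt t v
fromℤ-trails zero tp src tgt t v with does (v Fin.≟ t)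
... | true = refl
... | false = refl
fromℤ-trails (suc k) tp src tgt t v = trans (fromℤ-fold _) (fold-congℚ (λ j → step j (does (src j Fin.≟ v))))
  where
  fromℤ-iter : ∀ e x → fromℤ (iter ℤ.-_ e x) ≡ iter ℚ.-_ e (fromℤ x)
  fromℤ-iter zero x = refl
  fromℤ-iter (suc e) x = trans (fromℤ-neg _) (cong ℚ.-_ (fromℤ-iter e x))
  step : ∀ j c → fromℤ (if c then iter ℤ.-_ (exponent tp j) (trails ℤ._+_ ℤ.-_ 0ℤ 1ℤ k (tp ∘ punchIn j) (src ∘ punchIn j) (tgt ∘ punchIn j) t (tgt j)) else 0ℤ)
    ≡ (if c then iter ℚ.-_ (exponent tp j) (trails ℚ._+_ ℚ.-_ 0ℚ 1ℚ k (tp ∘ punchIn j) (src ∘ punchIn j) (tgt ∘ punchIn j) t (tgt j)) else 0ℚ)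
  step j true = trans (fromℤ-iter (exponent tp j) _) (cong (iter ℚ.-_ (exponent tp j)) (fromℤ-trails k (tp ∘ punchIn j) (src ∘ punchIn j) (tgt ∘ punchIn j) t (tgt j)))
  step j false = refl

marked+unmarked : ∀ k tp → marked k tp ℕ.+ unmarked k tp ≡ k
marked+unmarked zero tp = refl
marked+unmarked (suc k) tp with tp zero
... | true = cong suc (marked+unmarked k (tp ∘ suc))
... | false = trans (ℕ.+-suc _ _) (cong suc (marked+unmarked k (tp ∘ suc)))

trails-zero : ∀ {n} → 2 ≤ n → ∀ k → k ≡ 4 * n ∸ 1 → ∀ tp → marked k tp ≤ 3 → ∀ (src tgt : Fin k → Fin n) t v →
  trails ℤ._+_ ℤ.-_ 0ℤ 1ℤ k tp src tgt t v ≡ 0ℤ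
trails-zero {suc (suc m)} (s≤s (s≤s z≤n)) k k≡ tp few src tgt t v = cong ℚ.numerator (trans (fromℤ-trails k tp src tgt t v)
  (Link.trails-vanish m k tp src tgt few (ℕ.+-cancelˡ-≤ 3 _ _ (ℕ.≤-trans (ℕ.≤-reflexive count) (ℕ.+-monoˡ-≤ (unmarked k tp) few))) t v))
  where
  n = 2 ℕ.+ m
  -- With m + n = 2n - 2, the 4n - 1 edges consist of 3 and twice m + n; as at most 3 are marked, at
  -- least 4n - 4 are not.
  expand : 4 * n ≡ suc (3 ℕ.+ ((m ℕ.+ n) ℕ.+ (m ℕ.+ n)))
  expand = solve 1 (λ m → con 4 :* (con 2 :+ m) := con 1 :+ (con 3 :+ ((m :+ (con 2 :+ m)) :+ (m :+ (con 2 :+ m))))) refl m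
    where open ℕ.+-*-Solver
  count : 3 ℕ.+ ((m ℕ.+ n) ℕ.+ (m ℕ.+ n)) ≡ marked k tp ℕ.+ unmarked k tp
  count = sym (trans (marked+unmarked k tp) (trans k≡ (cong (_∸ 1) expand)))

-- Trails of a doubly-rooted digraph

does-true : ∀ {A : Set} (d : Dec A) → does d ≡ true → A
does-true (yes a) _ = a

∧-true : ∀ {x y} → x ∧ y ≡ true → x ≡ true ⨯ y ≡ true
∧-true {true} {true} _ = refl , refl

module _ {K n : ℕ} (src tgt : Fin K → Fin n) (t : Fin n) where

  IsWalk : ∀ k → (Fin k → Fin K) → Fin n → Set
  IsWalk k e v = (∀ i → toℕ i ≡ 0 → src (e i) ≡ v) ⨯ (∀ i → suc (toℕ i) ≡ k → tgt (e i) ≡ t) ⨯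
    (∀ i j → toℕ j ≡ suc (toℕ i) → src (e j) ≡ tgt (e i))

  walk?-sound : ∀ l (e : Fin (suc l) → Fin K) v → walk? src tgt t (suc l) e v ≡ true → IsWalk (suc l) e v
  walk?-sound zero e v h with h₁ , h₂ ← ∧-true {does (src (e zero) Fin.≟ v)} h =
    (λ { zero _ → does-true (src (e zero) Fin.≟ v) h₁ }) , (λ { zero _ → does-true (tgt (e zero) Fin.≟ t) h₂ }) , (λ { zero zero () })
  walk?-sound (suc l) e v h with h₁ , h₂ ← ∧-true {does (src (e zero) Fin.≟ v)} h with first , last , next ← walk?-sound l (e ∘ suc) (tgt (e zero)) h₂ =
    (λ { zero _ → does-true (src (e zero) Fin.≟ v) h₁ }) , (λ { (suc i) eq → last i (ℕ.suc-injective eq) }) ,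
    (λ { zero (suc zero) _ → first zero refl ; (suc i) (suc j) eq → next i j (ℕ.suc-injective eq) })

  walk?-complete : ∀ l (e : Fin (suc l) → Fin K) v → IsWalk (suc l) e v → walk? src tgt t (suc l) e v ≡ true
  walk?-complete zero e v (first , last , _) = cong₂ _∧_ (dec-true (src (e zero) Fin.≟ v) (first zero refl)) (dec-true (tgt (e zero) Fin.≟ t) (last zero refl))
  walk?-complete (suc l) e v (first , last , next) = cong₂ _∧_ (dec-true (src (e zero) Fin.≟ v) (first zero refl))
    (walk?-complete l (e ∘ suc) (tgt (e zero)) ((λ { zero _ → next zero (suc zero) refl }) , (λ i eq → last (suc i) (cong suc eq)) ,
      (λ i j eq → next (suc i) (suc j) (cong suc eq))))

  -- Positivity of k matters: for k = 0 the conditions in `IsWalk` are vacuous, whereas `walk?`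
  -- still compares the two roots.
  does-walk : ∀ {k} → 0 ℕ.< k → (e : Fin k → Fin K) → ∀ v {P : Set} (d : Dec P) → (P → IsWalk k e v) → (IsWalk k e v → P) →
    does d ≡ walk? src tgt t k e v
  does-walk {suc l} _ e v d to from with walk? src tgt t (suc l) e v in eq
  ... | true = dec-true d (from (walk?-sound l e v eq))
  ... | false = dec-false d λ p → contradiction (trans (sym eq) (walk?-complete l e v (to p))) λ ()

card-tabulate : ∀ k (f : Fin k → Bool) → ∣ Vec.tabulate f ∣ ≡ marked k f
card-tabulate zero f = refl
card-tabulate (suc k) f with f zero
... | true = cong suc (card-tabulate k (f ∘ suc))
... | false = card-tabulate k (f ∘ suc)

open import Defs

module _ (G : DoublyRootedDigraph) (B : A G → Bool) where
  private
    index : V G → Fin (∣V∣ G)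
    index = Inverse.from (enumV G)

    index-injective : ∀ {x y} → index x ≡ index y → x ≡ y
    index-injective {x} {y} h = trans (sym (Inverse.strictlyInverseˡ (enumV G) x)) (trans (cong (Inverse.to (enumV G)) h) (Inverse.strictlyInverseˡ (enumV G) y))

    source target : Fin (∣A∣ G) → Fin (∣V∣ G)
    source j = index (_⁻ G (a G j))
    target j = index (_⁺ G (a G j))

    mem : Fin (∣A∣ G) → Bool
    mem = B ∘ a G

  S≡trails : 0 ℕ.< ∣A∣ G → S G B ≡ trails ℤ._+_ ℤ.-_ 0ℤ 1ℤ (∣A∣ G) mem source target (index (t G)) (index (s G))
  S≡trails pos = trans (total-filter (isTrail? G) f (permutations (∣A∣ G))) (trans (total-cong same (permutations (∣A∣ G)))
    (total-trails (∣A∣ G) mem source target (index (t G)) (index (s G))))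
    where
    f : Permutation′ (∣A∣ G) → ℤ
    f σ = sgn (toℕ ∘ (σ ⟨$⟩ʳ_)) ℤ.* sgn (restrict (flip σ) (M G B))
    weight-eq : ∀ σ → f σ ≡ weight mem σ
    weight-eq σ = cong₂ (λ x y → sign x ℤ.* sign y) (inversions≡inv (toℕ ∘ (σ ⟨$⟩ʳ_))) (inversions-restrict (flip σ) mem)
    trail : ∀ σ → does (isTrail? G σ) ≡ walk? source target (index (t G)) (∣A∣ G) (σ ⟨$⟩ʳ_) (index (s G))
    trail σ = does-walk source target (index (t G)) pos (σ ⟨$⟩ʳ_) (index (s G)) (isTrail? G σ)
      (λ (x , y , z) → (λ i e → cong index (x i e)) , (λ i e → cong index (y i e)) , (λ i j e → cong index (z i j e)))
      (λ (x , y , z) → (λ i e → index-injective (x i e)) , (λ i e → index-injective (y i e)) , (λ i j e → index-injective (z i j e)))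
    same : ∀ σ → (if does (isTrail? G σ) then f σ else 0ℤ) ≡ (if walk? source target (index (t G)) (∣A∣ G) (σ ⟨$⟩ʳ_) (index (s G)) then weight mem σ else 0ℤ)
    same σ = cong₂ (λ c x → if c then x else 0ℤ) (trail σ) (weight-eq σ)

  S-vanish : 2 ≤ ∣V∣ G → ∣A∣ G ≡ 4 * ∣V∣ G ∸ 1 → card G B ≤ 3 → S G B ≡ 0ℤ
  S-vanish 2≤n eq few = trans (S≡trails (≡.subst (0 ℕ.<_) (sym eq) (positive 2≤n)))
    (trails-zero 2≤n (∣A∣ G) eq mem (≡.subst (_≤ 3) (card-tabulate (∣A∣ G) mem) few) source target (index (t G)) (index (s G)))
    where
    positive : ∀ {n} → 2 ≤ n → 0 ℕ.< 4 * n ∸ 1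
    positive {suc (suc n)} (s≤s (s≤s z≤n)) = s≤s z≤n

theorem4p2 : (n : ℕ) → 2 ≤ n → (G : DoublyRootedDigraph) →
    ∣V∣ G ≡ n → ∣A∣ G ≡ 4 * n ∸ 1 →
    (B : A G → Bool) → card G B ≤ 3 → T G B ≡ 0
theorem4p2 n 2≤n G refl edges B few = cong ℤ.∣_∣ (S-vanish G B 2≤n edges few)
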